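{- Let $q$ be a prime power, let $d\ge2$ be an integer, and let $g$ be a positive integer. Suppose $$q^{d-2}\mid g,\qquad \eta:=\frac{g}{q^{d-2}}\ \text{ divides }\ q^d-1,$$ and define $\rho:=\gcd(\eta,q-1)$. Then there is a modular $g$-Golomb ruler with at least $$q^{d-1}-\frac{q^{d-2}(\eta-\rho)}2$$ marks modulo $$\frac{q^{d-2}(q^d-1)}{g}.$$ Consequently, for every positive integer $$n\le q^{d-1}-\frac{q^{d-2}(\eta-\rho)}2,$$ writing $n=ag+r$ with integers $a,r$ and $0\le r<g$, one has $$G(g,n)\le \frac{q^{d-2}(q^d-1)}{g}-\left\lceil \frac{\frac{q^{d-2}(q^d-1)}{g}+\frac{g a(a-1)}2+ra}{n}\right\rceil.$$
   Context: A finite set $\mathcal{G}\subset\mathbb{Z}$ is a $g$-Golomb ruler if for every positive integer $d$ the number of pairs $(a,c)\in \mathcal{G}^2$ with $c-a=d$ is at most $g$. $G(g,n)$ denotes the minimum possible diameter (largest element minus smallest element) of a $g$-Golomb ruler with exactly $n$ elements (marks). A set $\mathcal{A}$ of residues modulo $N$ is a modular $g$-Golomb ruler modulo $N$ if every nonzero residue modulo $N$ occurs at most $g$ times as a difference $a-a' \pmod N$ with $(a,a')$ an ordered pair of distinct elements of $\mathcal{A}$; its elements are called marks. -}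

module Defs where

open import Data.Fin as Fin using (Fin; toℕ)
open import Data.Integer as ℤ using (ℤ; +_)
open import Data.List using (List; length; filter; cartesianProduct)
open import Data.List.Membership.Propositional using (_∈_)
open import Data.List.Relation.Unary.Unique.Propositional using (Unique)
open import Data.Nat as ℕ using (ℕ)
open import Data.Nat.Divisibility using (_∣?_)
open import Data.Nat.Primality using (Prime)
open import Data.Integer.Divisibility as ℤDiv using ()
open import Data.Product using (_×_; _,_; ∃; ∃-syntax)
open import Relation.Binary.PropositionalEquality using (_≡_; _≢_)
open import Relation.Nullary.Decidable using (Dec; ¬?; _×-dec_)

IsPrimePower : ℕ → Set
IsPrimePower q = ∃[ p ] ∃[ k ] (Prime p × 1 ℕ.≤ k × q ≡ p ℕ.^ k)

-- Finite sets are duplicate-free lists, so that `length` is the cardinality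
-- and `cartesianProduct S S` enumerates each pair of S² exactly once.

pairsWithDifference : List ℤ → ℤ → List (ℤ × ℤ)
pairsWithDifference S d =
  filter (λ (a , c) → (c ℤ.- a) ℤ.≟ d) (cartesianProduct S S)

IsGolombRuler : ℕ → List ℤ → Set
IsGolombRuler g S =
  Unique S × (∀ d → + 0 ℤ.< d → length (pairsWithDifference S d) ℕ.≤ g)

HasDiameter : List ℤ → ℤ → Set
HasDiameter S m = ∃[ lo ] ∃[ hi ]
  (lo ∈ S × hi ∈ S × (∀ x → x ∈ S → lo ℤ.≤ x × x ℤ.≤ hi) × m ≡ hi ℤ.- lo)

IsRulerDiameter : ℕ → ℕ → ℤ → Set
IsRulerDiameter g n m =
  ∃[ S ] (IsGolombRuler g S × length S ≡ n × HasDiameter S m)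

-- The graph of G: `IsG g n m` says that G(g,n) is defined and equal to m.
IsG : ℕ → ℕ → ℤ → Set
IsG g n m =
  IsRulerDiameter g n m × (∀ m′ → IsRulerDiameter g n m′ → m ℤ.≤ m′)

-- Residues modulo N are represented by Fin N.
DifferMod : (N : ℕ) → Fin N → Fin N → Fin N → Set
DifferMod N a a′ d = + N ℤDiv.∣ (+ toℕ a ℤ.- + toℕ a′) ℤ.- + toℕ d

differMod? : ∀ N (a a′ d : Fin N) → Dec (DifferMod N a a′ d)
differMod? N a a′ d = N ∣? ℤ.∣ (+ toℕ a ℤ.- + toℕ a′) ℤ.- + toℕ d ∣

pairsWithDifferenceMod : ∀ {N} → List (Fin N) → Fin N → List (Fin N × Fin N)
pairsWithDifferenceMod {N} A d =
  filter (λ (a , a′) → ¬? (a Fin.≟ a′) ×-dec differMod? N a a′ d)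
         (cartesianProduct A A)

IsModularGolombRuler : ℕ → (N : ℕ) → List (Fin N) → Set
IsModularGolombRuler g N A =
  Unique A ×
  (∀ (d : Fin N) → toℕ d ≢ 0 → length (pairsWithDifferenceMod A d) ℕ.≤ g)

{-# OPTIONS --safe #-}
-- Let θ generate the multiplicative group of 𝔽_(q^d), let Tr be the trace to 𝔽_q and
-- B = {i mod q^d − 1 : Tr θⁱ = 1}. Then |B| = q^(d−1), and for θˢ ≠ 1 the set B meets
-- its translate by s in at most q^(d−2) points, and in none if θˢ ∈ 𝔽_q. Both are root
-- counts: for c ∉ 𝔽_q, c Tr y − Tr (c y) is a polynomial of degree q^(d−2) in y^q.
-- Now reduce B modulo N = (q^d − 1)/η. A nonzero residue has η lifts, hence occurs at
-- most g = η q^(d−2) times as a difference. Of the η multiples s of N, ρ have θˢ ∈ 𝔽_q,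
-- so at most q^(d−2) (η − ρ) ordered pairs of B collide, and each class of m colliding
-- elements loses m − 1 ≤ m (m − 1)/2 marks.
--
-- Among n marks on the circle ℤ/N each gap length occurs at most g times. The gaps add
-- up to N, which forces the longest gap M to satisfy n M ≥ N + g a (a − 1)/2 + r a;
-- cutting the circle there leaves a ruler of diameter N − M.
--
-- The field: with Q = q^d, every element of the group ring 𝔽_p[ℤ/(Q − 1)] satisfies
-- a^Q = a, so a suitable idempotent e cuts out a field. The generator θ keeps its order
-- in it if e lies in the ideal of v = ∏ (θ^((Q−1)/r) − 1), r running over the primes
-- dividing Q − 1; and v ≠ 0 since the coefficient of 1 in v is ±1.
module Submission where

-- In the group ring the generator θ of order Q - 1 is there from the start, and equality is
-- decidable by comparing finitely many coefficients. What is in doubt is the size of a factor: it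
-- contains 0 and the Q - 1 powers of θ, but could be larger. So e is chosen such that the
-- differences among 0, the θⁱ and the 1 + θⁱ, a finite list, all become zero or units. Then y^Q -
-- y, which vanishes everywhere, has at most Q roots among these elements. Hence 1 + θⁱ is zero or a
-- power of θ, and by taking out common factors so is every sum of powers. The lower bound on M
-- comes from comparing the gaps with n copies of M. The deficits M - gap repeat no more often than
-- the gaps do, so their sum n M - N is at least what it would be if each of 0, ..., a - 1 occurred
-- g times and a occurred r times, namely g a (a - 1)/2 + r a.

open import Defs
open import Algebra.Bundles using (CommutativeRing; module AbelianGroup)
open import Data.Empty using (⊥-elim)
open import Data.Fin as Fin using (Fin; toℕ)
import Data.Fin.Properties as Finₚ
open import Data.List using (List; []; _∷_; _++_; map; length; filter; upTo; cartesianProduct; cartesianProductWith; replicate; concat; applyUpTo; take)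
open import Data.List.Extrema.Nat using (argmin; argmax; f[argmin]≤f[xs]; argmin-sel; f[xs]≤f[argmax]; argmax-sel)
import Data.List.Membership.DecPropositional
open import Data.List.Membership.Propositional using (_∈_; find; lose)
open import Data.List.Membership.Propositional.Properties using (∈-∃++; ∈-++⁻; ∈-++⁺ˡ; ∈-++⁺ʳ; ∈-applyUpTo⁺; ∈-cartesianProductWith⁺; ∈-filter⁺; ∈-upTo⁺; ∈-upTo⁻; ∈-filter⁻; ∈-map⁺; ∈-map⁻)
open import Data.List.Properties using (length-++; length-map; length-applyUpTo; map-upTo; length-upTo; length-take)
open import Data.List.Relation.Binary.Sublist.Propositional using (_⊆_; []; _∷_; _∷ʳ_)
open import Data.List.Relation.Binary.Sublist.Propositional.Properties using (All-resp-⊆; take-⊆)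
open import Data.List.Relation.Unary.All as All using (All; []; _∷_; all?)
import Data.List.Relation.Unary.All.Properties as All
open import Data.List.Relation.Unary.AllPairs as AllPairs using ([]; _∷_; AllPairs)
import Data.List.Relation.Unary.AllPairs.Properties as AllPairs
open import Data.List.Relation.Unary.Any using (here; there; any?)
import Data.List.Relation.Unary.Unique.DecPropositional
open import Data.List.Relation.Unary.Unique.Propositional using (Unique)
import Data.List.Relation.Unary.Unique.Propositional.Properties as Unique
open import Data.Nat as ℕ using (ℕ; zero; suc; _+_; _*_; _∸_; _≤_; _<_; z≤n; s≤s; NonZero; _^_)
open import Data.Nat.Combinatorics using (nCn≡1; nCk≡n!/k![n-k]!) renaming (_C_ to _choose_)
open import Data.Nat.Combinatorics.Specification using ([n∸k]!k!∣n!)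
open import Data.Nat.DivMod using (_%_; _/_; m/n*n≡m; %-distribˡ-+; %-distribˡ-*; m≡m%n+[m/n]*n; m%n<n; m*n%n≡0; m<n⇒m%n≡m; _mod_; [m+kn]%n≡m%n; [m+n]%n≡m%n; m%n%n≡m%n)
open import Data.Nat.Divisibility using (_∣_; _∣?_; divides; quotient; ∣⇒≤; m∣m*n; ∣-trans; ∣m∣n⇒∣m+n; ∣m+n∣m⇒∣n; ∣n⇒∣m*n; ∣m⇒∣m*n; n∣m*n; _∣0; *-cancelʳ-∣; m%n≡0⇒n∣m; n∣m⇒m%n≡0; *-monoʳ-∣)
open import Data.Nat.GCD using (gcd; gcd-GCD; gcd[m,n]∣m; gcd[m,n]∣n; module Bézout)
open import Data.Nat.ListAction using (product)
open import Data.Nat.Primality using (Prime; euclidsLemma; prime⇒nonZero; ¬prime[0]; prime⇒nonTrivial; prime?)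
open import Data.Nat.Primality.Factorisation using (factorise; factorisationHasAllPrimeFactors; module PrimeFactorisation)
import Data.Nat.Properties as ℕₚ
open import Data.Nat.Tactic.RingSolver using (solve-∀)
open import Data.Product using (_×_; _,_; ∃-syntax; proj₁; proj₂; Σ-syntax; uncurry)
open import Data.Sum using (_⊎_; inj₁; inj₂)
open import Function using (_∘_; id)
open import Level using (0ℓ)
open import Relation.Binary.Definitions using (tri<; tri≈; tri>)
open import Relation.Binary.PropositionalEquality as ≡ using (_≡_; _≢_; module ≡-Reasoning)
open import Relation.Nullary using (¬_; Dec; yes; no)
open import Relation.Nullary.Decidable as Dec using (_×-dec_; ¬?; _⊎-dec_; _→-dec_)
open import Relation.Unary using (Decidable)

-- Polynomial functions

module Roots (R : CommutativeRing 0ℓ 0ℓ) where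
  open CommutativeRing R hiding (zero; _-_) renaming (_+_ to _⊕_; _*_ to _⊗_; -_ to ⊖_)
  open import Relation.Binary.Reasoning.Setoid setoid
  open import Algebra.Properties.Semiring.Exp semiring renaming (_^_ to _↑_)
  open import Algebra.Properties.Ring ring using (+-cancelˡ)

  open import Algebra.Solver.Ring.NaturalCoefficients.Default commutativeSemiring

  -- f is a polynomial function of degree at most m whose coefficient at
  -- y^m is c. The clause for suc m is a divided difference,
  -- f y − f x = (y − x) g y rearranged so as to avoid subtraction.
  Lead : ℕ → Carrier → (Carrier → Carrier) → Set
  Lead zero    c f = ∀ y → f y ≈ c
  Lead (suc m) c f = ∀ x → Σ[ g ∈ (Carrier → Carrier) ] Lead m c g × (∀ y → f y ⊕ x ⊗ g y ≈ f x ⊕ y ⊗ g y)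

  -- That x - y is not a zero divisor. This lets roots be counted in the factor `F` before it is
  -- known to be a field.
  Apart : Carrier → Carrier → Set
  Apart x y = ∀ z → x ⊗ z ≈ y ⊗ z → z ≈ 0#

  Lead-cong : ∀ m {c c′ f} → c ≈ c′ → Lead m c f → Lead m c′ f
  Lead-cong zero    c≈c′ L y = trans (L y) c≈c′
  Lead-cong (suc m) c≈c′ L x = let g , Lg , eq = L x in g , Lead-cong m c≈c′ Lg , eq

  Lead-⊕ : ∀ m {c c′ f f′} → Lead m c f → Lead m c′ f′ → Lead m (c ⊕ c′) (λ y → f y ⊕ f′ y)
  Lead-⊕ zero    L L′ y = +-cong (L y) (L′ y)
  Lead-⊕ (suc m) {f = f} {f′} L L′ x = let g , Lg , eq = L x ; g′ , Lg′ , eq′ = L′ x in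
    (λ y → g y ⊕ g′ y) , Lead-⊕ m Lg Lg′ , λ y → begin
      (f y ⊕ f′ y) ⊕ x ⊗ (g y ⊕ g′ y)        ≈⟨ shuffle (f y) (f′ y) x (g y) (g′ y) ⟩
      (f y ⊕ x ⊗ g y) ⊕ (f′ y ⊕ x ⊗ g′ y)    ≈⟨ +-cong (eq y) (eq′ y) ⟩
      (f x ⊕ y ⊗ g y) ⊕ (f′ x ⊕ y ⊗ g′ y)    ≈⟨ shuffle (f x) (f′ x) y (g y) (g′ y) ⟨
      (f x ⊕ f′ x) ⊕ y ⊗ (g y ⊕ g′ y)        ∎
    where
    shuffle : ∀ a b x c d → (a ⊕ b) ⊕ x ⊗ (c ⊕ d) ≈ (a ⊕ x ⊗ c) ⊕ (b ⊕ x ⊗ d)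
    shuffle = solve 5 (λ a b x c d → (a :+ b) :+ x :* (c :+ d) := (a :+ x :* c) :+ (b :+ x :* d)) refl

  Lead-⊗ : ∀ m k {c f} → Lead m c f → Lead m (k ⊗ c) (λ y → k ⊗ f y)
  Lead-⊗ zero    k L y = *-congˡ (L y)
  Lead-⊗ (suc m) k {f = f} L x = let g , Lg , eq = L x in
    (λ y → k ⊗ g y) , Lead-⊗ m k Lg , λ y → begin
      k ⊗ f y ⊕ x ⊗ (k ⊗ g y)  ≈⟨ shuffle k (f y) x (g y) ⟩
      k ⊗ (f y ⊕ x ⊗ g y)      ≈⟨ *-congˡ (eq y) ⟩
      k ⊗ (f x ⊕ y ⊗ g y)      ≈⟨ shuffle k (f x) y (g y) ⟨
      k ⊗ f x ⊕ y ⊗ (k ⊗ g y)  ∎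
    where
    shuffle : ∀ k a x b → k ⊗ a ⊕ x ⊗ (k ⊗ b) ≈ k ⊗ (a ⊕ x ⊗ b)
    shuffle = solve 4 (λ k a x b → k :* a :+ x :* (k :* b) := k :* (a :+ x :* b)) refl

  Lead-suc : ∀ m {c f} → Lead m c f → Lead (suc m) 0# f
  Lead-suc zero    L x = (λ _ → 0#) , (λ _ → refl) ,
    λ y → +-cong (trans (L y) (sym (L x))) (trans (zeroʳ x) (sym (zeroʳ y)))
  Lead-suc (suc m) L x = let g , Lg , eq = L x in g , Lead-suc m Lg , eq

  Lead-< : ∀ {m n c f} → m < n → Lead m c f → Lead n 0# f
  Lead-< m<n = go (ℕₚ.≤⇒≤′ m<n)
    where
    go : ∀ {m n c f} → suc m ℕ.≤′ n → Lead m c f → Lead n 0# f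
    go {m} ℕ.≤′-refl         L = Lead-suc m L
    go     (ℕ.≤′-step m<n) L = Lead-suc _ (go m<n L)

  Lead-var : ∀ m {c f} → Lead m c f → Lead (suc m) c (λ y → y ⊗ f y)
  Lead-var zero {f = f} L x = f , L , λ y →
    trans (+-comm _ _) (+-cong (*-congˡ (trans (L y) (sym (L x)))) refl)
  Lead-var (suc m) {f = f} L x = let g , Lg , eq = L x in
    -- The divided difference of y f(y): y f(y) - x f(x) = (y - x) f(y) + x (f(y) - f(x)).
    (λ y → f y ⊕ x ⊗ g y) ,
    Lead-cong (suc m) (trans (+-congˡ (zeroʳ x)) (+-identityʳ _)) (Lead-⊕ (suc m) L (Lead-⊗ (suc m) x (Lead-suc m Lg))) ,
    λ y → begin
      y ⊗ f y ⊕ x ⊗ (f y ⊕ x ⊗ g y)  ≈⟨ +-congˡ (*-congˡ (eq y)) ⟩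
      y ⊗ f y ⊕ x ⊗ (f x ⊕ y ⊗ g y)  ≈⟨ shuffle x y (f x) (f y) (g y) ⟩
      x ⊗ f x ⊕ y ⊗ (f y ⊕ x ⊗ g y)  ∎
    where
    shuffle : ∀ x y a b c → y ⊗ b ⊕ x ⊗ (a ⊕ y ⊗ c) ≈ x ⊗ a ⊕ y ⊗ (b ⊕ x ⊗ c)
    shuffle = solve 5 (λ x y a b c → y :* b :+ x :* (a :+ y :* c) := x :* a :+ y :* (b :+ x :* c)) refl

  Lead-↑ : ∀ m → Lead m 1# (_↑ m)
  Lead-↑ zero    y = refl
  Lead-↑ (suc m) = Lead-var m (Lead-↑ m)

  -- Dividing out the first point keeps the leading coefficient and lowers the degree, and the other
  -- points, being `Apart` from it, become roots of the divided difference. More than m points bring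
  -- this down to the constant c having a root. The step uses f y = f x alone, so any common value k
  -- serves in place of 0.
  roots⇒lead≈0 : ∀ m {c f} → Lead m c f → ∀ xs → All (λ x → f x ≈ 0#) xs → AllPairs Apart xs →
                 m < length xs → c ≈ 0#
  fibre⇒lead≈0 : ∀ m {c f} k → Lead (suc m) c f → ∀ xs → All (λ x → f x ≈ k) xs → AllPairs Apart xs →
                 suc m < length xs → c ≈ 0#

  roots⇒lead≈0 zero    L (x ∷ xs) (fx ∷ fxs) _  _   = trans (sym (L x)) fx
  roots⇒lead≈0 (suc m) L xs       fxs        ap m<n = fibre⇒lead≈0 m 0# L xs fxs ap m<n

  fibre⇒lead≈0 m {f = f} k L (x ∷ xs) (fx ∷ fxs) (ap ∷ aps) (s≤s m<n) = let g , Lg , eq = L x in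
    roots⇒lead≈0 m Lg xs
      (All.map (λ {y} (fy , x#y) → x#y (g y) (+-cancelˡ (f x) _ _ (trans (+-congʳ (trans fx (sym fy))) (eq y))))
               (All.zip (fxs , ap)))
      aps m<n

-- Binomial coefficients modulo p and the Frobenius map

prime∤! : ∀ {p} → Prime p → ∀ {k} → k < p → ¬ (p ∣ k ℕ.!)
prime∤! {p} pr {zero}  k<p p∣ = ℕₚ.<⇒≱ (ℕ.nonTrivial⇒n>1 p {{prime⇒nonTrivial pr}}) (∣⇒≤ p∣)
prime∤! {p} pr {suc k} k<p p∣ with euclidsLemma (suc k) (k ℕ.!) pr p∣
... | inj₁ p∣k+1 = ℕₚ.<⇒≱ k<p (∣⇒≤ p∣k+1)
... | inj₂ p∣k!  = prime∤! pr (ℕₚ.<-trans (ℕₚ.n<1+n k) k<p) p∣k!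

-- p divides p!, the product of the binomial coefficient with k! and (p - k)!, but neither of these
-- factorials.
prime∣choose : ∀ {p} → Prime p → ∀ {k} → 0 < k → k < p → p ∣ p choose k
prime∣choose {p} pr {k} 0<k k<p with euclidsLemma (p choose k) (k ℕ.! * (p ∸ k) ℕ.!) pr p∣product
  where
  p! : (p choose k) * (k ℕ.! * (p ∸ k) ℕ.!) ≡ p ℕ.!
  p! = ≡.trans (≡.cong (_* (k ℕ.! * (p ∸ k) ℕ.!)) (nCk≡n!/k![n-k]! (ℕₚ.<⇒≤ k<p)))
         (m/n*n≡m {{ℕₚ._!*_!≢0 k (p ∸ k)}} (≡.subst (_∣ p ℕ.!) (ℕₚ.*-comm ((p ∸ k) ℕ.!) (k ℕ.!)) ([n∸k]!k!∣n! (ℕₚ.<⇒≤ k<p))))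
  m∣m! : ∀ m → 0 < m → m ∣ m ℕ.!
  m∣m! (suc m) _ = m∣m*n (m ℕ.!)
  p∣product : p ∣ (p choose k) * (k ℕ.! * (p ∸ k) ℕ.!)
  p∣product = ≡.subst (p ∣_) (≡.sym p!) (m∣m! p (ℕₚ.<-trans 0<k k<p))
... | inj₁ p∣choose = p∣choose
... | inj₂ p∣k![p-k]! with euclidsLemma (k ℕ.!) _ pr p∣k![p-k]!
...   | inj₁ p∣k! = ⊥-elim (prime∤! pr k<p p∣k!)
...   | inj₂ p∣   = ⊥-elim (prime∤! pr (ℕₚ.∸-monoʳ-< 0<k (ℕₚ.<⇒≤ k<p)) p∣)

module Frobenius (R : CommutativeRing 0ℓ 0ℓ) where
  open CommutativeRing R hiding (zero; _-_) renaming (_+_ to _⊕_; _*_ to _⊗_; -_ to ⊖_)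
  open import Algebra.Properties.Semiring.Exp semiring renaming (_^_ to _↑_)
  open import Algebra.Properties.Semiring.Mult semiring using (×-congʳ; ×-congˡ; ×-assocˡ; ×-assoc-*; ×-homo-1) renaming (_×_ to _×#_)
  open import Algebra.Properties.Semiring.Sum semiring using (sum; sum-cong-≋; sum-init-last; sum-replicate-zero)
  open import Algebra.Properties.CommutativeSemiring.Binomial commutativeSemiring using (binomialTerm; theorem)
  open import Relation.Binary.Reasoning.Setoid setoid
  open import Data.Vec.Functional using (init; last)

  module _ {p} (pr : Prime p) (char : p ×# 1# ≈ 0#) where

    p∣⇒×≈0 : ∀ {m} z → p ∣ m → m ×# z ≈ 0#
    p∣⇒×≈0 {m} z (divides j ≡.refl) = begin
      (j * p) ×# z        ≈⟨ ×-congˡ {z} (ℕₚ.*-comm j p) ⟩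
      (p * j) ×# z        ≈⟨ ×-assocˡ z p j ⟨
      p ×# (j ×# z)       ≈⟨ ×-congʳ p (*-identityˡ _) ⟨
      p ×# (1# ⊗ (j ×# z)) ≈⟨ ×-assoc-* p 1# (j ×# z) ⟨
      (p ×# 1#) ⊗ (j ×# z) ≈⟨ *-congʳ char ⟩
      0# ⊗ (j ×# z)       ≈⟨ zeroˡ _ ⟩
      0#                  ∎

    frobenius : ∀ x y → (x ⊕ y) ↑ p ≈ x ↑ p ⊕ y ↑ p
    frobenius x y = go p ≡.refl
      where
      go : ∀ m → m ≡ p → (x ⊕ y) ↑ m ≈ x ↑ m ⊕ y ↑ m
      go zero ≡.refl = ⊥-elim (¬prime[0] pr)
      go (suc m) ≡.refl = begin
        (x ⊕ y) ↑ suc m                         ≈⟨ theorem (suc m) x y ⟩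
        t Fin.zero ⊕ sum (t ∘ Fin.suc)          ≈⟨ +-cong t0 (sum-init-last (t ∘ Fin.suc)) ⟩
        y ↑ suc m ⊕ (sum (init (t ∘ Fin.suc)) ⊕ last (t ∘ Fin.suc)) ≈⟨ +-congˡ (+-cong mid lst) ⟩
        y ↑ suc m ⊕ (0# ⊕ x ↑ suc m)            ≈⟨ +-congˡ (+-identityˡ _) ⟩
        y ↑ suc m ⊕ x ↑ suc m                   ≈⟨ +-comm _ _ ⟩
        x ↑ suc m ⊕ y ↑ suc m                   ∎
        where
        t = binomialTerm x y (suc m)
        t0 : t Fin.zero ≈ y ↑ suc m
        t0 = trans (×-homo-1 _) (*-identityˡ _)
        mid : sum (init (t ∘ Fin.suc)) ≈ 0#
        mid = trans (sum-cong-≋ {n = m} (λ i → p∣⇒×≈0 _ (prime∣choose pr (s≤s z≤n)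
                (s≤s (≡.subst (_< m) (≡.sym (Finₚ.toℕ-inject₁ i)) (Finₚ.toℕ<n i))))))
              (sum-replicate-zero m)
        lst : last (t ∘ Fin.suc) ≈ x ↑ suc m
        lst rewrite Finₚ.toℕ-fromℕ m | nCn≡1 (suc m) | ℕₚ.n∸n≡0 m = trans (×-homo-1 _) (*-identityʳ _)

    frobenius^ : ∀ m x y → (x ⊕ y) ↑ (p ^ m) ≈ x ↑ (p ^ m) ⊕ y ↑ (p ^ m)
    frobenius^ zero x y = begin
      (x ⊕ y) ⊗ 1#     ≈⟨ distribʳ 1# x y ⟩
      x ⊗ 1# ⊕ y ⊗ 1#  ∎
    frobenius^ (suc m) x y = begin
      (x ⊕ y) ↑ (p * p ^ m)                 ≈⟨ ^-assocʳ (x ⊕ y) p (p ^ m) ⟨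
      ((x ⊕ y) ↑ p) ↑ (p ^ m)               ≈⟨ ^-congˡ (p ^ m) (frobenius x y) ⟩
      (x ↑ p ⊕ y ↑ p) ↑ (p ^ m)             ≈⟨ frobenius^ m _ _ ⟩
      (x ↑ p) ↑ (p ^ m) ⊕ (y ↑ p) ↑ (p ^ m) ≈⟨ +-cong (^-assocʳ x p _) (^-assocʳ y p _) ⟩
      x ↑ (p * p ^ m) ⊕ y ↑ (p * p ^ m)     ∎

-- For an idempotent e this is the factor e R of R.
Factor : (R : CommutativeRing 0ℓ 0ℓ) → CommutativeRing.Carrier R → CommutativeRing 0ℓ 0ℓ
Factor R e = record
  { Carrier = Carrier ; _≈_ = λ a b → e ⊗ a ≈ e ⊗ b ; _+_ = _⊕_ ; _*_ = _⊗_ ; -_ = ⊖_ ; 0# = 0# ; 1# = 1#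
  ; isCommutativeRing = record
    { isRing = record
      { +-isAbelianGroup = record
        { isGroup = record
          { isMonoid = record
            { isSemigroup = record
              { isMagma = record
                { isEquivalence = record { refl = refl ; sym = sym ; trans = trans }
                ; ∙-cong = λ {x} {y} {u} {v} p q →
                    trans (distribˡ e x u) (trans (+-cong p q) (sym (distribˡ e y v)))
                }
              ; assoc = λ x y z → *-congˡ (+-assoc x y z)
              }
            ; identity = (λ x → *-congˡ (+-identityˡ x)) , (λ x → *-congˡ (+-identityʳ x))
            }
          ; inverse = (λ x → *-congˡ (-‿inverseˡ x)) , (λ x → *-congˡ (-‿inverseʳ x))
          ; ⁻¹-cong = λ {x} {y} p → trans (sym (-‿distribʳ-* e x)) (trans (-‿cong p) (-‿distribʳ-* e y))
          }
        ; comm = λ x y → *-congˡ (+-comm x y)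
        }
      ; *-cong = λ {x} {y} {u} {v} p q → begin
          e ⊗ (x ⊗ u)  ≈⟨ *-assoc e x u ⟨
          (e ⊗ x) ⊗ u  ≈⟨ *-congʳ p ⟩
          (e ⊗ y) ⊗ u  ≈⟨ swap e y u ⟩
          (e ⊗ u) ⊗ y  ≈⟨ *-congʳ q ⟩
          (e ⊗ v) ⊗ y  ≈⟨ swap e v y ⟩
          (e ⊗ y) ⊗ v  ≈⟨ *-assoc e y v ⟩
          e ⊗ (y ⊗ v)  ∎
      ; *-assoc = λ x y z → *-congˡ (*-assoc x y z)
      ; *-identity = (λ x → *-congˡ (*-identityˡ x)) , (λ x → *-congˡ (*-identityʳ x))
      ; distrib = (λ x y z → *-congˡ (distribˡ x y z)) , (λ x y z → *-congˡ (distribʳ x y z))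
      }
    ; *-comm = λ x y → *-congˡ (*-comm x y)
    }
  }
  where
  open CommutativeRing R hiding (zero; _-_) renaming (_+_ to _⊕_; _*_ to _⊗_; -_ to ⊖_)
  open import Algebra.Properties.Ring ring using (-‿distribʳ-*)
  open import Relation.Binary.Reasoning.Setoid setoid
  swap : ∀ a b c → (a ⊗ b) ⊗ c ≈ (a ⊗ c) ⊗ b
  swap a b c = trans (*-assoc a b c) (trans (*-congˡ (*-comm b c)) (sym (*-assoc a c b)))

-- In a ring with a^(1+n) = a, each power aⁿ is an idempotent generating the ideal of a.
module PeriodicRing (R : CommutativeRing 0ℓ 0ℓ) where
  open CommutativeRing R hiding (zero; _-_) renaming (_+_ to _⊕_; _*_ to _⊗_; -_ to ⊖_)
  open import Algebra.Properties.Semiring.Exp semiring renaming (_^_ to _↑_)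
  open import Algebra.Properties.CommutativeSemiring.Exp commutativeSemiring using (^-distrib-*)
  open import Relation.Binary.Reasoning.Setoid setoid
  open import Algebra.Solver.Ring.NaturalCoefficients.Default commutativeSemiring

  module _ (_≟_ : ∀ a b → Dec (a ≈ b)) {n} (periodic : ∀ a → a ↑ suc (suc n) ≈ a) where

    power-idempotent : ∀ a → a ↑ suc n ⊗ a ↑ suc n ≈ a ↑ suc n
    power-idempotent a = begin
      (a ⊗ a ↑ n) ⊗ a ↑ suc n   ≈⟨ solve 3 (λ x y z → (x :* y) :* z := (x :* z) :* y) refl a (a ↑ n) (a ↑ suc n) ⟩
      a ↑ suc (suc n) ⊗ a ↑ n   ≈⟨ *-congʳ (periodic a) ⟩
      a ⊗ a ↑ n                 ∎

    -- e is shrunk to a nonzero idempotent e′ for which every a ∈ as is zero or a unit of the factor e′ R.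
    refine : ∀ as e → e ⊗ e ≈ e → ¬ (e ≈ 0#) →
      Σ[ e′ ∈ Carrier ] (e′ ⊗ e′ ≈ e′) × ¬ (e′ ≈ 0#) × (e′ ⊗ e ≈ e′) ×
        All (λ a → e′ ⊗ a ≈ 0# ⊎ e′ ⊗ a ↑ suc n ≈ e′) as
    refine []       e ee≈e e≉0 = e , ee≈e , e≉0 , ee≈e , []
    refine (a ∷ as) e ee≈e e≉0 with (e ⊗ a) ≟ 0#
    ... | yes ea≈0 = let e′ , idem , e′≉0 , e′e , h = refine as e ee≈e e≉0 in
      e′ , idem , e′≉0 , e′e ,
      inj₁ (begin
        e′ ⊗ a        ≈⟨ *-congʳ e′e ⟨
        (e′ ⊗ e) ⊗ a  ≈⟨ *-assoc _ _ _ ⟩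
        e′ ⊗ (e ⊗ a)  ≈⟨ *-congˡ ea≈0 ⟩
        e′ ⊗ 0#       ≈⟨ zeroʳ e′ ⟩
        0#            ∎) ∷ h
    ... | no ea≉0 =
      -- `f` is nonzero because a f = e a, and it is fixed by `b`; so a becomes a unit in every
      -- factor cut out of `f`.
      let b = a ↑ suc n
          f = e ⊗ b
          ff≈f : f ⊗ f ≈ f
          ff≈f = begin
            (e ⊗ b) ⊗ (e ⊗ b)  ≈⟨ solve 2 (λ x y → (x :* y) :* (x :* y) := (x :* x) :* (y :* y)) refl e b ⟩
            (e ⊗ e) ⊗ (b ⊗ b)  ≈⟨ *-cong ee≈e (power-idempotent a) ⟩
            e ⊗ b              ∎
          f≉0 : ¬ (f ≈ 0#)
          f≉0 = λ f≈0 → ea≉0 (begin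
            e ⊗ a        ≈⟨ *-congˡ (periodic a) ⟨
            e ⊗ (a ⊗ b)  ≈⟨ solve 3 (λ x y z → x :* (y :* z) := y :* (x :* z)) refl e a b ⟩
            a ⊗ (e ⊗ b)  ≈⟨ *-congˡ f≈0 ⟩
            a ⊗ 0#       ≈⟨ zeroʳ a ⟩
            0#           ∎)
          e′ , idem , e′≉0 , e′f , h = refine as f ff≈f f≉0
          absorb : ∀ c → f ⊗ c ≈ f → e′ ⊗ c ≈ e′
          absorb = λ c fc≈f → begin
            e′ ⊗ c        ≈⟨ *-congʳ e′f ⟨
            (e′ ⊗ f) ⊗ c  ≈⟨ *-assoc _ _ _ ⟩
            e′ ⊗ (f ⊗ c)  ≈⟨ *-congˡ fc≈f ⟩
            e′ ⊗ f        ≈⟨ e′f ⟩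
            e′            ∎
      in e′ , idem , e′≉0 ,
         absorb e (begin
           (e ⊗ b) ⊗ e  ≈⟨ solve 2 (λ x y → (x :* y) :* x := (x :* x) :* y) refl e b ⟩
           (e ⊗ e) ⊗ b  ≈⟨ *-congʳ ee≈e ⟩
           e ⊗ b        ∎) ,
         inj₂ (absorb b (trans (*-assoc _ _ _) (*-congˡ (power-idempotent a)))) ∷ h

-- Sums over lists

module _ where
  open ℕₚ
  open import Data.Nat.ListAction using (sum)
  open ≡ using (refl; sym; trans; cong; cong₂; subst)

  ∑ : {A : Set} → List A → (A → ℕ) → ℕ
  ∑ xs f = sum (map f xs)

  𝟙 : {P : Set} → Dec P → ℕ
  𝟙 (yes _) = 1
  𝟙 (no _)  = 0

  𝟙-mono : {P Q : Set} (P? : Dec P) (Q? : Dec Q) → (P → Q) → 𝟙 P? ≤ 𝟙 Q?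
  𝟙-mono (no _)  _       f = z≤n
  𝟙-mono (yes p) (yes _) f = s≤s z≤n
  𝟙-mono (yes p) (no ¬q) f = ⊥-elim (¬q (f p))

  𝟙-cong : {P Q : Set} (P? : Dec P) (Q? : Dec Q) → (P → Q) → (Q → P) → 𝟙 P? ≡ 𝟙 Q?
  𝟙-cong P? Q? f g = ≤-antisym (𝟙-mono P? Q? f) (𝟙-mono Q? P? g)

  𝟙-yes : {P : Set} (P? : Dec P) → P → 𝟙 P? ≡ 1
  𝟙-yes (yes _) p = refl
  𝟙-yes (no ¬p) p = ⊥-elim (¬p p)

  𝟙-no : {P : Set} (P? : Dec P) → ¬ P → 𝟙 P? ≡ 0
  𝟙-no (yes p) ¬p = ⊥-elim (¬p p)
  𝟙-no (no _)  ¬p = refl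

  module _ {A : Set} where

    ∑-mono-∈ : ∀ (xs : List A) {f g} → (∀ {x} → x ∈ xs → f x ≤ g x) → ∑ xs f ≤ ∑ xs g
    ∑-mono-∈ []       f≤g = z≤n
    ∑-mono-∈ (x ∷ xs) f≤g = +-mono-≤ (f≤g (here refl)) (∑-mono-∈ xs (f≤g ∘ there))

    ∑-mono : ∀ (xs : List A) {f g} → (∀ x → f x ≤ g x) → ∑ xs f ≤ ∑ xs g
    ∑-mono xs f≤g = ∑-mono-∈ xs (λ {x} _ → f≤g x)

    ∑-cong : ∀ (xs : List A) {f g} → (∀ x → f x ≡ g x) → ∑ xs f ≡ ∑ xs g
    ∑-cong []       eq = refl
    ∑-cong (x ∷ xs) eq = cong₂ _+_ (eq x) (∑-cong xs eq)

    ∑-++ : ∀ (xs ys : List A) f → ∑ (xs ++ ys) f ≡ ∑ xs f + ∑ ys f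
    ∑-++ []       ys f = refl
    ∑-++ (x ∷ xs) ys f = trans (cong (f x +_) (∑-++ xs ys f)) (sym (+-assoc (f x) _ _))

    ∑-map : ∀ {B : Set} (h : B → A) (xs : List B) f → ∑ (map h xs) f ≡ ∑ xs (f ∘ h)
    ∑-map h []       f = refl
    ∑-map h (x ∷ xs) f = cong (f (h x) +_) (∑-map h xs f)

    ∑-+ : ∀ (xs : List A) f g → ∑ xs (λ x → f x + g x) ≡ ∑ xs f + ∑ xs g
    ∑-+ []       f g = refl
    ∑-+ (x ∷ xs) f g = trans (cong (f x + g x +_) (∑-+ xs f g)) (interchange (f x) (g x) (∑ xs f) (∑ xs g))
      where
      interchange : ∀ a b c d → a + b + (c + d) ≡ a + c + (b + d)
      interchange = solve-∀

    ∑-const : ∀ (xs : List A) k → ∑ xs (λ _ → k) ≡ length xs * k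
    ∑-const []       k = refl
    ∑-const (x ∷ xs) k = cong (k +_) (∑-const xs k)

    ∑-0 : ∀ (xs : List A) → ∑ xs (λ _ → 0) ≡ 0
    ∑-0 xs = trans (∑-const xs 0) (*-zeroʳ (length xs))

    ∑-*ʳ : ∀ (xs : List A) f k → ∑ xs (λ x → f x * k) ≡ ∑ xs f * k
    ∑-*ʳ []       f k = refl
    ∑-*ʳ (x ∷ xs) f k = trans (cong (f x * k +_) (∑-*ʳ xs f k)) (sym (*-distribʳ-+ k (f x) (∑ xs f)))

    length-filter-∑ : ∀ {P : A → Set} (P? : Decidable P) xs → length (filter P? xs) ≡ ∑ xs (𝟙 ∘ P?)
    length-filter-∑ P? []       = refl
    length-filter-∑ P? (x ∷ xs) with P? x
    ... | yes _ = cong suc (length-filter-∑ P? xs)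
    ... | no _  = length-filter-∑ P? xs

    ∑-filter : ∀ {P : A → Set} (P? : Decidable P) xs f → ∑ (filter P? xs) f ≡ ∑ xs (λ x → 𝟙 (P? x) * f x)
    ∑-filter P? []       f = refl
    ∑-filter P? (x ∷ xs) f with P? x
    ... | yes _ = cong₂ _+_ (sym (*-identityˡ (f x))) (∑-filter P? xs f)
    ... | no _  = ∑-filter P? xs f

    ∑-∈ : ∀ {xs : List A} {x} f → x ∈ xs → f x ≤ ∑ xs f
    ∑-∈ {x ∷ xs} f (here refl) = m≤m+n (f x) _
    ∑-∈ {y ∷ xs} f (there x∈xs) = ≤-trans (∑-∈ f x∈xs) (m≤n+m _ (f y))

    1≤∑𝟙 : ∀ {P : A → Set} (P? : ∀ x → Dec (P x)) {xs x} → x ∈ xs → P x → 1 ≤ ∑ xs (λ x → 𝟙 (P? x))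
    1≤∑𝟙 P? {xs} {x} x∈ px = ≤-trans (≤-reflexive (sym (𝟙-yes (P? x) px))) (∑-∈ (λ x → 𝟙 (P? x)) x∈)

  ∑-swap : ∀ {A B : Set} (xs : List A) (ys : List B) (f : A → B → ℕ) →
           ∑ xs (λ x → ∑ ys (f x)) ≡ ∑ ys (λ y → ∑ xs (λ x → f x y))
  ∑-swap []       ys f = sym (∑-0 ys)
  ∑-swap (x ∷ xs) ys f = trans (cong (∑ ys (f x) +_) (∑-swap xs ys f)) (sym (∑-+ ys (f x) _))

  ∑-cartesianProductWith : ∀ {A B C : Set} (h : A → B → C) xs ys f →
    ∑ (cartesianProductWith h xs ys) f ≡ ∑ xs (λ x → ∑ ys (λ y → f (h x y)))
  ∑-cartesianProductWith h []       ys f = refl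
  ∑-cartesianProductWith h (x ∷ xs) ys f =
    trans (∑-++ (map (h x) ys) _ f) (cong₂ _+_ (∑-map (h x) ys f) (∑-cartesianProductWith h xs ys f))

  -- Once f x is deleted from `ys`, the images of the remaining elements are still there, since by
  -- injectivity they differ from f x.
  injective⇒length≤ : ∀ {A B : Set} (f : A → B) {xs : List A} {ys : List B} → Unique xs →
    (∀ {x} → x ∈ xs → f x ∈ ys) →
    (∀ {x y} → x ∈ xs → y ∈ xs → f x ≡ f y → x ≡ y) →
    length xs ≤ length ys
  injective⇒length≤ f []            _    _   = z≤n
  injective⇒length≤ f {x ∷ xs} (x∉xs ∷ u) f∈ inj with ∈-∃++ (f∈ (here refl))
  ... | us , vs , refl = begin
    suc (length xs)           ≤⟨ s≤s (injective⇒length≤ f u f∈′ (λ p q → inj (there p) (there q))) ⟩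
    suc (length (us ++ vs))   ≡⟨ cong suc (length-++ us) ⟩
    suc (length us + length vs) ≡⟨ +-suc (length us) (length vs) ⟨
    length us + suc (length vs) ≡⟨ length-++ us ⟨
    length (us ++ f x ∷ vs)   ∎
    where
    open ≤-Reasoning
    f∈′ : ∀ {y} → y ∈ xs → f y ∈ us ++ vs
    f∈′ {y} y∈ with ∈-++⁻ us (f∈ (there y∈))
    ... | inj₁ p             = ∈-++⁺ˡ p
    ... | inj₂ (there p)     = ∈-++⁺ʳ us p
    ... | inj₂ (here fy≡fx) = ⊥-elim (All.lookup x∉xs y∈ (inj (here refl) (there y∈) (sym fy≡fx)))

  count-injective : ∀ {A B : Set} {P : A → Set} (P? : Decidable P) {Q : B → Set} (Q? : Decidable Q) →
    ∀ {xs ys} (f : A → B) → Unique xs →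
    (∀ {x} → x ∈ xs → P x → f x ∈ ys × Q (f x)) →
    (∀ {x y} → x ∈ xs → P x → y ∈ xs → P y → f x ≡ f y → x ≡ y) →
    ∑ xs (𝟙 ∘ P?) ≤ ∑ ys (𝟙 ∘ Q?)
  count-injective P? Q? {xs} {ys} f u f∈ inj = begin
    ∑ xs (𝟙 ∘ P?)          ≡⟨ length-filter-∑ P? xs ⟨
    length (filter P? xs)  ≤⟨ injective⇒length≤ f (Unique.filter⁺ P? u)
                                (λ x∈ → let x∈xs , px = ∈-filter⁻ P? x∈ ; y∈ys , qy = f∈ x∈xs px in ∈-filter⁺ Q? y∈ys qy)
                                (λ x∈ y∈ → let x∈xs , px = ∈-filter⁻ P? x∈ ; y∈xs , py = ∈-filter⁻ P? y∈ in inj x∈xs px y∈xs py) ⟩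
    length (filter Q? ys)  ≡⟨ length-filter-∑ Q? ys ⟩
    ∑ ys (𝟙 ∘ Q?)          ∎
    where
    open ≤-Reasoning

-- Finite fields as factors of group rings

module _ where
  open ℕₚ
  open ≡ using (refl; sym; trans; cong; cong₂; subst; subst₂)

  %-+-cong : ∀ N .{{_ : NonZero N}} {a b c d} → a % N ≡ b % N → c % N ≡ d % N → (a + c) % N ≡ (b + d) % N
  %-+-cong N {a} {b} {c} {d} a≡b c≡d =
    trans (%-distribˡ-+ a c N) (trans (cong₂ (λ x y → (x + y) % N) a≡b c≡d) (sym (%-distribˡ-+ b d N)))

  ∣m+n∣n⇒∣m : ∀ {d m n} → d ∣ m + n → d ∣ n → d ∣ m
  ∣m+n∣n⇒∣m {d} {m} {n} d∣m+n d∣n = ∣m+n∣m⇒∣n (subst (d ∣_) (+-comm m n) d∣m+n) d∣n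

  -- The group ring 𝔽_p[ℤ/n]. The list x₁ ∷ x₂ ∷ … stands for θ^x₁ + θ^x₂ + …,
  -- where θ generates ℤ/n, and ∑ a (δ s) is the coefficient of θ^(−s) in a.
  module GroupRing (p n : ℕ) .{{_ : NonZero p}} .{{_ : NonZero n}} where

    δ : ℕ → ℕ → ℕ
    δ s x = 𝟙 (n ∣? (x + s))

    coeff : ℕ → List ℕ → ℕ
    coeff s a = ∑ a (δ s)

    infix 4 _≈_
    -- A record, so that a and b can be inferred from the type; the coefficients alone do not
    -- determine the two lists.
    record _≈_ (a b : List ℕ) : Set where
      constructor coeffwise
      field at : ∀ s → coeff s a % p ≡ coeff s b % p
    open _≈_

    _⊛_ : List ℕ → List ℕ → List ℕ
    _⊛_ = cartesianProductWith _+_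

    neg : List ℕ → List ℕ
    neg a = concat (replicate (p ∸ 1) a)

    ∑-concat-replicate : ∀ k (a : List ℕ) h → ∑ (concat (replicate k a)) h ≡ k * ∑ a h
    ∑-concat-replicate zero    a h = refl
    ∑-concat-replicate (suc k) a h = trans (∑-++ a _ h) (cong (∑ a h +_) (∑-concat-replicate k a h))

    ∑-neg : ∀ a h → ∑ (neg a) h ≡ (p ∸ 1) * ∑ a h
    ∑-neg = ∑-concat-replicate (p ∸ 1)

    *-congˡ-% : ∀ a b c → b % p ≡ c % p → (a * b) % p ≡ (a * c) % p
    *-congˡ-% a b c b≡c = trans (%-distribˡ-* a b p)
      (trans (cong (λ y → (a % p * y) % p) b≡c) (sym (%-distribˡ-* a c p)))

    ∑-cong-% : ∀ a (f g : ℕ → ℕ) → (∀ x → f x % p ≡ g x % p) → ∑ a f % p ≡ ∑ a g % p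
    ∑-cong-% []      f g eq = refl
    ∑-cong-% (x ∷ a) f g eq = %-+-cong p {f x} {g x} {∑ a f} {∑ a g} (eq x) (∑-cong-% a f g eq)

    p-1+1 : ∀ x → (p ∸ 1) * x + x ≡ x * p
    p-1+1 x = trans (+-comm ((p ∸ 1) * x) x) (trans (cong (_* x) (trans (+-comm 1 (p ∸ 1)) (m∸n+n≡m (ℕ.>-nonZero⁻¹ p)))) (*-comm p x))

    -- Laws that merely rearrange monomials preserve the sum of every function h, before any
    -- reduction modulo p or n.
    exact⇒≈ : ∀ {a b} → (∀ h → ∑ a h ≡ ∑ b h) → a ≈ b
    exact⇒≈ eq = coeffwise λ s → cong (_% p) (eq (δ s))

    -- Here the indexing of coefficients by -s pays off: multiplication by θˣ turns s into x + s,
    -- without subtracting exponents.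
    coeff-⊛ : ∀ s a b → coeff s (a ⊛ b) ≡ ∑ a (λ x → coeff (x + s) b)
    coeff-⊛ s a b = trans (∑-cartesianProductWith _+_ a b (δ s))
      (∑-cong a (λ x → ∑-cong b (λ y → cong (λ z → 𝟙 (n ∣? z)) (rotate x y s))))
      where
      rotate : ∀ x y s → x + y + s ≡ y + (x + s)
      rotate = solve-∀

    ⊛-congˡ : ∀ a {b c} → b ≈ c → (a ⊛ b) ≈ (a ⊛ c)
    ⊛-congˡ a {b} {c} b≈c = coeffwise λ s → begin
      coeff s (a ⊛ b) % p                 ≡⟨ cong (_% p) (coeff-⊛ s a b) ⟩
      ∑ a (λ x → coeff (x + s) b) % p     ≡⟨ ∑-cong-% a _ _ (λ x → at b≈c (x + s)) ⟩
      ∑ a (λ x → coeff (x + s) c) % p     ≡⟨ cong (_% p) (coeff-⊛ s a c) ⟨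
      coeff s (a ⊛ c) % p                 ∎
      where open ≡-Reasoning

    ⊛-comm : ∀ a b → (a ⊛ b) ≈ (b ⊛ a)
    ⊛-comm a b = exact⇒≈ λ h → begin
      ∑ (a ⊛ b) h                            ≡⟨ ∑-cartesianProductWith _+_ a b h ⟩
      ∑ a (λ x → ∑ b (λ y → h (x + y)))      ≡⟨ ∑-swap a b _ ⟩
      ∑ b (λ y → ∑ a (λ x → h (x + y)))      ≡⟨ ∑-cong b (λ y → ∑-cong a (λ x → cong h (+-comm x y))) ⟩
      ∑ b (λ y → ∑ a (λ x → h (y + x)))      ≡⟨ ∑-cartesianProductWith _+_ b a h ⟨
      ∑ (b ⊛ a) h                            ∎
      where open ≡-Reasoning

    ⊛-assoc : ∀ a b c → ((a ⊛ b) ⊛ c) ≈ (a ⊛ (b ⊛ c))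
    ⊛-assoc a b c = exact⇒≈ λ h → begin
      ∑ ((a ⊛ b) ⊛ c) h                                     ≡⟨ ∑-cartesianProductWith _+_ (a ⊛ b) c h ⟩
      ∑ (a ⊛ b) (λ x → ∑ c (λ z → h (x + z)))               ≡⟨ ∑-cartesianProductWith _+_ a b _ ⟩
      ∑ a (λ x → ∑ b (λ y → ∑ c (λ z → h (x + y + z))))     ≡⟨ ∑-cong a (λ x → ∑-cong b (λ y → ∑-cong c (λ z → cong h (+-assoc x y z)))) ⟩
      ∑ a (λ x → ∑ b (λ y → ∑ c (λ z → h (x + (y + z)))))   ≡⟨ ∑-cong a (λ x → ∑-cartesianProductWith _+_ b c _) ⟨
      ∑ a (λ x → ∑ (b ⊛ c) (λ y → h (x + y)))               ≡⟨ ∑-cartesianProductWith _+_ a (b ⊛ c) h ⟨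
      ∑ (a ⊛ (b ⊛ c)) h                                     ∎
      where open ≡-Reasoning

    ++-cong : ∀ {a b c d} → a ≈ b → c ≈ d → (a ++ c) ≈ (b ++ d)
    ++-cong {a} {b} {c} {d} a≈b c≈d = coeffwise λ s → begin
      coeff s (a ++ c) % p             ≡⟨ cong (_% p) (∑-++ a c _) ⟩
      (coeff s a + coeff s c) % p      ≡⟨ %-+-cong p {coeff s a} {coeff s b} (at a≈b s) (at c≈d s) ⟩
      (coeff s b + coeff s d) % p      ≡⟨ cong (_% p) (∑-++ b d _) ⟨
      coeff s (b ++ d) % p             ∎
      where open ≡-Reasoning

    ++-comm : ∀ a b → (a ++ b) ≈ (b ++ a)
    ++-comm a b = exact⇒≈ λ h → trans (∑-++ a b h) (trans (+-comm (∑ a h) (∑ b h)) (sym (∑-++ b a h)))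

    neg-cong : ∀ {a b} → a ≈ b → neg a ≈ neg b
    neg-cong {a} {b} a≈b = coeffwise λ s → trans (cong (_% p) (∑-neg a (δ s)))
      (trans (*-congˡ-% (p ∸ 1) (coeff s a) (coeff s b) (at a≈b s)) (cong (_% p) (sym (∑-neg b (δ s)))))

    neg-inverseˡ : ∀ a → (neg a ++ a) ≈ []
    neg-inverseˡ a = coeffwise λ s → begin
      coeff s (neg a ++ a) % p                    ≡⟨ cong (_% p) (∑-++ (neg a) a _) ⟩
      (coeff s (neg a) + coeff s a) % p           ≡⟨ cong (λ z → (z + coeff s a) % p) (∑-neg a _) ⟩
      ((p ∸ 1) * coeff s a + coeff s a) % p       ≡⟨ cong (_% p) (p-1+1 (coeff s a)) ⟩
      (coeff s a * p) % p                         ≡⟨ m*n%n≡0 (coeff s a) p ⟩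
      0                                           ≡⟨ m*n%n≡0 0 p ⟨
      0 % p                                       ∎
      where open ≡-Reasoning

    ⊛-identityˡ : ∀ a → ((0 ∷ []) ⊛ a) ≈ a
    ⊛-identityˡ a = exact⇒≈ λ h → trans (∑-cartesianProductWith _+_ (0 ∷ []) a h) (+-identityʳ (∑ a h))

    ⊛-distribʳ : ∀ a b c → ((b ++ c) ⊛ a) ≈ ((b ⊛ a) ++ (c ⊛ a))
    ⊛-distribʳ a b c = exact⇒≈ λ h → begin
      ∑ ((b ++ c) ⊛ a) h                                     ≡⟨ ∑-cartesianProductWith _+_ (b ++ c) a h ⟩
      ∑ (b ++ c) (λ x → ∑ a (λ y → h (x + y)))               ≡⟨ ∑-++ b c _ ⟩
      ∑ b (λ x → ∑ a (λ y → h (x + y))) + ∑ c (λ x → ∑ a (λ y → h (x + y)))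
                                                             ≡⟨ cong₂ _+_ (∑-cartesianProductWith _+_ b a h) (∑-cartesianProductWith _+_ c a h) ⟨
      ∑ (b ⊛ a) h + ∑ (c ⊛ a) h                              ≡⟨ ∑-++ (b ⊛ a) (c ⊛ a) h ⟨
      ∑ ((b ⊛ a) ++ (c ⊛ a)) h                               ∎
      where open ≡-Reasoning

    ≈-trans : ∀ {a b c} → a ≈ b → b ≈ c → a ≈ c
    ≈-trans p q = coeffwise λ s → trans (at p s) (at q s)

    ≈-sym : ∀ {a b} → a ≈ b → b ≈ a
    ≈-sym p = coeffwise λ s → sym (at p s)

    ≈-refl : ∀ {a} → a ≈ a
    ≈-refl = coeffwise λ s → refl

    ⊛-cong : ∀ {a b c d} → a ≈ b → c ≈ d → (a ⊛ c) ≈ (b ⊛ d)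
    ⊛-cong {a} {b} {c} {d} a≈b c≈d =
      ≈-trans (⊛-congˡ a c≈d) (≈-trans (⊛-comm a d) (≈-trans (⊛-congˡ d a≈b) (⊛-comm d b)))

    groupRing : CommutativeRing 0ℓ 0ℓ
    groupRing = record
      { Carrier = List ℕ ; _≈_ = _≈_ ; _+_ = _++_ ; _*_ = _⊛_ ; -_ = neg ; 0# = [] ; 1# = 0 ∷ []
      ; isCommutativeRing = record
        { isRing = record
          { +-isAbelianGroup = record
            { isGroup = record
              { isMonoid = record
                { isSemigroup = record
                  { isMagma = record
                    { isEquivalence = record
                      { refl = ≈-refl ; sym = ≈-sym ; trans = ≈-trans }
                    ; ∙-cong = ++-cong
                    }
                  ; assoc = λ a b c → exact⇒≈ λ h → cong (λ z → ∑ z h) (++-assoc a b c)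
                  }
                ; identity = (λ a → ≈-refl) , (λ a → exact⇒≈ λ h → cong (λ z → ∑ z h) (++-identityʳ a))
                }
              ; inverse = neg-inverseˡ , λ a → ≈-trans (++-comm a (neg a)) (neg-inverseˡ a)
              ; ⁻¹-cong = neg-cong
              }
            ; comm = ++-comm
            }
          ; *-cong = ⊛-cong
          ; *-assoc = ⊛-assoc
          ; *-identity = ⊛-identityˡ , λ a → ≈-trans (⊛-comm a _) (⊛-identityˡ a)
          ; distrib = (λ a b c → ≈-trans (⊛-comm a _) (≈-trans (⊛-distribʳ a b c)
                        (++-cong (⊛-comm b a) (⊛-comm c a)))) ,
                      ⊛-distribʳ
          }
        ; *-comm = ⊛-comm
        }
      }
      where open import Data.List.Properties using (++-assoc; ++-identityʳ)

    δ-% : ∀ s x → δ s x ≡ δ (s % n) x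
    δ-% s x = 𝟙-cong (n ∣? (x + s)) (n ∣? (x + s % n))
      (λ d → ∣m+n∣n⇒∣m (subst (n ∣_) s-split d) (n∣m*n (s / n)))
      (λ d → subst (n ∣_) (sym s-split) (∣m∣n⇒∣m+n d (n∣m*n (s / n))))
      where
      s-split : x + s ≡ x + s % n + s / n * n
      s-split = trans (cong (x +_) (m≡m%n+[m/n]*n s n)) (sym (+-assoc x (s % n) _))

    _≈?_ : ∀ a b → Dec (a ≈ b)
    a ≈? b = Dec.map′
      (λ eq → coeffwise λ s → trans (cong (_% p) (∑-cong a (δ-% s))) (trans (eq (m%n<n s n)) (cong (_% p) (sym (∑-cong b (δ-% s))))))
      (λ eq {s} _ → at eq s)
      (allUpTo? (λ s → coeff s a % p ≟ coeff s b % p) n)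

    [_]-cong : ∀ {x y} k l → x + k * n ≡ y + l * n → (x ∷ []) ≈ (y ∷ [])
    [_]-cong {x} {y} k l eq = coeffwise λ s → cong (λ z → (z + 0) % p) (𝟙-cong (n ∣? (x + s)) (n ∣? (y + s))
      (λ d → ∣m+n∣n⇒∣m (subst (n ∣_) (eq′ s) (∣m∣n⇒∣m+n d (n∣m*n k))) (n∣m*n l))
      (λ d → ∣m+n∣n⇒∣m (subst (n ∣_) (sym (eq′ s)) (∣m∣n⇒∣m+n d (n∣m*n l))) (n∣m*n k)))
      where
      shift : ∀ x s k → x + s + k ≡ x + k + s
      shift = solve-∀
      eq′ : ∀ s → x + s + k * n ≡ y + s + l * n
      eq′ s = trans (shift x s (k * n)) (trans (cong (_+ s) eq) (shift y (l * n) s))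

    -- For each prime r ∈ rs the element v contains the factor θ^(n/r) − 1. The
    -- support condition says that only powers of θ of order dividing
    -- product rs occur in v.
    record Separator (rs : List ℕ) : Set where
      field
        v         : List ℕ
        support   : ∀ s → ¬ (n ∣ product rs * s) → coeff s v % p ≡ 0 % p
        coeff₀≢0  : coeff 0 v % p ≢ 0 % p
        separates : ∀ {r} → r ∈ rs → ∃[ h ] (h * r ≡ n × ∃[ w ] (v ≈ (((h ∷ []) ++ neg (0 ∷ [])) ⊛ w)))

    -- With h = n / r, the coefficient of 1 in (θ^h - 1) v is that of θ^(-h) in v minus that of 1.
    -- The former vanishes by `support`, because θ^h has order r and r does not divide the product
    -- of the other primes. So the coefficient of 1 merely changes sign.
    separator : 1 < p → ∀ rs → Unique rs → All Prime rs → All (_∣ n) rs → Separator rs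
    separator 1<p [] _ _ _ = record
      { v = 0 ∷ []
      ; support = λ s n∤s → cong (λ z → (z + 0) % p) (𝟙-no (n ∣? s) (λ n∣s → n∤s (subst (n ∣_) (sym (*-identityˡ s)) n∣s)))
      ; coeff₀≢0 = λ eq → 1≢0 (trans (sym (m<n⇒m%n≡m 1<p)) (trans (sym (cong (λ z → (z + 0) % p) (𝟙-yes (n ∣? 0) (n ∣0)))) (trans eq (m*n%n≡0 0 p))))
      ; separates = λ ()
      }
      where
      1≢0 : 1 ≢ 0
      1≢0 ()
    separator 1<p (r ∷ rs) (r∉rs ∷ uniq) (r-prime ∷ primes) (divides h n≡hr ∷ rs∣n) = record
      { v = f ⊛ v
      ; support = λ s n∤ → begin
          coeff s (f ⊛ v) % p                            ≡⟨ cong (_% p) (coeff-step s) ⟩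
          (coeff (h + s) v + (p ∸ 1) * coeff s v) % p    ≡⟨ vanish (coeff (h + s) v) (coeff s v)
                                                              (support (h + s) (λ n∣ → n∤ (n∣⇒ s n∣)))
                                                              (support s (λ n∣ → n∤ (subst (n ∣_) (sym (*-assoc r (product rs) s)) (∣n⇒∣m*n r n∣)))) ⟩
          0 % p                                          ∎
      ; coeff₀≢0 = λ eq → coeff₀≢0 (begin
          coeff 0 v % p                                  ≡⟨ %-+-cong p {0} {(p ∸ 1) * coeff 0 v} {coeff 0 v} (sym (shrink eq)) refl ⟩
          ((p ∸ 1) * coeff 0 v + coeff 0 v) % p          ≡⟨ cong (_% p) (p-1+1 (coeff 0 v)) ⟩
          (coeff 0 v * p) % p                            ≡⟨ m*n%n≡0 (coeff 0 v) p ⟩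
          0                                              ≡⟨ m*n%n≡0 0 p ⟨
          0 % p                                          ∎)
      ; separates = λ where
          (here refl) → h , sym n≡hr , v , ≈-refl
          (there r∈) → let h′ , eq , w , v≈ = separates r∈ in h′ , eq , f ⊛ w , move h′ w v≈
      }
      where
      open ≡-Reasoning
      open Separator (separator 1<p rs uniq primes rs∣n)
      f = (h ∷ []) ++ neg (0 ∷ [])
      coeff-step : ∀ s → coeff s (f ⊛ v) ≡ coeff (h + s) v + (p ∸ 1) * coeff s v
      coeff-step s = trans (coeff-⊛ s f v) (cong (coeff (h + s) v +_)
        (trans (∑-neg (0 ∷ []) (λ x → coeff (x + s) v)) (cong ((p ∸ 1) *_) (+-identityʳ _))))
      vanish : ∀ a b → a % p ≡ 0 % p → b % p ≡ 0 % p → (a + (p ∸ 1) * b) % p ≡ 0 % p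
      vanish a b a≡0 b≡0 = %-+-cong p {a} {0} {(p ∸ 1) * b} {0} a≡0
        (trans (*-congˡ-% (p ∸ 1) b 0 b≡0) (cong (_% p) (*-zeroʳ (p ∸ 1))))
      n∣⇒ : ∀ s → n ∣ product rs * (h + s) → n ∣ product (r ∷ rs) * s
      n∣⇒ s n∣ = ∣m+n∣n⇒∣m {n} {product (r ∷ rs) * s} {product rs * n} (subst (n ∣_) (trans (expand r (product rs) h s) (cong (λ z → r * product rs * s + product rs * z) (sym n≡hr))) (∣n⇒∣m*n r n∣)) (n∣m*n (product rs))
        where
        expand : ∀ r P h s → r * (P * (h + s)) ≡ r * P * s + P * (h * r)
        expand = solve-∀
      instance
        h≢0 : NonZero h
        h≢0 = m*n≢0⇒m≢0 h {{subst NonZero n≡hr (ℕ.≢-nonZero (ℕ.≢-nonZero⁻¹ n))}}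
      r∤ : ¬ (r ∣ product rs)
      r∤ r∣ = All.lookup r∉rs (factorisationHasAllPrimeFactors r-prime r∣ primes) refl
      n∤Ph : ¬ (n ∣ product rs * (h + 0))
      n∤Ph n∣ = r∤ (*-cancelʳ-∣ h (subst₂ _∣_ (trans n≡hr (*-comm h r)) (cong (product rs *_) (+-identityʳ h)) n∣))
      shrink : coeff 0 (f ⊛ v) % p ≡ 0 % p → ((p ∸ 1) * coeff 0 v) % p ≡ 0 % p
      shrink eq = trans (%-+-cong p {0} {coeff (h + 0) v} {(p ∸ 1) * coeff 0 v} (sym (support (h + 0) n∤Ph)) refl)
        (trans (cong (_% p) (sym (coeff-step 0))) eq)
      move : ∀ h′ w → v ≈ (((h′ ∷ []) ++ neg (0 ∷ [])) ⊛ w) → (f ⊛ v) ≈ (((h′ ∷ []) ++ neg (0 ∷ [])) ⊛ (f ⊛ w))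
      move h′ w v≈ = ≈-trans (⊛-congˡ f v≈) (≈-trans (≈-sym (⊛-assoc f g w))
        (≈-trans (⊛-cong (⊛-comm f g) ≈-refl) (⊛-assoc g f w)))
        where g = (h′ ∷ []) ++ neg (0 ∷ [])

-- Construction of the field of order p^m

module _ (R : CommutativeRing 0ℓ 0ℓ) where
  open CommutativeRing R using (Carrier; _≈_; 0#; 1#) renaming (_+_ to _⊕_; _*_ to _⊗_)
  open import Algebra.Properties.Semiring.Exp (CommutativeRing.semiring R) using () renaming (_^_ to _↑_)

  -- R is a field with n + 1 elements, presented through a generator θ of its multiplicative group.
  record IsCyclicField (p n : ℕ) : Set where
    field
      _≟_           : ∀ a b → Dec (a ≈ b)
      1≉0           : ¬ (1# ≈ 0#)
      frobenius^    : ∀ k x y → (x ⊕ y) ↑ (p ^ k) ≈ x ↑ (p ^ k) ⊕ y ↑ (p ^ k)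
      θ             : ℕ → Carrier
      θ-0           : θ 0 ≈ 1#
      θ-+           : ∀ i j → θ (i + j) ≈ θ i ⊗ θ j
      θ-n           : θ n ≈ 1#
      θ-injective   : ∀ {i j} → i < n → j < n → θ i ≈ θ j → i ≡ j
      zero-or-power : ∀ a → a ≈ 0# ⊎ ∃[ i ] (i < n × a ≈ θ i)

prime-divisor : ∀ n → 1 < n → ∃[ r ] (Prime r × r ∣ n)
prime-divisor n@(suc _) 1<n with factorise n
... | record { factors = []    ; isFactorisation = n≡1 } = ⊥-elim (ℕₚ.<⇒≢ 1<n (≡.sym n≡1))
... | record { factors = r ∷ rs ; isFactorisation = n≡ ; factorsPrime = r-prime ∷ _ } =
  r , r-prime , divides (product rs) (≡.trans n≡ (ℕₚ.*-comm r (product rs)))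

∸-+-swap : ∀ {i j n} → i ≤ j → i ≤ n → j ∸ i + n ≡ n ∸ i + j
∸-+-swap {i} {j} {n} i≤j i≤n = begin
  j ∸ i + n              ≡⟨ ≡.cong (j ∸ i +_) (ℕₚ.m∸n+n≡m i≤n) ⟨
  j ∸ i + (n ∸ i + i)    ≡⟨ rot (j ∸ i) (n ∸ i) i ⟩
  n ∸ i + (j ∸ i + i)    ≡⟨ ≡.cong (n ∸ i +_) (ℕₚ.m∸n+n≡m i≤j) ⟩
  n ∸ i + j              ∎
  where
  open ≡.≡-Reasoning
  rot : ∀ a b c → a + (b + c) ≡ b + (a + c)
  rot = solve-∀

-- j stands for i - x modulo n. The identity exhibits i ≡ x + j, which takes θˣ out of θˣ + θⁱ.
wrap-around : ∀ x i n .{{_ : NonZero n}} → let j = n ∸ x % n + i in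
              i + suc (x / n) * n ≡ x + j % n + j / n * n
wrap-around x i n = begin
  i + suc (x / n) * n                        ≡⟨ rot i n (x / n * n) ⟩
  n + (x / n * n + i)                        ≡⟨ ≡.cong (_+ (x / n * n + i)) (ℕₚ.m+[n∸m]≡n (ℕₚ.<⇒≤ (m%n<n x n))) ⟨
  x % n + (n ∸ x % n) + (x / n * n + i)      ≡⟨ rot′ (x % n) (n ∸ x % n) (x / n * n) i ⟩
  x % n + x / n * n + j                      ≡⟨ ≡.cong₂ _+_ (≡.sym (m≡m%n+[m/n]*n x n)) (m≡m%n+[m/n]*n j n) ⟩
  x + (j % n + j / n * n)                    ≡⟨ ℕₚ.+-assoc x (j % n) _ ⟨
  x + j % n + j / n * n                      ∎
  where
  open ≡.≡-Reasoning
  j = n ∸ x % n + i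
  rot : ∀ i n y → i + (n + y) ≡ n + (y + i)
  rot = solve-∀
  rot′ : ∀ a b y i → a + b + (y + i) ≡ a + y + (b + i)
  rot′ = solve-∀

module FieldConstruction {p} (p-prime : Prime p) (m : ℕ) {n′} (p^m≡ : p ^ m ≡ suc (suc n′)) where

  n = suc n′

  instance
    p≢0 : NonZero p
    p≢0 = prime⇒nonZero p-prime

  1<p : 1 < p
  1<p = ℕ.nonTrivial⇒n>1 p {{prime⇒nonTrivial p-prime}}

  open GroupRing p n hiding (_≈_)
  open CommutativeRing groupRing hiding (zero; _-_) renaming (_+_ to _⊕_; _*_ to _⊗_; -_ to ⊖_)
  open import Algebra.Properties.Semiring.Exp semiring renaming (_^_ to _↑_)
  open import Algebra.Properties.Semiring.Mult semiring renaming (_×_ to _×#_) using ()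
  open import Algebra.Properties.Ring ring using (x[y-z]≈xy-xz)
  open import Algebra.Properties.Group +-group using (x∙y⁻¹≈ε⇒x≈y)
  open import Relation.Binary.Reasoning.Setoid setoid
  open import Algebra.Solver.Ring.NaturalCoefficients.Default commutativeSemiring

  [_] : ℕ → List ℕ
  [ j ] = j ∷ []

  [n*k]≈1 : ∀ k → [ k * n ] ≈ 1#
  [n*k]≈1 k = [_]-cong 0 k (ℕₚ.+-identityʳ (k * n))

  char : p ×# 1# ≈ 0#
  char = GroupRing.coeffwise λ s → ≡.trans (≡.cong (_% p) (≡.trans (multiple s p) (ℕₚ.*-comm p _)))
           (≡.trans (m*n%n≡0 (coeff s 1#) p) (≡.sym (m*n%n≡0 0 p)))
    where
    multiple : ∀ s k → coeff s (k ×# 1#) ≡ k * coeff s 1#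
    multiple s zero    = ≡.refl
    multiple s (suc k) = ≡.trans (∑-++ 1# (k ×# 1#) (δ s)) (≡.cong (coeff s 1# +_) (multiple s k))

  open Frobenius groupRing using (frobenius^)

  [_]↑ : ∀ x k → [ x ] ↑ k ≈ [ k * x ]
  [ x ]↑ zero    = refl
  [ x ]↑ (suc k) = *-congˡ {[ x ]} ([ x ]↑ k)

  -- The p^m-th power is additive and sends θˣ to θ^(x + x n) = θˣ, and every element is a sum of
  -- such powers.
  periodic : ∀ a → a ↑ (p ^ m) ≈ a
  periodic []      rewrite p^m≡ = refl
  periodic (x ∷ a) = begin
    ([ x ] ⊕ a) ↑ (p ^ m)             ≈⟨ frobenius^ p-prime char m [ x ] a ⟩
    [ x ] ↑ (p ^ m) ⊕ a ↑ (p ^ m)     ≈⟨ +-cong ([ x ]↑ (p ^ m)) (periodic a) ⟩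
    [ p ^ m * x ] ⊕ a                 ≈⟨ +-congʳ {a} ([_]-cong 0 x (≡.trans (≡.cong (λ z → z * x + 0) p^m≡) (step n′ x))) ⟩
    [ x ] ⊕ a                         ∎
    where
    step : ∀ n′ x → suc (suc n′) * x + 0 ≡ x + x * suc n′
    step = solve-∀

  periodic′ : ∀ a → a ↑ suc n ≈ a
  periodic′ a = ≡.subst (λ k → a ↑ k ≈ a) p^m≡ (periodic a)

  primeDivisor? : ∀ r → Dec (Prime r × r ∣ n)
  primeDivisor? r = prime? r ×-dec (r ∣? n)

  rs : List ℕ
  rs = filter primeDivisor? (upTo (suc n))

  open Separator (separator 1<p rs (Unique.filter⁺ primeDivisor? (Unique.upTo⁺ (suc n)))
         (All.map proj₁ (All.all-filter primeDivisor? (upTo (suc n)))) (All.map proj₂ (All.all-filter primeDivisor? (upTo (suc n)))))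

  v↑n≉0 : ¬ (v ↑ n ≈ 0#)
  v↑n≉0 v↑n≈0 = coeff₀≢0 (GroupRing._≈_.at v≈0 0)
    where
    v≈0 : v ≈ 0#
    v≈0 = trans (sym (periodic′ v)) (trans (*-congˡ {v} v↑n≈0) (zeroʳ v))

  -- The elements among which the roots of y^(n+1) - y will be counted; their pairwise differences
  -- are to become zero or units.
  sums : List (List ℕ)
  sums = [] ∷ applyUpTo [_] n ++ applyUpTo (λ i → 0 ∷ i ∷ []) n

  differences : List (List ℕ)
  differences = cartesianProductWith (λ a b → a ⊕ (⊖ b)) sums sums

  open PeriodicRing groupRing using (refine; power-idempotent)

  abstract
    component : Σ[ e ∈ List ℕ ] (e ⊗ e ≈ e) × ¬ (e ≈ 0#) × (e ⊗ v ↑ n ≈ e) ×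
                All (λ a → e ⊗ a ≈ 0# ⊎ e ⊗ a ↑ n ≈ e) differences
    component = refine _≈?_ {n′} periodic′ differences (v ↑ n) (power-idempotent _≈?_ {n′} periodic′ v) v↑n≉0

    e : List ℕ
    e = proj₁ component

    e≉0 : ¬ (e ≈ 0#)
    e≉0 = proj₁ (proj₂ (proj₂ component))

    ev↑n≈e : e ⊗ v ↑ n ≈ e
    ev↑n≈e = proj₁ (proj₂ (proj₂ (proj₂ component)))

    zero-or-unit : All (λ a → e ⊗ a ≈ 0# ⊎ e ⊗ a ↑ n ≈ e) differences
    zero-or-unit = proj₂ (proj₂ (proj₂ (proj₂ component)))

  F = Factor groupRing e
  module F = CommutativeRing F
  open Roots F using (Apart; Lead; Lead-⊕; Lead-⊗; Lead-<; Lead-↑; roots⇒lead≈0)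
  open import Algebra.Properties.Semiring.Exp F.semiring using () renaming (_^_ to _↑ᶠ_)

  ↑-agree : ∀ a k → a ↑ᶠ k ≡ a ↑ k
  ↑-agree a zero    = ≡.refl
  ↑-agree a (suc k) = ≡.cong (a ⊗_) (↑-agree a k)

  -- By the choice of `e` the difference a - b is zero or a unit of the factor; a unit is cancelled
  -- by multiplying with its (n - 1)-st power, which inverts it.
  ≈⊎apart : ∀ {a b} → a ∈ sums → b ∈ sums → a F.≈ b ⊎ Apart a b
  ≈⊎apart {a} {b} a∈ b∈ with All.lookup zero-or-unit (∈-cartesianProductWith⁺ (λ a b → a ⊕ (⊖ b)) a∈ b∈)
  ... | inj₁ zero-divisor = inj₁ (x∙y⁻¹≈ε⇒x≈y _ _ (trans (sym (x[y-z]≈xy-xz e a b)) zero-divisor))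
  ... | inj₂ unit = inj₂ λ z az≈bz →
          let c = a ⊕ (⊖ b) in begin
          e ⊗ z                         ≈⟨ *-congʳ {z} unit ⟨
          (e ⊗ (c ⊗ c ↑ n′)) ⊗ z        ≈⟨ solve 5 (λ e a b d z → (e :* ((a :+ b) :* d)) :* z := d :* (e :* (a :* z) :+ e :* (b :* z))) refl e a (⊖ b) (c ↑ n′) z ⟩
          c ↑ n′ ⊗ (e ⊗ (a ⊗ z) ⊕ e ⊗ ((⊖ b) ⊗ z)) ≈⟨ *-congˡ {c ↑ n′} (+-congʳ {e ⊗ ((⊖ b) ⊗ z)} az≈bz) ⟩
          c ↑ n′ ⊗ (e ⊗ (b ⊗ z) ⊕ e ⊗ ((⊖ b) ⊗ z)) ≈⟨ solve 5 (λ e b b′ d z → d :* (e :* (b :* z) :+ e :* (b′ :* z)) := (d :* (e :* z)) :* (b :+ b′)) refl e b (⊖ b) (c ↑ n′) z ⟩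
          (c ↑ n′ ⊗ (e ⊗ z)) ⊗ (b ⊕ (⊖ b)) ≈⟨ *-congˡ {c ↑ n′ ⊗ (e ⊗ z)} (-‿inverseʳ b) ⟩
          (c ↑ n′ ⊗ (e ⊗ z)) ⊗ 0#       ≈⟨ zeroʳ (c ↑ n′ ⊗ (e ⊗ z)) ⟩
          0#                            ≈⟨ zeroʳ e ⟨
          e ⊗ 0#                        ∎

  -- The exponents j with θʲ = 1 form a subgroup. If it contained some 0 < j < n, it would
  -- contain n/r for a prime r, but θ^(n/r) − 1 is a factor of the unit v.
  Period : ℕ → Set
  Period j = [ j ] F.≈ 1#

  period-* : ∀ k {j} → Period j → Period (k * j)
  period-* zero    pj = refl
  period-* (suc k) {j} pj = F.trans {[ suc k * j ]} {[ j ] ⊗ 1#} (F.*-congˡ {[ j ]} (period-* k pj)) (F.trans {[ j ] ⊗ 1#} (F.*-identityʳ [ j ]) pj)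

  period-cancel : ∀ i {j} → Period (i + j) → Period j → Period i
  period-cancel i {j} pij pj = F.trans {[ i ]} (F.trans {[ i ]} {[ i ] ⊗ 1#} (F.sym {[ i ] ⊗ 1#} (F.*-identityʳ [ i ])) (F.*-congˡ {[ i ]} (F.sym {[ j ]} pj))) pij

  n-period : ∀ k → Period (k * n)
  n-period k = *-congˡ {e} ([n*k]≈1 k)

  gcd-period : ∀ {j} → Period j → Period (gcd j n)
  gcd-period {j} pj with Bézout.identity (gcd-GCD j n)
  ... | Bézout.+- x y eq = period-cancel (gcd j n) (≡.subst Period (≡.sym eq) (period-* x pj)) (n-period y)
  ... | Bézout.-+ x y eq = period-cancel (gcd j n) (≡.subst Period (≡.sym eq) (n-period y)) (period-* x pj)

  no-period : ∀ {j} → 0 < j → j < n → ¬ Period j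
  no-period {j} 0<j j<n pj with gcd[m,n]∣n j n
  ... | divides h n≡hg with prime-divisor h 1<h
    where
    g<n : gcd j n < n
    g<n = ℕₚ.≤-<-trans (∣⇒≤ {{ℕ.>-nonZero 0<j}} (gcd[m,n]∣m j n)) j<n
    1<h : 1 < h
    1<h = ℕₚ.≰⇒> λ where
      z≤n       → ℕₚ.1+n≢0 n≡hg
      (s≤s z≤n) → ℕₚ.<⇒≢ g<n (≡.sym (≡.trans n≡hg (ℕₚ.+-identityʳ (gcd j n))))
  -- Since n = t g r with g the gcd, n / r = t g is a period along with g. So θ^(n/r) - 1 vanishes
  -- in the factor, and with it e = e vⁿ.
  ...   | r , r-prime , divides t h≡tr = e≉0 (begin
    e                      ≈⟨ ev↑n≈e ⟨
    e ⊗ (v ⊗ v ↑ n′)       ≈⟨ *-congˡ {e} (*-congʳ {v ↑ n′} v≈) ⟩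
    e ⊗ ((([ k ] ⊕ (⊖ 1#)) ⊗ w) ⊗ v ↑ n′) ≈⟨ solve 5 (λ e a b w u → e :* (((a :+ b) :* w) :* u) := (e :* a :+ e :* b) :* (w :* u)) refl e [ k ] (⊖ 1#) w (v ↑ n′) ⟩
    (e ⊗ [ k ] ⊕ e ⊗ (⊖ 1#)) ⊗ (w ⊗ v ↑ n′) ≈⟨ *-congʳ {w ⊗ v ↑ n′} (+-congʳ {e ⊗ (⊖ 1#)} k-period) ⟩
    (e ⊗ 1# ⊕ e ⊗ (⊖ 1#)) ⊗ (w ⊗ v ↑ n′) ≈⟨ *-congʳ {w ⊗ v ↑ n′} (distribˡ e 1# (⊖ 1#)) ⟨
    (e ⊗ (1# ⊕ (⊖ 1#))) ⊗ (w ⊗ v ↑ n′) ≈⟨ *-congʳ {w ⊗ v ↑ n′} (trans (*-congˡ {e} (-‿inverseʳ 1#)) (zeroʳ e)) ⟩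
    0# ⊗ (w ⊗ v ↑ n′)      ≈⟨ zeroˡ (w ⊗ v ↑ n′) ⟩
    0#                     ∎)
    where
    n≡trg : n ≡ t * gcd j n * r
    n≡trg = ≡.trans n≡hg (≡.trans (≡.cong (_* gcd j n) h≡tr) (swap t r (gcd j n)))
      where
      swap : ∀ t r g → t * r * g ≡ t * g * r
      swap = solve-∀
    r∣n : r ∣ n
    r∣n = divides (t * gcd j n) n≡trg
    sep = separates {r} (∈-filter⁺ primeDivisor? (∈-upTo⁺ (s≤s (∣⇒≤ r∣n))) (r-prime , r∣n))
    k = proj₁ sep
    w = proj₁ (proj₂ (proj₂ sep))
    v≈ = proj₂ (proj₂ (proj₂ sep))
    k-period : Period k
    k-period = ≡.subst Period (ℕₚ.*-cancelʳ-≡ (t * gcd j n) k r {{prime⇒nonZero r-prime}} (≡.trans (≡.sym n≡trg) (≡.sym (proj₁ (proj₂ sep)))))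
                 (period-* t (gcd-period pj))

  θ-injective< : ∀ {i j} → i < j → j < n → ¬ ([ i ] F.≈ [ j ])
  θ-injective< {i} {j} i<j j<n eq = no-period (ℕₚ.m<n⇒0<n∸m i<j) (ℕₚ.≤-<-trans (ℕₚ.m∸n≤m j i) j<n)
    (period-cancel (j ∸ i) {n} (F.trans {[ j ∸ i + n ]} (F.trans {[ j ∸ i + n ]} (F.reflexive (≡.cong [_] (∸-+-swap (ℕₚ.<⇒≤ i<j) (ℕₚ.<⇒≤ i<n)))) (F.*-congˡ {[ n ∸ i ]} (F.sym {[ i ]} eq)))
      (≡.subst Period (≡.trans (ℕₚ.*-identityˡ n) (≡.sym (ℕₚ.m∸n+n≡m (ℕₚ.<⇒≤ i<n)))) (n-period 1)))
      (≡.subst Period (ℕₚ.*-identityˡ n) (n-period 1)))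
    where
    i<n = ℕₚ.<-trans i<j j<n

  1≉0 : ¬ (1# F.≈ 0#)
  1≉0 eq = e≉0 (trans (sym (*-identityʳ e)) (trans eq (zeroʳ e)))

  θ≉0 : ∀ {j} → j < n → ¬ (0# F.≈ [ j ])
  θ≉0 {j} j<n eq = 1≉0 (F.trans {1#} (F.sym {[ n ∸ j + j ]} (≡.subst Period (≡.trans (ℕₚ.*-identityˡ n) (≡.sym (ℕₚ.m∸n+n≡m (ℕₚ.<⇒≤ j<n)))) (n-period 1)))
    (F.trans {[ n ∸ j + j ]} (F.*-congˡ {[ n ∸ j ]} (F.sym {0#} eq)) (F.zeroʳ [ n ∸ j ])))

  0∈sums : [] ∈ sums
  0∈sums = here ≡.refl

  θ∈sums : ∀ {j} → j < n → [ j ] ∈ sums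
  θ∈sums j<n = there (∈-++⁺ˡ (∈-applyUpTo⁺ [_] j<n))

  1+θ∈sums : ∀ {j} → j < n → 0 ∷ j ∷ [] ∈ sums
  1+θ∈sums j<n = there (∈-++⁺ʳ (applyUpTo [_] n) (∈-applyUpTo⁺ (λ i → 0 ∷ i ∷ []) j<n))

  apart : ∀ {a b} → a ∈ sums → b ∈ sums → ¬ (a F.≈ b) → Apart a b
  apart a∈ b∈ a≉b with ≈⊎apart a∈ b∈
  ... | inj₁ a≈b = ⊥-elim (a≉b a≈b)
  ... | inj₂ a#b = a#b

  _≟_ : ∀ a b → Dec (a F.≈ b)
  a ≟ b = (e ⊗ a) ≈? (e ⊗ b)

  -- Otherwise 1 + θⁱ, 0 and the θᵏ would be n + 2 roots of y^(n+1) − y.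
  1+θ : ∀ {i} → i < n → (0 ∷ i ∷ []) F.≈ 0# ⊎ ∃[ k ] (k < n × (0 ∷ i ∷ []) F.≈ [ k ])
  1+θ {i} i<n with (0 ∷ i ∷ []) ≟ 0# | ℕₚ.anyUpTo? (λ k → (0 ∷ i ∷ []) ≟ [ k ]) n
  ... | yes ≈0 | _         = inj₁ ≈0
  ... | no _   | yes power = inj₂ power
  ... | no ≉0  | no ≉θ     = ⊥-elim (1≉0 (F.trans {1#} (F.sym {1# ⊕ 0#} (F.+-identityʳ 1#)) (roots⇒lead≈0 (suc n) lead
      (b ∷ 0# ∷ applyUpTo [_] n) (All.universal root (b ∷ 0# ∷ applyUpTo [_] n))
      ((apart b∈ 0∈sums ≉0 ∷ All.applyUpTo⁺₁ [_] n (λ k<n → apart b∈ (θ∈sums k<n) (λ eq → ≉θ (_ , k<n , eq))))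
        ∷ All.applyUpTo⁺₁ [_] n (λ k<n → apart 0∈sums (θ∈sums k<n) (θ≉0 k<n))
        ∷ AllPairs.applyUpTo⁺₁ [_] n (λ k<l l<n → apart (θ∈sums (ℕₚ.<-trans k<l l<n)) (θ∈sums l<n) (θ-injective< k<l l<n)))
      (ℕₚ.≤-reflexive (≡.cong (suc ∘ suc) (≡.sym (length-applyUpTo [_] n)))))))
    where
    b = 0 ∷ i ∷ []
    b∈ = 1+θ∈sums i<n
    lead : Lead (suc n) (1# ⊕ 0#) (λ y → y ↑ᶠ suc n ⊕ (⊖ 1#) ⊗ y ↑ᶠ 1)
    lead = Lead-⊕ (suc n) (Lead-↑ (suc n)) (Lead-< (s≤s (s≤s z≤n)) (Lead-⊗ 1 (⊖ 1#) (Lead-↑ 1)))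
    root : ∀ y → (y ↑ᶠ suc n ⊕ (⊖ 1#) ⊗ y ↑ᶠ 1) F.≈ 0#
    root y = *-congˡ {e} (begin
      y ↑ᶠ suc n ⊕ (⊖ 1#) ⊗ (y ⊗ 1#)  ≈⟨ +-cong (trans (reflexive (↑-agree y (suc n))) (periodic′ y)) (*-congˡ {⊖ 1#} (*-identityʳ y)) ⟩
      y ⊕ (⊖ 1#) ⊗ y                  ≈⟨ solve 2 (λ a y → y :+ a :* y := (con 1 :+ a) :* y) refl (⊖ 1#) y ⟩
      (1# ⊕ (⊖ 1#)) ⊗ y               ≈⟨ *-congʳ {y} (-‿inverseʳ 1#) ⟩
      0# ⊗ y                          ≈⟨ zeroˡ y ⟩
      0#                              ∎)

  θ-% : ∀ x → [ x ] F.≈ [ x % n ]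
  θ-% x = *-congˡ {e} ([_]-cong 0 (x / n) (≡.trans (ℕₚ.+-identityʳ x) (m≡m%n+[m/n]*n x n)))

  factor-out : ∀ x i → let j = n ∸ x % n + i in [ i ] ≈ [ x + j % n ]
  factor-out x i = [_]-cong (suc (x / n)) ((n ∸ x % n + i) / n) (wrap-around x i n)

  -- Induction on the number of summands: θˣ + θⁱ = θˣ (1 + θ^(i - x)), and by `1+θ` the bracket is
  -- zero or a power of θ.
  zero-or-power : ∀ a → a F.≈ 0# ⊎ ∃[ i ] (i < n × a F.≈ [ i ])
  zero-or-power [] = inj₁ F.refl
  zero-or-power (x ∷ a) with zero-or-power a
  ... | inj₁ a≈0 = inj₂ (x % n , m%n<n x n , F.trans {[ x ] ⊕ a} (F.+-congˡ {[ x ]} a≈0) (F.trans {[ x ] ⊕ 0#} (F.+-identityʳ [ x ]) (θ-% x)))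
  ... | inj₂ (i , i<n , a≈θ) = finish (1+θ (m%n<n (n ∸ x % n + i) n))
    where
    s = 0 ∷ (n ∸ x % n + i) % n ∷ []
    split : ([ x ] ⊕ a) F.≈ ([ x ] ⊗ s)
    split = F.trans {[ x ] ⊕ a} (F.+-congˡ {[ x ]} a≈θ) (*-congˡ {e}
      (+-cong {[ x ]} (reflexive (≡.cong [_] (≡.sym (ℕₚ.+-identityʳ x)))) (factor-out x i)))
    finish : s F.≈ 0# ⊎ ∃[ k ] (k < n × s F.≈ [ k ]) → (x ∷ a) F.≈ 0# ⊎ ∃[ i ] (i < n × (x ∷ a) F.≈ [ i ])
    finish (inj₁ s≈0) = inj₁ (F.trans {[ x ] ⊕ a} split (F.trans {[ x ] ⊗ s} (F.*-congˡ {[ x ]} s≈0) (F.zeroʳ [ x ])))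
    finish (inj₂ (k , _ , s≈θ)) = inj₂ ((x + k) % n , m%n<n (x + k) n ,
      F.trans {[ x ] ⊕ a} split (F.trans {[ x ] ⊗ s} (F.*-congˡ {[ x ]} s≈θ) (θ-% (x + k))))

  θ-injective : ∀ {i j} → i < n → j < n → [ i ] F.≈ [ j ] → i ≡ j
  θ-injective {i} {j} i<n j<n eq with ℕₚ.<-cmp i j
  ... | tri< i<j _ _ = ⊥-elim (θ-injective< i<j j<n eq)
  ... | tri≈ _ i≡j _ = i≡j
  ... | tri> _ _ j<i = ⊥-elim (θ-injective< j<i i<n (F.sym {[ i ]} eq))

  frobeniusᶠ : ∀ k x y → ((x ⊕ y) ↑ᶠ (p ^ k)) F.≈ (x ↑ᶠ (p ^ k) ⊕ y ↑ᶠ (p ^ k))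
  frobeniusᶠ k x y = *-congˡ {e} (begin
    (x ⊕ y) ↑ᶠ (p ^ k)             ≡⟨ ↑-agree (x ⊕ y) (p ^ k) ⟩
    (x ⊕ y) ↑ (p ^ k)              ≈⟨ frobenius^ p-prime char k x y ⟩
    x ↑ (p ^ k) ⊕ y ↑ (p ^ k)      ≡⟨ ≡.cong₂ _⊕_ (↑-agree x (p ^ k)) (↑-agree y (p ^ k)) ⟨
    x ↑ᶠ (p ^ k) ⊕ y ↑ᶠ (p ^ k)    ∎)

  isCyclicField : IsCyclicField F p n
  isCyclicField = record
    { _≟_ = _≟_ ; 1≉0 = 1≉0 ; frobenius^ = frobeniusᶠ ; θ = [_]
    ; θ-0 = F.refl ; θ-+ = λ i j → F.refl ; θ-n = ≡.subst Period (ℕₚ.*-identityˡ n) (n-period 1)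
    ; θ-injective = θ-injective ; zero-or-power = zero-or-power }

cyclicField : ∀ {p n} → Prime p → ∀ m → 0 < n → p ^ m ≡ suc n → Σ[ R ∈ CommutativeRing 0ℓ 0ℓ ] IsCyclicField R p n
cyclicField {n = suc n′} p-prime m _ eq = F , isCyclicField
  where open FieldConstruction p-prime m eq

-- The elements of trace one

∑-upTo-suc : ∀ n f → ∑ (upTo (suc n)) f ≡ f 0 + ∑ (upTo n) (f ∘ suc)
∑-upTo-suc n f = ≡.cong (f 0 +_) (≡.trans (≡.cong (λ xs → ∑ xs f) (≡.sym (map-upTo suc n))) (∑-map suc (upTo n) f))

∑-cover : ∀ {A B : Set} {P : B → A → Set} (xs : List A) (ys : List B) (P? : ∀ y x → Dec (P y x)) →
          (∀ x → ∃[ y ] (y ∈ ys × P y x)) → length xs ≤ ∑ ys (λ y → ∑ xs (λ x → 𝟙 (P? y x)))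
∑-cover xs ys P? cover = begin
  length xs                                ≡⟨ ℕₚ.*-identityʳ _ ⟨
  length xs * 1                            ≡⟨ ∑-const xs 1 ⟨
  ∑ xs (λ _ → 1)                           ≤⟨ ∑-mono xs (λ x → let y , y∈ , pyx = cover x in 1≤∑𝟙 (λ y → P? y x) y∈ pyx) ⟩
  ∑ xs (λ x → ∑ ys (λ y → 𝟙 (P? y x)))     ≡⟨ ∑-swap xs ys _ ⟩
  ∑ ys (λ y → ∑ xs (λ x → 𝟙 (P? y x)))     ∎
  where open ℕₚ.≤-Reasoning

-- Serves to bound a single term from below: if the sum reaches `length xs` times M, no term can
-- fall short of M.
∑-bounded-except : ∀ {A : Set} {xs : List A} {x} → x ∈ xs → ∀ f M → (∀ y → f y ≤ M) →
                   ∑ xs f + M ≤ length xs * M + f x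
∑-bounded-except {xs = x ∷ xs} (here ≡.refl) f M f≤M = begin
  f x + ∑ xs f + M            ≤⟨ ℕₚ.+-monoˡ-≤ M (ℕₚ.+-monoʳ-≤ (f x) (ℕₚ.≤-trans (∑-mono xs f≤M) (ℕₚ.≤-reflexive (∑-const xs M)))) ⟩
  f x + length xs * M + M     ≡⟨ rot (f x) (length xs * M) M ⟩
  M + length xs * M + f x     ∎
  where
  open ℕₚ.≤-Reasoning
  rot : ∀ a b c → a + b + c ≡ c + b + a
  rot = solve-∀
∑-bounded-except {xs = y ∷ xs} {x} (there x∈xs) f M f≤M = begin
  f y + ∑ xs f + M            ≡⟨ ℕₚ.+-assoc (f y) _ M ⟩
  f y + (∑ xs f + M)          ≤⟨ ℕₚ.+-mono-≤ (f≤M y) (∑-bounded-except x∈xs f M f≤M) ⟩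
  M + (length xs * M + f x)   ≡⟨ ℕₚ.+-assoc M _ (f x) ⟨
  M + length xs * M + f x     ∎
  where open ℕₚ.≤-Reasoning

-- β stands for {i : Tr θⁱ = 1} ⊆ ℤ/n, where θ generates the multiplicative group of
-- 𝔽_(q^d), d = 2 + d′ and n = q^d − 1; the s with n ∣ s (q − 1) are those with θˢ ∈ 𝔽_q.
record RelativeDifferenceSet (q d′ n : ℕ) : Set₁ where
  field
    β            : ℕ → Set
    β?           : ∀ i → Dec (β i)
    β-periodic   : ∀ i k → β i → β (i + k * n)
    β-periodic⁻¹ : ∀ i k → β (i + k * n) → β i
    size         : q ^ suc d′ ≤ ∑ (upTo n) (𝟙 ∘ β?)
    intersection : ∀ s → ¬ (n ∣ s) → ∑ (upTo n) (λ i → 𝟙 (β? i ×-dec β? (i + s))) ≤ q ^ d′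
    disjoint     : ∀ s → ¬ (n ∣ s) → n ∣ s * (q ∸ 1) → ∀ i → β i → ¬ β (i + s)

module TraceOne {R : CommutativeRing 0ℓ 0ℓ} {p n} (F : IsCyclicField R p n) (k d′ : ℕ)
                (1<q : 1 < p ^ k) (q^d≡ : (p ^ k) ^ suc (suc d′) ≡ suc n) where
  open CommutativeRing R hiding (zero; _-_) renaming (_+_ to _⊕_; _*_ to _⊗_; -_ to ⊖_)
  open IsCyclicField F
  open Roots R
  open import Algebra.Properties.Semiring.Exp semiring renaming (_^_ to _↑_)
  open import Algebra.Properties.CommutativeSemiring.Exp commutativeSemiring using (^-distrib-*)
  open import Algebra.Properties.Group +-group using (x∙y⁻¹≈ε⇒x≈y)
  open import Algebra.Properties.Ring ring using (x[y-z]≈xy-xz; +-cancelˡ; +-cancelʳ)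
  open import Relation.Binary.Reasoning.Setoid setoid
  open import Algebra.Solver.Ring.NaturalCoefficients.Default commutativeSemiring

  q = p ^ k

  instance
    q≢0 : NonZero q
    q≢0 = ℕ.>-nonZero (ℕₚ.<-trans (s≤s z≤n) 1<q)

  0<n : 0 < n
  0<n = ℕ.s≤s⁻¹ (≡.subst (2 ≤_) q^d≡ (ℕₚ.≤-trans 1<q (ℕₚ.m≤m*n q (q ^ suc d′) {{ℕₚ.m^n≢0 q (suc d′)}})))

  instance
    n≢0 : NonZero n
    n≢0 = ℕ.>-nonZero 0<n

  θ-*n : ∀ j → θ (j * n) ≈ 1#
  θ-*n zero    = θ-0
  θ-*n (suc j) = trans (θ-+ n (j * n)) (trans (*-cong θ-n (θ-*n j)) (*-identityˡ 1#))

  θ-periodic : ∀ i j → θ (i + j * n) ≈ θ i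
  θ-periodic i j = trans (θ-+ i (j * n)) (trans (*-congˡ (θ-*n j)) (*-identityʳ _))

  θ-↑ : ∀ i m → θ i ↑ m ≈ θ (m * i)
  θ-↑ i zero    = sym θ-0
  θ-↑ i (suc m) = trans (*-congˡ (θ-↑ i m)) (sym (θ-+ i (m * i)))

  θ-inverse : ∀ i → ∃[ b ] θ i ⊗ b ≈ 1#
  θ-inverse i = θ (n ∸ i % n) , trans (sym (θ-+ i _)) (trans (reflexive (≡.cong θ eq)) (θ-*n (suc (i / n))))
    where
    rot : ∀ a b c → a + b + c ≡ c + a + b
    rot = solve-∀
    eq : i + (n ∸ i % n) ≡ suc (i / n) * n
    eq = ≡.trans (≡.cong (_+ (n ∸ i % n)) (m≡m%n+[m/n]*n i n)) (≡.trans (rot (i % n) (i / n * n) (n ∸ i % n))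
      (≡.cong (_+ i / n * n) (ℕₚ.m∸n+n≡m (ℕₚ.<⇒≤ (m%n<n i n)))))

  θ≉0 : ∀ i → ¬ (θ i ≈ 0#)
  θ≉0 i θ≈0 = 1≉0 (trans (sym (proj₂ (θ-inverse i))) (trans (*-congʳ θ≈0) (zeroˡ _)))

  0↑ : ∀ m → .{{NonZero m}} → 0# ↑ m ≈ 0#
  0↑ (suc m) = zeroˡ _

  inverse : ∀ a → ¬ (a ≈ 0#) → ∃[ b ] a ⊗ b ≈ 1#
  inverse a a≉0 with zero-or-power a
  ... | inj₁ a≈0           = ⊥-elim (a≉0 a≈0)
  ... | inj₂ (i , _ , a≈θ) = let b , θb≈1 = θ-inverse i in b , trans (*-congʳ a≈θ) θb≈1

  apart : ∀ {a b} → ¬ (a ≈ b) → Apart a b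
  apart {a} {b} a≉b z az≈bz with inverse (a ⊕ (⊖ b)) (λ eq → a≉b (x∙y⁻¹≈ε⇒x≈y a b eq))
  ... | w , cw≈1 = begin
    z                              ≈⟨ *-identityˡ z ⟨
    1# ⊗ z                         ≈⟨ *-congʳ cw≈1 ⟨
    ((a ⊕ (⊖ b)) ⊗ w) ⊗ z          ≈⟨ solve 4 (λ a b w z → ((a :+ b) :* w) :* z := w :* (a :* z :+ b :* z)) refl a (⊖ b) w z ⟩
    w ⊗ (a ⊗ z ⊕ (⊖ b) ⊗ z)        ≈⟨ *-congˡ (+-congʳ az≈bz) ⟩
    w ⊗ (b ⊗ z ⊕ (⊖ b) ⊗ z)        ≈⟨ *-congˡ (distribʳ z b (⊖ b)) ⟨
    w ⊗ ((b ⊕ (⊖ b)) ⊗ z)          ≈⟨ *-congˡ (*-congʳ (-‿inverseʳ b)) ⟩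
    w ⊗ (0# ⊗ z)                   ≈⟨ *-congˡ (zeroˡ z) ⟩
    w ⊗ 0#                         ≈⟨ zeroʳ w ⟩
    0#                             ∎

  fermat : ∀ a → a ↑ (q ^ suc (suc d′)) ≈ a
  fermat a with zero-or-power a
  ... | inj₁ a≈0 = trans (^-congˡ (q ^ suc (suc d′)) a≈0) (trans (0↑ (q ^ suc (suc d′)) {{ℕₚ.m^n≢0 q (suc (suc d′))}}) (sym a≈0))
  ... | inj₂ (i , _ , a≈θ) = begin
    a ↑ Q                 ≈⟨ ^-congˡ Q a≈θ ⟩
    θ i ↑ Q               ≈⟨ θ-↑ i Q ⟩
    θ (Q * i)             ≡⟨ ≡.cong θ (≡.trans (≡.cong (_* i) q^d≡) (≡.cong (i +_) (ℕₚ.*-comm n i))) ⟩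
    θ (i + i * n)         ≈⟨ θ-periodic i i ⟩
    θ i                   ≈⟨ a≈θ ⟨
    a                     ∎
    where Q = q ^ suc (suc d′)

  frobenius-q : ∀ a b → (a ⊕ b) ↑ q ≈ a ↑ q ⊕ b ↑ q
  frobenius-q = frobenius^ k

  ↑-q-commute : ∀ a i → (a ↑ (q ^ i)) ↑ q ≈ a ↑ (q ^ suc i)
  ↑-q-commute a i = trans (^-assocʳ a (q ^ i) q) (^-congʳ a (ℕₚ.*-comm (q ^ i) q))

  q-↑-commute : ∀ a i → (a ↑ q) ↑ (q ^ i) ≈ a ↑ (q ^ suc i)
  q-↑-commute a i = ^-assocʳ a q (q ^ i)

  -- The q-polynomial with terms c_j y^(q^j) for j < i; all coefficients 1 and i = d give the trace.
  linearised : (ℕ → Carrier) → ℕ → Carrier → Carrier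
  linearised c zero    y = 0#
  linearised c (suc i) y = c i ⊗ y ↑ (q ^ i) ⊕ linearised c i y

  Lead-linearised : ∀ c i → Lead (q ^ i) (c i) (linearised c (suc i))
  linearised-low  : ∀ c i → Lead (q ^ i) 0# (linearised c i)
  Lead-linearised c i = Lead-cong (q ^ i) (trans (+-identityʳ _) (*-identityʳ (c i)))
    (Lead-⊕ (q ^ i) (Lead-⊗ (q ^ i) (c i) (Lead-↑ (q ^ i))) (linearised-low c i))
  linearised-low c zero    = Lead-suc 0 (λ y → refl)
  linearised-low c (suc i) = Lead-< (ℕₚ.^-monoʳ-< q 1<q (ℕₚ.n<1+n i)) (Lead-linearised c i)

  traceTo : ℕ → Carrier → Carrier
  traceTo = linearised (λ _ → 1#)

  trace : Carrier → Carrier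
  trace = traceTo (suc (suc d′))

  traceTo-cong : ∀ i {a b} → a ≈ b → traceTo i a ≈ traceTo i b
  traceTo-cong zero    a≈b = refl
  traceTo-cong (suc i) a≈b = +-cong (*-congˡ (^-congˡ (q ^ i) a≈b)) (traceTo-cong i a≈b)

  traceTo-↑ : ∀ i y → traceTo i y ↑ q ≈ traceTo i (y ↑ q)
  traceTo-↑ zero    y = 0↑ q
  traceTo-↑ (suc i) y = begin
    (1# ⊗ y ↑ (q ^ i) ⊕ traceTo i y) ↑ q          ≈⟨ frobenius-q _ _ ⟩
    (1# ⊗ y ↑ (q ^ i)) ↑ q ⊕ traceTo i y ↑ q      ≈⟨ +-cong (trans (^-congˡ q (*-identityˡ _))
                                                       (trans (↑-q-commute y i) (sym (trans (*-identityˡ _) (q-↑-commute y i))))) (traceTo-↑ i y) ⟩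
    1# ⊗ (y ↑ q) ↑ (q ^ i) ⊕ traceTo i (y ↑ q)    ∎

  -- Replacing y by y^q moves every term one place up: y is lost and y^(q^i) is gained. For i = d
  -- these two agree by `fermat`, so the trace is fixed by the q-th power.
  traceTo-shift : ∀ i y → traceTo i (y ↑ q) ⊕ y ≈ traceTo i y ⊕ y ↑ (q ^ i)
  traceTo-shift zero    y = +-congˡ (sym (*-identityʳ y))
  traceTo-shift (suc i) y = begin
    (1# ⊗ (y ↑ q) ↑ (q ^ i) ⊕ traceTo i (y ↑ q)) ⊕ y     ≈⟨ +-assoc _ _ _ ⟩
    1# ⊗ (y ↑ q) ↑ (q ^ i) ⊕ (traceTo i (y ↑ q) ⊕ y)     ≈⟨ +-cong (trans (*-identityˡ _) (q-↑-commute y i)) (traceTo-shift i y) ⟩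
    y ↑ (q ^ suc i) ⊕ (traceTo i y ⊕ y ↑ (q ^ i))        ≈⟨ solve 3 (λ a b c → a :+ (b :+ c) := (con 1 :* c :+ b) :+ a) refl _ _ _ ⟩
    (1# ⊗ y ↑ (q ^ i) ⊕ traceTo i y) ⊕ y ↑ (q ^ suc i)   ∎

  trace-fixed : ∀ y → trace y ↑ q ≈ trace y
  trace-fixed y = trans (traceTo-↑ (suc (suc d′)) y)
    (+-cancelʳ y _ _ (trans (traceTo-shift (suc (suc d′)) y) (+-congˡ (fermat y))))

  fixed-↑ : ∀ {c} → c ↑ q ≈ c → ∀ i → c ↑ (q ^ i) ≈ c
  fixed-↑ {c} cq≈c zero    = *-identityʳ c
  fixed-↑ {c} cq≈c (suc i) = trans (sym (q-↑-commute c i)) (trans (^-congˡ (q ^ i) cq≈c) (fixed-↑ cq≈c i))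

  trace-scale : ∀ {c} → c ↑ q ≈ c → ∀ i y → traceTo i (c ⊗ y) ≈ c ⊗ traceTo i y
  trace-scale {c} cq≈c zero    y = sym (zeroʳ c)
  trace-scale {c} cq≈c (suc i) y = begin
    1# ⊗ (c ⊗ y) ↑ (q ^ i) ⊕ traceTo i (c ⊗ y)    ≈⟨ +-cong (*-congˡ (trans (^-distrib-* c y (q ^ i)) (*-congʳ (fixed-↑ cq≈c i)))) (trace-scale cq≈c i y) ⟩
    1# ⊗ (c ⊗ y ↑ (q ^ i)) ⊕ c ⊗ traceTo i y      ≈⟨ solve 3 (λ c a b → con 1 :* (c :* a) :+ c :* b := c :* (con 1 :* a :+ b)) refl c _ _ ⟩
    c ⊗ (1# ⊗ y ↑ (q ^ i) ⊕ traceTo i y)          ∎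

  defect : Carrier → ℕ → Carrier
  defect c j = c ⊕ (⊖ (c ↑ (q ^ suc j)))

  -- In c Tr y - Tr (c y) the terms c y cancel, and each remaining y^(q^(j+1)) is (y^q)^(q^j).
  -- Reading the rest in y^q lowers its degree by the factor q.
  trace-defect : ∀ c i y → c ⊗ traceTo (suc i) y ≈ traceTo (suc i) (c ⊗ y) ⊕ linearised (defect c) i (y ↑ q)
  trace-defect c zero y = solve 2 (λ c y → c :* (con 1 :* (y :* con 1) :+ con 0) := (con 1 :* ((c :* y) :* con 1) :+ con 0) :+ con 0) refl c y
  trace-defect c (suc i) y = begin
    c ⊗ (1# ⊗ Y ⊕ traceTo (suc i) y)                      ≈⟨ solve 3 (λ c a b → c :* (con 1 :* a :+ b) := c :* a :+ c :* b) refl c Y _ ⟩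
    c ⊗ Y ⊕ c ⊗ traceTo (suc i) y                         ≈⟨ +-cong split (trace-defect c i y) ⟩
    (1# ⊗ (c ⊗ y) ↑ (q ^ suc i) ⊕ defect c i ⊗ (y ↑ q) ↑ (q ^ i)) ⊕ (traceTo (suc i) (c ⊗ y) ⊕ linearised (defect c) i (y ↑ q))
      ≈⟨ solve 4 (λ a b c d → (a :+ b) :+ (c :+ d) := (a :+ c) :+ (b :+ d)) refl _ _ _ _ ⟩
    traceTo (suc (suc i)) (c ⊗ y) ⊕ linearised (defect c) (suc i) (y ↑ q)  ∎
    where
    Y = y ↑ (q ^ suc i)
    C = c ↑ (q ^ suc i)
    split : c ⊗ Y ≈ 1# ⊗ (c ⊗ y) ↑ (q ^ suc i) ⊕ defect c i ⊗ (y ↑ q) ↑ (q ^ i)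
    split = begin
      c ⊗ Y                                   ≈⟨ solve 2 (λ c y → c :* y := con 0 :* y :+ c :* y) refl c Y ⟩
      0# ⊗ Y ⊕ c ⊗ Y                          ≈⟨ +-congʳ (*-congʳ (-‿inverseʳ C)) ⟨
      (C ⊕ (⊖ C)) ⊗ Y ⊕ c ⊗ Y                 ≈⟨ solve 4 (λ a b c y → (a :+ b) :* y :+ c :* y := con 1 :* (a :* y) :+ (c :+ b) :* y) refl C (⊖ C) c Y ⟩
      1# ⊗ (C ⊗ Y) ⊕ defect c i ⊗ Y           ≈⟨ +-cong (*-congˡ (sym (^-distrib-* c y (q ^ suc i)))) (*-congˡ (sym (q-↑-commute y i))) ⟩
      1# ⊗ (c ⊗ y) ↑ (q ^ suc i) ⊕ defect c i ⊗ (y ↑ q) ↑ (q ^ i)  ∎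

  -- Contraposition of `fibre⇒lead≈0`: more than m distinct elements h i in one fibre of f would
  -- force c = 0.
  fibre-bound : ∀ m .{{_ : NonZero m}} {c f} t N (h : ℕ → Carrier) → (∀ {i j} → i < N → j < N → h i ≈ h j → i ≡ j) →
    Lead m c f → ¬ (c ≈ 0#) → {P : ℕ → Set} (P? : ∀ i → Dec (P i)) → (∀ i → P i → f (h i) ≈ t) →
    ∑ (upTo N) (𝟙 ∘ P?) ≤ m
  fibre-bound (suc m) {f = f} t N h h-inj L c≉0 P? P⇒ with ∑ (upTo N) (𝟙 ∘ P?) ℕₚ.≤? suc m
  ... | yes ≤m = ≤m
  ... | no ≰m  = ⊥-elim (c≉0 (fibre⇒lead≈0 m t L (map h is)
      (All.map⁺ (All.map (λ {i} → P⇒ i) (All.all-filter P? (upTo N))))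
      (AllPairs.map⁺ (pairs is (All.filter⁺ P? (All.applyUpTo⁺₁ id N id)) (Unique.filter⁺ P? (Unique.upTo⁺ N))))
      (≡.subst (suc m <_) (≡.trans (≡.sym (length-filter-∑ P? (upTo N))) (≡.sym (length-map h is))) (ℕₚ.≰⇒> ≰m))))
    where
    is = filter P? (upTo N)
    pairs : ∀ is → All (_< N) is → Unique is → AllPairs (λ i j → Apart (h i) (h j)) is
    pairs []       []           []        = []
    pairs (i ∷ is) (i<N ∷ is<N) (i∉ ∷ u) =
      All.map (λ (i≢j , j<N) → apart (λ eq → i≢j (h-inj i<N j<N eq))) (All.zip (i∉ , is<N)) ∷ pairs is is<N u

  -- Enumerates all q^d = n + 1 field elements. Index 1 is θ⁰, the unit, which is why the fibre of
  -- trace one is `fibre? 1`.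
  element : ℕ → Carrier
  element zero    = 0#
  element (suc i) = θ i

  element-injective : ∀ {i j} → i < suc n → j < suc n → element i ≈ element j → i ≡ j
  element-injective {zero}  {zero}  _         _         _  = ≡.refl
  element-injective {zero}  {suc j} _         _         eq = ⊥-elim (θ≉0 j (sym eq))
  element-injective {suc i} {zero}  _         _         eq = ⊥-elim (θ≉0 i eq)
  element-injective {suc i} {suc j} (s≤s i<n) (s≤s j<n) eq = ≡.cong suc (θ-injective i<n j<n eq)

  element-surjective : ∀ a → ∃[ i ] (i < suc n × a ≈ element i)
  element-surjective a with zero-or-power a
  ... | inj₁ a≈0             = 0 , s≤s z≤n , a≈0
  ... | inj₂ (i , i<n , a≈θ) = suc i , s≤s i<n , a≈θ

  fixed? : ∀ j → Dec (element j ↑ q ≈ element j)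
  fixed? j = (element j ↑ q) ≟ element j

  subfield : List ℕ
  subfield = filter fixed? (upTo (suc n))

  subfield-size : length subfield ≤ q
  subfield-size = ≡.subst (_≤ q) (≡.sym (length-filter-∑ fixed? (upTo (suc n))))
    (fibre-bound q {f = λ y → y ↑ q ⊕ (⊖ 1#) ⊗ y ↑ 1} 0# (suc n) element element-injective
      (Lead-⊕ q (Lead-↑ q) (Lead-< 1<q (Lead-⊗ 1 (⊖ 1#) (Lead-↑ 1))))
      (λ eq → 1≉0 (trans (sym (+-identityʳ 1#)) eq)) fixed?
      (λ j fix → begin
        element j ↑ q ⊕ (⊖ 1#) ⊗ (element j ⊗ 1#)  ≈⟨ +-cong fix (*-congˡ (*-identityʳ _)) ⟩
        element j ⊕ (⊖ 1#) ⊗ element j             ≈⟨ solve 2 (λ a y → y :+ a :* y := (con 1 :+ a) :* y) refl (⊖ 1#) _ ⟩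
        (1# ⊕ (⊖ 1#)) ⊗ element j                  ≈⟨ *-congʳ (-‿inverseʳ 1#) ⟩
        0# ⊗ element j                             ≈⟨ zeroˡ _ ⟩
        0#                                         ∎))

  fibre? : ∀ j i → Dec (trace (element i) ≈ element j)
  fibre? j i = trace (element i) ≟ element j

  fibre-size : ∀ j → ∑ (upTo (suc n)) (𝟙 ∘ fibre? j) ≤ q ^ suc d′
  fibre-size j = fibre-bound (q ^ suc d′) {{ℕₚ.m^n≢0 q (suc d′)}} (element j) (suc n) element element-injective
    (Lead-linearised (λ _ → 1#) (suc d′)) 1≉0 (fibre? j) (λ _ → id)

  fibres-cover : suc n ≤ ∑ subfield (λ j → ∑ (upTo (suc n)) (𝟙 ∘ fibre? j))
  fibres-cover = ≡.subst (_≤ ∑ subfield (λ j → ∑ (upTo (suc n)) (𝟙 ∘ fibre? j))) (length-upTo (suc n))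
    (∑-cover (upTo (suc n)) subfield fibre? λ i → let j , j≤n , tr≈ = element-surjective (trace (element i)) in
      j , ∈-filter⁺ fixed? (∈-upTo⁺ j≤n) (trans (^-congˡ q (sym tr≈)) (trans (trace-fixed _) tr≈)) , tr≈)

  β : ℕ → Set
  β i = trace (θ i) ≈ 1#

  β? : ∀ i → Dec (β i)
  β? i = trace (θ i) ≟ 1#

  trace-0 : ¬ (trace 0# ≈ 1#)
  trace-0 eq = 1≉0 (trans (sym eq) (vanish (suc (suc d′))))
    where
    vanish : ∀ i → traceTo i 0# ≈ 0#
    vanish zero    = refl
    vanish (suc i) = trans (+-cong (trans (*-identityˡ _) (0↑ (q ^ i) {{ℕₚ.m^n≢0 q i}})) (vanish i)) (+-identityʳ 0#)

  -- The q^d field elements are distributed over at most q fibres of the trace,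
  -- each of size at most q^(d−1), so no fibre over the subfield is smaller.
  size : q ^ suc d′ ≤ ∑ (upTo n) (𝟙 ∘ β?)
  size = ℕₚ.≤-trans (ℕₚ.+-cancelˡ-≤ (suc n) _ _ total) (ℕₚ.≤-reflexive drop-0)
    where
    M = q ^ suc d′
    total : suc n + M ≤ suc n + ∑ (upTo (suc n)) (𝟙 ∘ fibre? 1)
    total = ℕₚ.≤-trans (ℕₚ.+-monoˡ-≤ M fibres-cover) (ℕₚ.≤-trans
      (∑-bounded-except {xs = subfield} {1} (∈-filter⁺ fixed? (∈-upTo⁺ (s≤s 0<n)) (trans (^-congˡ q θ-0) (trans (1↑ q) (sym θ-0)))) _ M fibre-size)
      (ℕₚ.+-monoˡ-≤ _ (ℕₚ.≤-trans (ℕₚ.*-monoˡ-≤ M subfield-size) (ℕₚ.≤-reflexive q^d≡))))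
      where
      1↑ : ∀ m → 1# ↑ m ≈ 1#
      1↑ zero    = refl
      1↑ (suc m) = trans (*-identityˡ _) (1↑ m)
    -- The zero element has trace 0, so the fibre over 1 consists of powers of θ.
    drop-0 : ∑ (upTo (suc n)) (𝟙 ∘ fibre? 1) ≡ ∑ (upTo n) (𝟙 ∘ β?)
    drop-0 = ≡.trans (∑-upTo-suc n (𝟙 ∘ fibre? 1)) (≡.cong₂ _+_ (𝟙-no (fibre? 1 0) (λ eq → trace-0 (trans eq θ-0)))
      (∑-cong (upTo n) (λ i → 𝟙-cong (fibre? 1 (suc i)) (β? i) (λ eq → trans eq θ-0) (λ eq → trans eq (sym θ-0)))))

  β-shift : ∀ {i s} → β (i + s) → trace (θ s ⊗ θ i) ≈ 1#
  β-shift {i} {s} b = trans (traceTo-cong (suc (suc d′)) (trans (*-comm (θ s) (θ i)) (sym (θ-+ i s)))) b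

  θ≈1⇒∣ : ∀ s → θ s ≈ 1# → n ∣ s
  θ≈1⇒∣ s θs≈1 = m%n≡0⇒n∣m s n (θ-injective (m%n<n s n) 0<n (begin
    θ (s % n)                ≈⟨ θ-periodic (s % n) (s / n) ⟨
    θ (s % n + s / n * n)    ≡⟨ ≡.cong θ (m≡m%n+[m/n]*n s n) ⟨
    θ s                      ≈⟨ θs≈1 ⟩
    1#                       ≈⟨ θ-0 ⟨
    θ 0                      ∎))

  -- For c = θˢ in the subfield Tr (c y) = c Tr y; if both traces were 1, then c = 1.
  fixed⇒disjoint : ∀ {s} → ¬ (n ∣ s) → θ s ↑ q ≈ θ s → ∀ i → β i → ¬ β (i + s)
  fixed⇒disjoint {s} n∤s fix i bi bis = n∤s (θ≈1⇒∣ s (begin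
    θ s                      ≈⟨ *-identityʳ (θ s) ⟨
    θ s ⊗ 1#                 ≈⟨ *-congˡ bi ⟨
    θ s ⊗ trace (θ i)        ≈⟨ trace-scale fix (suc (suc d′)) (θ i) ⟨
    trace (θ s ⊗ θ i)        ≈⟨ β-shift bis ⟩
    1#                       ∎))

  both? : ∀ s i → Dec (β i × β (i + s))
  both? s i = β? i ×-dec β? (i + s)

  -- If θˢ = c is not in the subfield, then c Tr y − Tr (c y) is a polynomial of degree
  -- q^(d−2) in y^q; it takes the value c − 1 on the intersection.
  intersection : ∀ s → ¬ (n ∣ s) → ∑ (upTo n) (𝟙 ∘ both? s) ≤ q ^ d′
  intersection s n∤s with (θ s ↑ q) ≟ θ s
  ... | yes fix = ℕₚ.≤-trans (ℕₚ.≤-reflexive (≡.trans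
      (∑-cong (upTo n) (λ i → 𝟙-no (both? s i) (uncurry (fixed⇒disjoint n∤s fix i)))) (∑-0 (upTo n)))) z≤n
  ... | no ¬fix = fibre-bound (q ^ d′) {{ℕₚ.m^n≢0 q d′}} (c ⊕ (⊖ 1#)) n (λ i → θ i ↑ q)
      -- The q-th power map is injective, being undone by a further q^(d-1)-th power.
      (λ i<n j<n eq → θ-injective i<n j<n (trans (sym (unroot _)) (trans (^-congˡ (q ^ suc d′) eq) (unroot _))))
      (Lead-linearised (defect c) d′)
      -- If the leading coefficient c - c^(q^(d-1)) were 0, the q-th power of c would be c^(q^d) =
      -- c.
      (λ eq → ¬fix (trans (^-congˡ q (x∙y⁻¹≈ε⇒x≈y c _ eq)) (trans (↑-q-commute c (suc d′)) (fermat c))))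
      (both? s)
      (λ i (bi , bis) → +-cancelˡ 1# _ _ (begin
        1# ⊕ linearised (defect c) (suc d′) (θ i ↑ q)                   ≈⟨ +-congʳ (β-shift bis) ⟨
        trace (c ⊗ θ i) ⊕ linearised (defect c) (suc d′) (θ i ↑ q)      ≈⟨ trace-defect c (suc d′) (θ i) ⟨
        c ⊗ trace (θ i)                                                 ≈⟨ *-congˡ bi ⟩
        c ⊗ 1#                                                          ≈⟨ solve 1 (λ c → c :* con 1 := c :+ con 0) refl c ⟩
        c ⊕ 0#                                                          ≈⟨ +-congˡ (-‿inverseʳ 1#) ⟨
        c ⊕ (1# ⊕ (⊖ 1#))                                               ≈⟨ solve 3 (λ a b c → a :+ (b :+ c) := b :+ (a :+ c)) refl c 1# (⊖ 1#) ⟩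
        1# ⊕ (c ⊕ (⊖ 1#))                                               ∎))
    where
    c = θ s
    unroot : ∀ a → (a ↑ q) ↑ (q ^ suc d′) ≈ a
    unroot a = trans (q-↑-commute a (suc d′)) (fermat a)

  relativeDifferenceSet : RelativeDifferenceSet q d′ n
  relativeDifferenceSet = record
    { β = β ; β? = β?
    ; β-periodic = λ i j b → trans (traceTo-cong (suc (suc d′)) (θ-periodic i j)) b
    ; β-periodic⁻¹ = λ i j b → trans (traceTo-cong (suc (suc d′)) (sym (θ-periodic i j))) b
    ; size = size ; intersection = intersection
    ; disjoint = λ s n∤s (divides j eq) → fixed⇒disjoint n∤s (begin
        θ s ↑ q                ≈⟨ θ-↑ s q ⟩
        θ (q * s)              ≡⟨ ≡.cong θ (split s j eq) ⟩
        θ (s + j * n)          ≈⟨ θ-periodic s j ⟩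
        θ s                    ∎)
    }
    where
    split : ∀ s j → s * (q ∸ 1) ≡ j * n → q * s ≡ s + j * n
    split s j eq = ≡.trans (≡.cong (_* s) (≡.sym (ℕₚ.m+[n∸m]≡n (ℕ.>-nonZero⁻¹ q))))
      (≡.cong (s +_) (≡.trans (ℕₚ.*-comm (q ∸ 1) s) eq))

1<p^k : ∀ {p k} → Prime p → 1 ≤ k → 1 < p ^ k
1<p^k {p} {k} p-prime 1≤k = ℕₚ.≤-<-trans (ℕₚ.≤-reflexive (≡.sym (ℕₚ.^-zeroˡ k)))
  (ℕₚ.^-monoˡ-< k {{ℕ.>-nonZero 1≤k}} (ℕ.nonTrivial⇒n>1 p {{prime⇒nonTrivial p-prime}}))

1<q^d : ∀ {q} → 1 < q → ∀ d → 1 < q ^ suc d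
1<q^d {q} 1<q d = ℕₚ.<-≤-trans 1<q (ℕₚ.m≤m*n q (q ^ d) {{ℕₚ.m^n≢0 q d {{ℕ.>-nonZero (ℕₚ.<-trans (s≤s z≤n) 1<q)}}}})

0<q^d∸1 : ∀ {q} → 1 < q → ∀ d → 0 < q ^ suc d ∸ 1
0<q^d∸1 1<q d = ℕₚ.m<n⇒0<n∸m (1<q^d 1<q d)

primePower⇒relativeDifferenceSet : ∀ {p} → Prime p → ∀ k d′ → 1 ≤ k →
  RelativeDifferenceSet (p ^ k) d′ ((p ^ k) ^ suc (suc d′) ∸ 1)
primePower⇒relativeDifferenceSet {p} p-prime k d′ 1≤k =
  TraceOne.relativeDifferenceSet (proj₂ (cyclicField p-prime (k * suc (suc d′)) (0<q^d∸1 1<q (suc d′))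
    (≡.trans (≡.sym (ℕₚ.^-*-assoc p k (suc (suc d′)))) q^d≡))) k d′ 1<q q^d≡
  where
  1<q : 1 < p ^ k
  1<q = 1<p^k p-prime 1≤k
  q^d≡ : (p ^ k) ^ suc (suc d′) ≡ suc ((p ^ k) ^ suc (suc d′) ∸ 1)
  q^d≡ = ≡.sym (ℕₚ.m+[n∸m]≡n (ℕₚ.<⇒≤ (1<q^d 1<q (suc d′))))

-- Reduction modulo N

open ℕₚ
open ≡ using (refl; sym; trans; cong; cong₂; subst; subst₂)
open import Data.List.Membership.DecPropositional _≟_ using (_∈?_)
open import Data.Integer as ℤ using (ℤ; +_)
import Data.Integer.Properties as ℤₚ
import Data.Integer.DivMod as ℤDivMod
import Data.Integer.Divisibility as ℤDiv
open import Data.Integer.Tactic.RingSolver using () renaming (solve-∀ to solve-∀-ℤ)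
open import Data.Rational.Unnormalised as ℚ using (mkℚᵘ; ceiling; *≤*)
import Data.Rational.Unnormalised.Properties as ℚₚ
open import Algebra.Properties.Group (AbelianGroup.group ℤₚ.+-0-abelianGroup) using (//-rightDividesˡ)

∣+-+∣ : ∀ x y → ℤ.∣ + x ℤ.- + y ∣ ≡ ℤ.∣ x ℤ.⊖ y ∣
∣+-+∣ x y = cong ℤ.∣_∣ (ℤₚ.m-n≡m⊖n x y)

∣∸⇒%≡ : ∀ {N x y} .{{_ : NonZero N}} → y ≤ x → N ∣ x ∸ y → x % N ≡ y % N
∣∸⇒%≡ {N} {x} {y} y≤x (divides k eq) =
  trans (cong (_% N) (trans (sym (m+[n∸m]≡n y≤x)) (cong (λ z → y + z) eq))) ([m+kn]%n≡m%n y k N)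

%≡⇒∣∸ : ∀ {N x y} .{{_ : NonZero N}} → y ≤ x → x % N ≡ y % N → N ∣ x ∸ y
%≡⇒∣∸ {N} {x} {y} y≤x eq = divides (x / N ∸ y / N) (begin
  x ∸ y                                          ≡⟨ cong₂ _∸_ (m≡m%n+[m/n]*n x N) (m≡m%n+[m/n]*n y N) ⟩
  (x % N + x / N * N) ∸ (y % N + y / N * N)      ≡⟨ cong (λ z → (z + x / N * N) ∸ (y % N + y / N * N)) eq ⟩
  (y % N + x / N * N) ∸ (y % N + y / N * N)      ≡⟨ [m+n]∸[m+o]≡n∸o (y % N) _ _ ⟩
  x / N * N ∸ y / N * N                          ≡⟨ *-distribʳ-∸ N (x / N) (y / N) ⟨
  (x / N ∸ y / N) * N                            ∎)
  where open ≡-Reasoning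

∣-⇒%≡ : ∀ {N} .{{_ : NonZero N}} x y → + N ℤDiv.∣ (+ x ℤ.- + y) → x % N ≡ y % N
∣-⇒%≡ {N} x y d with ≤-total y x
... | inj₁ y≤x = ∣∸⇒%≡ y≤x (subst (N ∣_) (trans (∣+-+∣ x y) (cong ℤ.∣_∣ (ℤₚ.⊖-≥ y≤x))) d)
... | inj₂ x≤y = sym (∣∸⇒%≡ x≤y (subst (N ∣_) (trans (∣+-+∣ x y) (trans (ℤₚ.∣m⊖n∣≡∣n⊖m∣ x y) (cong ℤ.∣_∣ (ℤₚ.⊖-≥ x≤y)))) d))

%≡⇒∣- : ∀ {N} .{{_ : NonZero N}} x y → x % N ≡ y % N → + N ℤDiv.∣ (+ x ℤ.- + y)
%≡⇒∣- {N} x y eq with ≤-total y x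
... | inj₁ y≤x = subst (N ∣_) (sym (trans (∣+-+∣ x y) (cong ℤ.∣_∣ (ℤₚ.⊖-≥ y≤x)))) (%≡⇒∣∸ y≤x eq)
... | inj₂ x≤y = subst (N ∣_) (sym (trans (∣+-+∣ x y) (trans (ℤₚ.∣m⊖n∣≡∣n⊖m∣ x y) (cong ℤ.∣_∣ (ℤₚ.⊖-≥ x≤y))))) (%≡⇒∣∸ x≤y (sym eq))

sub-sub : ∀ a b c → (+ a ℤ.- + b) ℤ.- + c ≡ + a ℤ.- + (b + c)
sub-sub a b c = trans (ℤₚ.+-assoc (+ a) (ℤ.- + b) (ℤ.- + c)) (cong (λ z → + a ℤ.+ z) (sym (ℤₚ.neg-distrib-+ (+ b) (+ c))))

DifferMod⇒%≡ : ∀ {N} .{{_ : NonZero N}} (a a′ d : Fin N) → DifferMod N a a′ d → toℕ a % N ≡ (toℕ a′ + toℕ d) % N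
DifferMod⇒%≡ {N} a a′ d diff = ∣-⇒%≡ (toℕ a) (toℕ a′ + toℕ d) (subst (+ N ℤDiv.∣_) (sub-sub (toℕ a) (toℕ a′) (toℕ d)) diff)

%≡⇒DifferMod : ∀ {N} .{{_ : NonZero N}} (a a′ d : Fin N) → toℕ a % N ≡ (toℕ a′ + toℕ d) % N → DifferMod N a a′ d
%≡⇒DifferMod {N} a a′ d eq = subst (+ N ℤDiv.∣_) (sym (sub-sub (toℕ a) (toℕ a′) (toℕ d))) (%≡⇒∣- (toℕ a) (toℕ a′ + toℕ d) eq)

∑-⊆ : ∀ {A : Set} {xs ys : List A} → xs ⊆ ys → ∀ f → ∑ xs f ≤ ∑ ys f
∑-⊆ []         f = z≤n
∑-⊆ (y ∷ʳ s)   f = ≤-trans (∑-⊆ s f) (m≤n+m _ (f y))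
∑-⊆ (refl ∷ s) f = +-monoʳ-≤ (f _) (∑-⊆ s f)

-- A class of size m contributes 2 + m² ≥ 3 m to the right-hand side.
transversal : ∀ {A : Set} {_~_ : A → A → Set} (_~?_ : ∀ x y → Dec (x ~ y)) →
  (∀ {x} → x ~ x) → (∀ {x y} → x ~ y → y ~ x) → ∀ xs →
  ∃[ ys ] (ys ⊆ xs × AllPairs (λ x y → ¬ (x ~ y)) ys ×
           3 * length xs ≤ 2 * length ys + ∑ xs (λ x → ∑ xs (λ y → 𝟙 (x ~? y))))
transversal _~?_ ~-refl ~-sym [] = [] , [] , [] , z≤n
transversal {_~_ = _~_} _~?_ ~-refl ~-sym (x ∷ xs) with transversal _~?_ ~-refl ~-sym xs | any? (x ~?_) xs
-- x repeats a class, say that of y: the new ordered pairs (x, x), (x, y) and (y, x) pay for the 3.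
... | ys , ys⊆xs , ys-≁ , bound | yes x~ = ys , x ∷ʳ ys⊆xs , ys-≁ , (begin
    3 * suc (length xs)                                ≡⟨ *-suc 3 (length xs) ⟩
    3 + 3 * length xs                                  ≤⟨ +-monoʳ-≤ 3 bound ⟩
    3 + (2 * length ys + S)                            ≡⟨ rot 1 1 1 (2 * length ys) S ⟩
    2 * length ys + (1 + 1 + (1 + S))                  ≤⟨ +-monoʳ-≤ (2 * length ys) (+-mono-≤ (+-mono-≤ self row) (+-monoˡ-≤ S column)) ⟩
    2 * length ys + (𝟙 (x ~? x) + ∑ xs (λ y → 𝟙 (x ~? y)) + (∑ xs (λ y → 𝟙 (y ~? x)) + S)) ≡⟨ cong (λ z → 2 * length ys + (𝟙 (x ~? x) + ∑ xs (λ y → 𝟙 (x ~? y)) + z)) (∑-+ xs _ _) ⟨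
    2 * length ys + ∑ (x ∷ xs) (λ x′ → ∑ (x ∷ xs) (λ y → 𝟙 (x′ ~? y)))   ∎)
  where
  open ≤-Reasoning
  S = ∑ xs (λ x → ∑ xs (λ y → 𝟙 (x ~? y)))
  rot : ∀ a b c y s → a + b + c + (y + s) ≡ y + (a + b + (c + s))
  rot = solve-∀
  self : 1 ≤ 𝟙 (x ~? x)
  self = ≤-reflexive (sym (𝟙-yes (x ~? x) ~-refl))
  row : 1 ≤ ∑ xs (λ y → 𝟙 (x ~? y))
  row = let y , y∈ , x~y = find x~ in 1≤∑𝟙 (x ~?_) y∈ x~y
  column : 1 ≤ ∑ xs (λ y → 𝟙 (y ~? x))
  column = let y , y∈ , x~y = find x~ in 1≤∑𝟙 (_~? x) y∈ (~-sym x~y)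
-- x opens a class: the new representative pays 2 and the pair (x, x) pays 1.
... | ys , ys⊆xs , ys-≁ , bound | no x≁ = x ∷ ys , refl ∷ ys⊆xs , All-resp-⊆ ys⊆xs (All.¬Any⇒All¬ xs x≁) ∷ ys-≁ , (begin
    3 * suc (length xs)                                ≡⟨ *-suc 3 (length xs) ⟩
    3 + 3 * length xs                                  ≤⟨ +-monoʳ-≤ 3 bound ⟩
    3 + (2 * length ys + S)                            ≡⟨ rot (length ys) S ⟩
    2 * suc (length ys) + (1 + 0 + (0 + S))            ≤⟨ +-monoʳ-≤ (2 * suc (length ys)) (+-mono-≤ (+-mono-≤ self z≤n) (+-monoˡ-≤ S z≤n)) ⟩
    2 * suc (length ys) + (𝟙 (x ~? x) + ∑ xs (λ y → 𝟙 (x ~? y)) + (∑ xs (λ y → 𝟙 (y ~? x)) + S)) ≡⟨ cong (λ z → 2 * suc (length ys) + (𝟙 (x ~? x) + ∑ xs (λ y → 𝟙 (x ~? y)) + z)) (∑-+ xs _ _) ⟨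
    2 * suc (length ys) + ∑ (x ∷ xs) (λ x′ → ∑ (x ∷ xs) (λ y → 𝟙 (x′ ~? y)))   ∎)
  where
  open ≤-Reasoning
  S = ∑ xs (λ x → ∑ xs (λ y → 𝟙 (x ~? y)))
  rot : ∀ y s → 3 + (2 * y + s) ≡ 2 * suc y + (1 + 0 + (0 + s))
  rot = solve-∀
  self : 1 ≤ 𝟙 (x ~? x)
  self = ≤-reflexive (sym (𝟙-yes (x ~? x) ~-refl))

-- Here w = η / ρ. If w ∣ k, then η ∣ k (q - 1), hence n ∣ k N (q - 1) and θ^(k N) lies in the
-- subfield; there are ρ such k below η.
module Projection {q d′ n} (D : RelativeDifferenceSet q d′ n) (N η ρ w : ℕ) .{{N≢0 : NonZero N}} .{{η≢0 : NonZero η}}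
                  (n≡Nη : n ≡ N * η) (η≡ρw : η ≡ ρ * w) (η∣w[q-1] : η ∣ w * (q ∸ 1)) where
  open RelativeDifferenceSet D

  instance
    n≢0 : NonZero n
    n≢0 = subst NonZero (sym n≡Nη) (m*n≢0 N η)
    w≢0 : NonZero w
    w≢0 = m*n≢0⇒n≢0 ρ {{subst NonZero η≡ρw (ℕ.≢-nonZero (ℕ.≢-nonZero⁻¹ η))}}

  N∣n : N ∣ n
  N∣n = subst (N ∣_) (sym n≡Nη) (m∣m*n η)

  B : List ℕ
  B = filter β? (upTo n)

  both? : ∀ s i → Dec (β i × β (i + s))
  both? s i = β? i ×-dec β? (i + s)

  -- A representative of y - x modulo n, free of subtraction.
  offset : ℕ → ℕ → ℕ
  offset x y = y + x * (n ∸ 1)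

  offset-spec : ∀ x y → x + offset x y ≡ y + x * n
  offset-spec x y = trans (rot x y (n ∸ 1)) (cong (λ z → y + x * z) (m+[n∸m]≡n (ℕ.>-nonZero⁻¹ n)))
    where
    rot : ∀ x y z → x + (y + x * z) ≡ y + x * (1 + z)
    rot = solve-∀

  -- For y ≡ x modulo N this is the k below η with x + k N ≡ y modulo n.
  fibreIndex : ℕ → ℕ → ℕ
  fibreIndex x y = (offset x y / N) % η

  fibreIndex-spec : ∀ x y → y % N ≡ x % N → x + fibreIndex x y * N + (offset x y / N / η) * n ≡ y + x * n
  fibreIndex-spec x y y≡x = begin
    x + fibreIndex x y * N + m / η * n         ≡⟨ cong (λ z → x + fibreIndex x y * N + m / η * z) n≡Nη ⟩
    x + m % η * N + m / η * (N * η)            ≡⟨ regroup x (m % η) (m / η) N η ⟩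
    x + (m % η + m / η * η) * N                ≡⟨ cong (λ z → x + z * N) (m≡m%n+[m/n]*n m η) ⟨
    x + m * N                                  ≡⟨ cong (λ z → x + z) (m/n*n≡m N∣offset) ⟩
    x + offset x y                             ≡⟨ offset-spec x y ⟩
    y + x * n                                  ∎
    where
    open ≡-Reasoning
    m = offset x y / N
    regroup : ∀ x a b N η → x + a * N + b * (N * η) ≡ x + (a + b * η) * N
    regroup = solve-∀
    N∣offset : N ∣ offset x y
    N∣offset = m%n≡0⇒n∣m _ N (trans (%-+-cong N y≡x refl)
      (n∣m⇒m%n≡0 _ N (subst (N ∣_) (sym (cong (λ z → x * z) (m+[n∸m]≡n (ℕ.>-nonZero⁻¹ n))) ) (∣n⇒∣m*n x N∣n) ∣∘ rot)))
      where
      rot : x * (1 + (n ∸ 1)) ≡ x + x * (n ∸ 1)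
      rot = *-suc x (n ∸ 1)
      _∣∘_ : ∀ {a b} → N ∣ a → a ≡ b → N ∣ b
      d ∣∘ refl = d

  fibre-count : ∀ x → ∑ B (λ y → 𝟙 (y % N ≟ x % N)) ≤ ∑ (upTo η) (λ k → 𝟙 (β? (x + k * N)))
  fibre-count x = count-injective (λ y → y % N ≟ x % N) (λ k → β? (x + k * N)) (fibreIndex x)
    (Unique.filter⁺ β? (Unique.upTo⁺ n))
    (λ {y} y∈B y≡x → ∈-upTo⁺ (m%n<n (offset x y / N) η) ,
       β-periodic⁻¹ _ (offset x y / N / η) (subst β (sym (fibreIndex-spec x y y≡x)) (β-periodic y x (proj₂ (∈-filter⁻ β? {xs = upTo n} y∈B)))))
    (λ {y} {z} y∈B y≡x z∈B z≡x eq → begin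
       y                    ≡⟨ m<n⇒m%n≡m (∈-upTo⁻ (proj₁ (∈-filter⁻ β? {xs = upTo n} y∈B))) ⟨
       y % n                ≡⟨ residue y y≡x ⟨
       (x + fibreIndex x y * N) % n   ≡⟨ cong (λ k → (x + k * N) % n) eq ⟩
       (x + fibreIndex x z * N) % n   ≡⟨ residue z z≡x ⟩
       z % n                ≡⟨ m<n⇒m%n≡m (∈-upTo⁻ (proj₁ (∈-filter⁻ β? {xs = upTo n} z∈B))) ⟩
       z                    ∎)
    where
    open ≡-Reasoning
    residue : ∀ y → y % N ≡ x % N → (x + fibreIndex x y * N) % n ≡ y % n
    residue y y≡x = trans (sym ([m+kn]%n≡m%n _ (offset x y / N / η) n))
      (trans (cong (_% n) (fibreIndex-spec x y y≡x)) ([m+kn]%n≡m%n y x n))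

  -- A difference s modulo N has the η lifts s + k N modulo n, and each pair of B realises one of
  -- them.
  pair-count : ∀ s → ∑ B (λ x → ∑ B (λ y → 𝟙 (y % N ≟ (x + s) % N))) ≤ ∑ (upTo η) (λ k → ∑ (upTo n) (𝟙 ∘ both? (s + k * N)))
  pair-count s = begin
    ∑ B (λ x → ∑ B (λ y → 𝟙 (y % N ≟ (x + s) % N)))            ≤⟨ ∑-mono B (λ x → fibre-count (x + s)) ⟩
    ∑ B (λ x → ∑ (upTo η) (λ k → 𝟙 (β? (x + s + k * N))))      ≡⟨ ∑-swap B (upTo η) _ ⟩
    ∑ (upTo η) (λ k → ∑ B (λ x → 𝟙 (β? (x + s + k * N))))      ≡⟨ ∑-cong (upTo η) (λ k → trans (∑-filter β? (upTo n) _) (∑-cong (upTo n) (λ x → product-𝟙 k x))) ⟩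
    ∑ (upTo η) (λ k → ∑ (upTo n) (𝟙 ∘ both? (s + k * N)))      ∎
    where
    open ≤-Reasoning
    product-𝟙 : ∀ k x → 𝟙 (β? x) * 𝟙 (β? (x + s + k * N)) ≡ 𝟙 (both? (s + k * N) x)
    product-𝟙 k x rewrite +-assoc x s (k * N) with β? x | β? (x + (s + k * N))
    ... | yes _ | yes _ = refl
    ... | yes _ | no _  = refl
    ... | no _  | _     = refl

  pair-count-≢0 : ∀ s → ¬ (N ∣ s) → ∑ B (λ x → ∑ B (λ y → 𝟙 (y % N ≟ (x + s) % N))) ≤ η * q ^ d′
  pair-count-≢0 s N∤s = begin
    _                                                          ≤⟨ pair-count s ⟩
    ∑ (upTo η) (λ k → ∑ (upTo n) (𝟙 ∘ both? (s + k * N)))      ≤⟨ ∑-mono (upTo η) (λ k → intersection (s + k * N)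
                                                                    (λ n∣ → N∤s (∣m+n∣m⇒∣n (subst (N ∣_) (+-comm s (k * N)) (∣-trans N∣n n∣)) (n∣m*n k)))) ⟩
    ∑ (upTo η) (λ _ → q ^ d′)                                  ≡⟨ trans (∑-const (upTo η) _) (cong (_* q ^ d′) (length-upTo η)) ⟩
    η * q ^ d′                                                 ∎
    where open ≤-Reasoning

  ρ≤#multiples : ρ ≤ ∑ (upTo η) (λ k → 𝟙 (w ∣? k))
  ρ≤#multiples = begin
    ρ                                  ≡⟨ trans (*-identityʳ _) (length-upTo ρ) ⟨
    length (upTo ρ) * 1                ≡⟨ ∑-const (upTo ρ) 1 ⟨
    ∑ (upTo ρ) (λ _ → 1)               ≡⟨ ∑-cong (upTo ρ) (λ j → 𝟙-yes (0 ≤? j) z≤n) ⟨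
    ∑ (upTo ρ) (λ j → 𝟙 (0 ≤? j))      ≤⟨ count-injective (0 ≤?_) (w ∣?_) (_* w) (Unique.upTo⁺ ρ)
                                            (λ {j} j∈ _ → ∈-upTo⁺ (subst (j * w <_) (sym η≡ρw) (*-monoˡ-< w (∈-upTo⁻ j∈))) , n∣m*n j)
                                            (λ {i} {j} _ _ _ _ → *-cancelʳ-≡ i j w) ⟩
    ∑ (upTo η) (λ k → 𝟙 (w ∣? k))      ∎
    where open ≤-Reasoning

  -- Only the k with w ∤ k contribute: for the others θ^(k N) lies in the subfield.
  pair-count-0 : ∑ B (λ x → ∑ B (λ y → 𝟙 (y % N ≟ (x + 0) % N))) + ρ * q ^ d′ ≤ length B + η * q ^ d′
  pair-count-0 = begin
    _ + ρ * M                                                                   ≤⟨ +-mono-≤ (pair-count 0) (*-monoˡ-≤ M ρ≤#multiples) ⟩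
    ∑ (upTo η) count + ∑ (upTo η) (λ k → 𝟙 (w ∣? k)) * M                        ≡⟨ cong (λ z → ∑ (upTo η) count + z) (∑-*ʳ (upTo η) _ M) ⟨
    ∑ (upTo η) count + ∑ (upTo η) (λ k → 𝟙 (w ∣? k) * M)                        ≡⟨ ∑-+ (upTo η) _ _ ⟨
    ∑ (upTo η) (λ k → count k + 𝟙 (w ∣? k) * M)                                 ≤⟨ ∑-mono-∈ (upTo η) (λ {k} k∈ → pointwise k (∈-upTo⁻ k∈)) ⟩
    -- Each k has room for one M, taken by the intersection if w ∤ k and by the indicator if w ∣ k.
    -- For k = 0 the diagonal comes on top, with its `length B` pairs.
    ∑ (upTo η) (λ k → 𝟙 (k ≟ 0) * length B + M)                                 ≡⟨ ∑-+ (upTo η) _ _ ⟩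
    ∑ (upTo η) (λ k → 𝟙 (k ≟ 0) * length B) + ∑ (upTo η) (λ _ → M)              ≡⟨ cong₂ _+_ (∑-*ʳ (upTo η) _ (length B)) (trans (∑-const (upTo η) M) (cong (_* M) (length-upTo η))) ⟩
    ∑ (upTo η) (λ k → 𝟙 (k ≟ 0)) * length B + η * M                             ≤⟨ +-monoˡ-≤ (η * M) (≤-trans (*-monoˡ-≤ (length B) one-zero) (≤-reflexive (*-identityˡ _))) ⟩
    length B + η * M                                                            ∎
    where
    open ≤-Reasoning
    M = q ^ d′
    count : ℕ → ℕ
    count k = ∑ (upTo n) (𝟙 ∘ both? (0 + k * N))
    one-zero : ∑ (upTo η) (λ k → 𝟙 (k ≟ 0)) ≤ 1
    one-zero = count-injective (_≟ 0) (_≟ 0) {ys = 0 ∷ []} id (Unique.upTo⁺ η) (λ { _ refl → here refl , refl }) (λ _ _ _ _ → id)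
    n∤ : ∀ k → k < η → k ≢ 0 → ¬ (n ∣ k * N)
    n∤ k k<η k≢0 n∣ = <⇒≱ k<η (∣⇒≤ {{ℕ.≢-nonZero k≢0}} (*-cancelʳ-∣ N (subst (_∣ k * N) (trans n≡Nη (*-comm N η)) n∣)))
    pointwise : ∀ k → k < η → count k + 𝟙 (w ∣? k) * M ≤ 𝟙 (k ≟ 0) * length B + M
    pointwise zero k<η = +-mono-≤
      (≤-trans (∑-mono (upTo n) (λ i → 𝟙-mono (both? 0 i) (β? i) proj₁)) (≤-reflexive (trans (sym (length-filter-∑ β? (upTo n))) (sym (*-identityˡ _)))))
      (≤-trans (*-monoˡ-≤ M (𝟙-mono (w ∣? 0) (0 ≟ 0) (λ _ → refl))) (≤-reflexive (*-identityˡ M)))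
    pointwise k@(suc _) k<η with w ∣? k
    ... | no _ = subst (_≤ M) (sym (+-identityʳ (count k))) (intersection (k * N) (n∤ k k<η (λ ())))
    ... | yes (divides l k≡lw) = ≤-reflexive (cong₂ _+_ (trans (∑-cong (upTo n) (λ i → 𝟙-no (both? (k * N) i)
            (uncurry (disjoint (k * N) (n∤ k k<η (λ ())) n∣ i)))) (∑-0 (upTo n))) (*-identityˡ M))
      where
      regroup : ∀ l w N q → N * (w * q) * l ≡ l * w * N * q
      regroup = solve-∀
      n∣ : n ∣ k * N * (q ∸ 1)
      n∣ = subst₂ _∣_ (sym n≡Nη) (trans (regroup l w N (q ∸ 1)) (cong (λ z → z * N * (q ∸ 1)) (sym k≡lw)))
             (∣m⇒∣m*n l (*-monoʳ-∣ N η∣w[q-1]))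

  -- Congruence modulo N, written with x + 0 so that the collisions are literally the sum in
  -- `pair-count-0`.
  _~?_ : ∀ x y → Dec (y % N ≡ (x + 0) % N)
  x ~? y = y % N ≟ (x + 0) % N

  residues = transversal _~?_ (λ {x} → cong (_% N) (sym (+-identityʳ x)))
    (λ {x} {y} eq → trans (cong (_% N) (sym (+-identityʳ x))) (trans (sym eq) (cong (_% N) (sym (+-identityʳ y))))) B

  representatives : List ℕ
  representatives = proj₁ residues

  A : List (Fin N)
  A = map (_mod N) representatives

  toℕ-mod : ∀ x → toℕ (x mod N) ≡ x % N
  toℕ-mod x = Finₚ.toℕ-fromℕ< (m%n<n x N)

  A-unique : Unique A
  A-unique = AllPairs.map⁺ (AllPairs.map
    (λ {x} {y} x≁y eq → x≁y (trans (sym (toℕ-mod y)) (trans (cong toℕ (sym eq)) (trans (toℕ-mod x) (cong (_% N) (sym (+-identityʳ x)))))))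
    (proj₁ (proj₂ (proj₂ residues))))

  A-golomb : ∀ (d : Fin N) → toℕ d ≢ 0 → length (pairsWithDifferenceMod A d) ≤ η * q ^ d′
  A-golomb d d≢0 = begin
    length (pairsWithDifferenceMod A d)                                      ≡⟨ length-filter-∑ _ (cartesianProduct A A) ⟩
    ∑ (cartesianProduct A A) (λ (a , a′) → 𝟙 (¬? (a Fin.≟ a′) ×-dec differMod? N a a′ d))
                                                                             ≡⟨ ∑-cartesianProductWith _,_ A A _ ⟩
    ∑ A (λ a → ∑ A (λ a′ → 𝟙 (¬? (a Fin.≟ a′) ×-dec differMod? N a a′ d)))   ≡⟨ trans (∑-map (_mod N) reps _) (∑-cong reps (λ x → ∑-map (_mod N) reps _)) ⟩
    ∑ reps (λ x → ∑ reps (λ y → 𝟙 (¬? ((x mod N) Fin.≟ (y mod N)) ×-dec differMod? N (x mod N) (y mod N) d)))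
                                                                             ≤⟨ ∑-mono reps (λ x → ∑-mono reps (λ y → 𝟙-mono _ (y % N ≟ (x + s) % N) (λ (_ , diff) → shift x y diff))) ⟩
    ∑ reps (λ x → ∑ reps (λ y → 𝟙 (y % N ≟ (x + s) % N)))                    ≤⟨ ∑-mono reps (λ x → ∑-⊆ reps⊆B _) ⟩
    ∑ reps (λ x → ∑ B (λ y → 𝟙 (y % N ≟ (x + s) % N)))                       ≤⟨ ∑-⊆ reps⊆B _ ⟩
    ∑ B (λ x → ∑ B (λ y → 𝟙 (y % N ≟ (x + s) % N)))                          ≤⟨ pair-count-≢0 s N∤s ⟩
    η * q ^ d′                                                               ∎
    where
    open ≤-Reasoning
    reps = representatives
    reps⊆B = proj₁ (proj₂ residues)
    -- A difference x - y ≡ d is read backwards as y ≡ x + (N - d), the form counted by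
    -- `pair-count-≢0`.
    s = N ∸ toℕ d
    N∤s : ¬ (N ∣ s)
    N∤s N∣s = <⇒≱ (∸-monoʳ-< (n≢0⇒n>0 d≢0) (<⇒≤ (Finₚ.toℕ<n d))) (∣⇒≤ {{ℕ.>-nonZero (m<n⇒0<n∸m (Finₚ.toℕ<n d))}} N∣s)
    shift : ∀ x y → DifferMod N (x mod N) (y mod N) d → y % N ≡ (x + s) % N
    shift x y diff = E.begin
      y % N                       E.≡⟨ [m+n]%n≡m%n y N ⟨
      (y + N) % N                 E.≡⟨ cong (λ z → (y + z) % N) (m+[n∸m]≡n (<⇒≤ (Finₚ.toℕ<n d))) ⟨
      (y + (toℕ d + s)) % N       E.≡⟨ cong (_% N) (+-assoc y (toℕ d) s) ⟨
      (y + toℕ d + s) % N         E.≡⟨ %-+-cong N {c = s} (sym x≡) refl ⟩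
      (x + s) % N                 E.∎
      where
      module E = ≡-Reasoning
      x≡ : x % N ≡ (y + toℕ d) % N
      x≡ = E.begin
        x % N                             E.≡⟨ m%n%n≡m%n x N ⟨
        x % N % N                         E.≡⟨ cong (_% N) (toℕ-mod x) ⟨
        toℕ (x mod N) % N                 E.≡⟨ DifferMod⇒%≡ (x mod N) (y mod N) d diff ⟩
        (toℕ (y mod N) + toℕ d) % N       E.≡⟨ cong (λ z → (z + toℕ d) % N) (toℕ-mod y) ⟩
        (y % N + toℕ d) % N               E.≡⟨ %-+-cong N {c = toℕ d} (m%n%n≡m%n y N) refl ⟩
        (y + toℕ d) % N                   E.∎

  -- Of the 3 |B| in `transversal` one |B| is used up by the diagonal in `pair-count-0`. What is
  -- left is twice the bound on the marks, with the negative term moved across.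
  A-size : 2 * q ^ suc d′ + ρ * q ^ d′ ≤ 2 * length A + η * q ^ d′
  A-size = begin
    2 * q ^ suc d′ + ρ * M             ≤⟨ +-monoˡ-≤ (ρ * M) (*-monoʳ-≤ 2 (subst (q ^ suc d′ ≤_) (sym (length-filter-∑ β? (upTo n))) size)) ⟩
    2 * length B + ρ * M               ≤⟨ +-cancelˡ-≤ (length B) _ _ total ⟩
    2 * length reps + η * M            ≡⟨ cong (λ z → 2 * z + η * M) (length-map (_mod N) reps) ⟨
    2 * length A + η * M               ∎
    where
    open ≤-Reasoning
    M = q ^ d′
    reps = representatives
    S = ∑ B (λ x → ∑ B (λ y → 𝟙 (x ~? y)))
    rot₁ : ∀ b r → b + (2 * b + r) ≡ 3 * b + r
    rot₁ = solve-∀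
    rot₂ : ∀ a b c → a + (b + c) ≡ b + (a + c)
    rot₂ = solve-∀
    total : length B + (2 * length B + ρ * M) ≤ length B + (2 * length reps + η * M)
    total = begin
      length B + (2 * length B + ρ * M)        ≡⟨ rot₁ (length B) (ρ * M) ⟩
      3 * length B + ρ * M                     ≤⟨ +-monoˡ-≤ (ρ * M) (proj₂ (proj₂ (proj₂ residues))) ⟩
      2 * length reps + S + ρ * M              ≡⟨ +-assoc (2 * length reps) S (ρ * M) ⟩
      2 * length reps + (S + ρ * M)            ≤⟨ +-monoʳ-≤ (2 * length reps) pair-count-0 ⟩
      2 * length reps + (length B + η * M)     ≡⟨ rot₂ (2 * length reps) (length B) (η * M) ⟩
      length B + (2 * length reps + η * M)     ∎

-- Cutting the circle at the longest gap

least : {P : ℕ → Set} → (∀ m → Dec (P m)) → ∀ N → P N → ∃[ m ] (m ≤ N × P m × (∀ j → j < m → ¬ P j))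
least P? N pN with P? 0
... | yes p0 = 0 , z≤n , p0 , λ _ ()
least P? zero    pN | no ¬p0 = ⊥-elim (¬p0 pN)
least P? (suc N) pN | no ¬p0 with least (P? ∘ suc) N pN
... | m , m≤N , pm , below = suc m , s≤s m≤N , pm , λ where
  zero    _         → ¬p0
  (suc j) (s≤s j<m) → below j j<m

maximiser : ∀ {A : Set} (f : A → ℕ) {x xs} → x ∈ xs → ∃[ y ] (y ∈ xs × (∀ {z} → z ∈ xs → f z ≤ f y))
maximiser f {x} {xs} x∈xs = argmax f x xs , member (argmax-sel f x xs) , All.lookup (f[xs]≤f[argmax] x xs)
  where
  member : ∀ {y} → y ≡ x ⊎ y ∈ xs → y ∈ xs
  member (inj₁ refl) = x∈xs
  member (inj₂ y∈xs) = y∈xs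

minimiser : ∀ {A : Set} (f : A → ℕ) {x xs} → x ∈ xs → ∃[ y ] (y ∈ xs × (∀ {z} → z ∈ xs → f y ≤ f z))
minimiser f {x} {xs} x∈xs = argmin f x xs , member (argmin-sel f x xs) , All.lookup (f[argmin]≤f[xs] x xs)
  where
  member : ∀ {y} → y ≡ x ⊎ y ∈ xs → y ∈ xs
  member (inj₁ refl) = x∈xs
  member (inj₂ y∈xs) = y∈xs

triangle : ℕ → ℕ
triangle zero    = 0
triangle (suc a) = triangle a + suc a

2*triangle : ∀ a → 2 * triangle a ≡ a * suc a
2*triangle zero    = refl
2*triangle (suc a) = trans (*-distribˡ-+ 2 (triangle a) (suc a)) (trans (cong (λ z → z + 2 * suc a) (2*triangle a)) (expand a))
  where
  expand : ∀ a → a * suc a + 2 * suc a ≡ suc a * suc (suc a)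
  expand = solve-∀

-- ∑_{t ≤ a} #{δ < t}, so that δ + shortfall a δ ≥ a.
shortfall : ℕ → ℕ → ℕ
shortfall zero    δ = 0
shortfall (suc a) δ = shortfall a δ + ∑ (upTo (suc a)) (λ v → 𝟙 (δ ≟ v))

δ+shortfall : ∀ a δ → a ≤ δ + shortfall a δ
δ+shortfall zero    δ = z≤n
δ+shortfall (suc a) δ with suc a ≤? δ
... | yes a<δ = ≤-trans a<δ (m≤m+n δ _)
... | no  a≮δ = begin
  suc a                                                           ≡⟨ +-comm 1 a ⟩
  a + 1                                                           ≤⟨ +-mono-≤ (δ+shortfall a δ) (1≤∑𝟙 (δ ≟_) (∈-upTo⁺ (≰⇒> a≮δ)) refl) ⟩
  δ + shortfall a δ + ∑ (upTo (suc a)) (λ v → 𝟙 (δ ≟ v))          ≡⟨ +-assoc δ _ _ ⟩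
  δ + shortfall (suc a) δ                                         ∎
  where open ≤-Reasoning

module _ {A : Set} (xs : List A) (δ : A → ℕ) {g} (multiplicity : ∀ v → ∑ xs (λ x → 𝟙 (δ x ≟ v)) ≤ g) where

  -- Being smaller than t means being one of t values, each taken at most g times; summing t g over
  -- t ≤ a gives the triangular number.
  ∑-shortfall : ∀ a → ∑ xs (shortfall a ∘ δ) ≤ triangle a * g
  ∑-shortfall zero    = ≤-reflexive (∑-0 xs)
  ∑-shortfall (suc a) = begin
    ∑ xs (shortfall (suc a) ∘ δ)                                                  ≡⟨ ∑-+ xs _ _ ⟩
    ∑ xs (shortfall a ∘ δ) + ∑ xs (λ x → ∑ (upTo (suc a)) (λ v → 𝟙 (δ x ≟ v)))    ≡⟨ cong (λ z → ∑ xs (shortfall a ∘ δ) + z) (∑-swap xs (upTo (suc a)) _) ⟩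
    ∑ xs (shortfall a ∘ δ) + ∑ (upTo (suc a)) (λ v → ∑ xs (λ x → 𝟙 (δ x ≟ v)))    ≤⟨ +-mono-≤ (∑-shortfall a) (∑-mono (upTo (suc a)) multiplicity) ⟩
    triangle a * g + ∑ (upTo (suc a)) (λ _ → g)                                   ≡⟨ cong (λ z → triangle a * g + z) (trans (∑-const (upTo (suc a)) g) (cong (_* g) (length-upTo (suc a)))) ⟩
    triangle a * g + suc a * g                                                    ≡⟨ *-distribʳ-+ g (triangle a) (suc a) ⟨
    triangle (suc a) * g                                                          ∎
    where open ≤-Reasoning

  -- For `length xs` = a g + r this reads ∑ δ ≥ g a (a - 1)/2 + r a.
  length*a≤∑δ : ∀ a → length xs * a ≤ ∑ xs δ + triangle a * g
  length*a≤∑δ a = begin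
    length xs * a                        ≡⟨ ∑-const xs a ⟨
    ∑ xs (λ _ → a)                       ≤⟨ ∑-mono xs (λ x → δ+shortfall a (δ x)) ⟩
    ∑ xs (λ x → δ x + shortfall a (δ x)) ≡⟨ ∑-+ xs δ _ ⟩
    ∑ xs δ + ∑ xs (shortfall a ∘ δ)      ≤⟨ +-monoʳ-≤ (∑ xs δ) (∑-shortfall a) ⟩
    ∑ xs δ + triangle a * g              ∎
    where open ≤-Reasoning

%-+-cancelˡ : ∀ N .{{_ : NonZero N}} c {a b} → (c + a) % N ≡ (c + b) % N → a % N ≡ b % N
%-+-cancelˡ N c {a} {b} eq = begin
  a % N                     ≡⟨ restore a ⟨
  (c′ + (c + a)) % N        ≡⟨ %-+-cong N {a = c′} refl eq ⟩
  (c′ + (c + b)) % N        ≡⟨ restore b ⟩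
  b % N                     ∎
  where
  open ≡-Reasoning
  c′ = c * (N ∸ 1)
  rot : ∀ c d x → c * d + (c + x) ≡ x + c * (1 + d)
  rot = solve-∀
  restore : ∀ x → (c′ + (c + x)) % N ≡ x % N
  restore x = trans (cong (_% N) (trans (rot c (N ∸ 1) x) (cong (λ z → x + c * z) (m+[n∸m]≡n (ℕ.>-nonZero⁻¹ N))))) ([m+kn]%n≡m%n x c N)

record ResidueRuler (g N : ℕ) .{{_ : NonZero N}} (X : List ℕ) : Set where
  field
    unique      : Unique X
    bounded     : ∀ {x} → x ∈ X → x < N
    differences : ∀ t → 0 < t → t < N → ∑ X (λ y → ∑ X (λ x → 𝟙 (x % N ≟ (y + t) % N))) ≤ g

module Unrolling {g N} .{{_ : NonZero g}} .{{_ : NonZero N}} {X} (ruler : ResidueRuler g N X) where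
  open ResidueRuler ruler

  -- How far one has to go forward from y to reach x on the circle ℤ/N.
  dist : ℕ → ℕ → ℕ
  dist y x = (x + (N ∸ y)) % N

  dist<N : ∀ y x → dist y x < N
  dist<N y x = m%n<n _ N

  +-dist : ∀ {y} x → y ≤ N → (y + dist y x) % N ≡ x % N
  +-dist {y} x y≤N = begin
    (y + (x + (N ∸ y)) % N) % N      ≡⟨ %-+-cong N {a = y} refl (m%n%n≡m%n (x + (N ∸ y)) N) ⟩
    (y + (x + (N ∸ y))) % N          ≡⟨ cong (_% N) (rot y x (N ∸ y)) ⟩
    (x + (y + (N ∸ y))) % N          ≡⟨ cong (λ z → (x + z) % N) (m+[n∸m]≡n y≤N) ⟩
    (x + N) % N                      ≡⟨ [m+n]%n≡m%n x N ⟩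
    x % N                            ∎
    where
    open ≡-Reasoning
    rot : ∀ a b c → a + (b + c) ≡ b + (a + c)
    rot = solve-∀

  dist-unique : ∀ {y x s} → y ≤ N → s < N → (y + s) % N ≡ x % N → dist y x ≡ s
  dist-unique {y} {x} {s} y≤N s<N eq = begin
    dist y x          ≡⟨ m<n⇒m%n≡m (dist<N y x) ⟨
    dist y x % N      ≡⟨ %-+-cancelˡ N y (trans (+-dist x y≤N) (sym eq)) ⟩
    s % N             ≡⟨ m<n⇒m%n≡m s<N ⟩
    s                 ∎
    where open ≡-Reasoning

  dist-injective : ∀ {y x x′} → y ≤ N → x < N → x′ < N → dist y x ≡ dist y x′ → x ≡ x′
  dist-injective {y} {x} {x′} y≤N x<N x′<N eq = begin
    x                         ≡⟨ m<n⇒m%n≡m x<N ⟨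
    x % N                     ≡⟨ +-dist x y≤N ⟨
    (y + dist y x) % N        ≡⟨ cong (λ z → (y + z) % N) eq ⟩
    (y + dist y x′) % N       ≡⟨ +-dist x′ y≤N ⟩
    x′ % N                    ≡⟨ m<n⇒m%n≡m x′<N ⟩
    x′                        ∎
    where open ≡-Reasoning

  -- The second alternative ends the search after a full turn, at s + 1 = N, where a lone mark y
  -- meets itself.
  Stop : ℕ → ℕ → Set
  Stop y s = (y + suc s) % N ∈ X ⊎ s ≡ N ∸ 1

  next : ∀ y → ∃[ s ] (s ≤ N ∸ 1 × Stop y s × (∀ j → j < s → ¬ Stop y j))
  next y = least (λ s → ((y + suc s) % N ∈? X) ⊎-dec (s ≟ N ∸ 1)) (N ∸ 1) (inj₂ refl)

  gap : ℕ → ℕ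
  gap y = suc (proj₁ (next y))

  1+[N∸1] : suc (N ∸ 1) ≡ N
  1+[N∸1] = m+[n∸m]≡n (ℕ.>-nonZero⁻¹ N)

  gap≤N : ∀ y → gap y ≤ N
  gap≤N y = subst (gap y ≤_) 1+[N∸1] (s≤s (proj₁ (proj₂ (next y))))

  gap∈X : ∀ {y} → y ∈ X → (y + gap y) % N ∈ X
  gap∈X {y} y∈X with proj₁ (proj₂ (proj₂ (next y)))
  ... | inj₁ ∈X = ∈X
  ... | inj₂ eq = subst (_∈ X) (sym (trans (cong (λ s → (y + suc s) % N) eq) (trans (cong (λ z → (y + z) % N) 1+[N∸1]) (trans ([m+n]%n≡m%n y N) (m<n⇒m%n≡m (bounded y∈X)))))) y∈X

  gap-least : ∀ {y t} → 0 < t → t < gap y → ¬ ((y + t) % N ∈ X)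
  gap-least {y} {suc s} _ (s≤s s<) ∈X = proj₂ (proj₂ (proj₂ (next y))) s s< (inj₁ ∈X)

  arc? : ∀ y m → Dec (dist y m < gap y)
  arc? y m = dist y m <? gap y

  module Arcs {x₀} (x₀∈X : x₀ ∈ X) where

    -- The last mark before m is the one at which the distance to m is smallest.
    arcs-cover : ∀ m → ∃[ y ] (y ∈ X × dist y m < gap y)
    arcs-cover m with minimiser (λ y → dist y m) x₀∈X
    ... | y , y∈X , minimal with arc? y m
    ...   | yes inside = y , y∈X , inside
    ...   | no outside = ⊥-elim (<⇒≱ closer (minimal (gap∈X y∈X)))
      where
      z = (y + gap y) % N
      s = dist y m ∸ gap y
      s<N : s < N
      s<N = ≤-<-trans (m∸n≤m _ (gap y)) (dist<N y m)
      z-dist : dist z m ≡ s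
      z-dist = dist-unique (<⇒≤ (m%n<n _ N)) s<N (begin
        ((y + gap y) % N + s) % N    ≡⟨ %-+-cong N {c = s} (m%n%n≡m%n (y + gap y) N) refl ⟩
        (y + gap y + s) % N          ≡⟨ cong (_% N) (trans (+-assoc y (gap y) s) (cong (λ z → y + z) (m+[n∸m]≡n (≮⇒≥ outside)))) ⟩
        (y + dist y m) % N           ≡⟨ +-dist m (<⇒≤ (bounded y∈X)) ⟩
        m % N                        ∎)
        where open ≡-Reasoning
      closer : dist z m < dist y m
      closer = subst (_< dist y m) (sym z-dist) (∸-monoʳ-< (s≤s z≤n) (≮⇒≥ outside))

    N≤∑gap : N ≤ ∑ X gap
    N≤∑gap = begin
      N                                                   ≡⟨ length-upTo N ⟨
      length (upTo N)                                     ≤⟨ ∑-cover (upTo N) X arc? arcs-cover ⟩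
      ∑ X (λ y → ∑ (upTo N) (λ m → 𝟙 (arc? y m)))         ≤⟨ ∑-mono-∈ X arc-size ⟩
      ∑ X gap                                             ∎
      where
      open ≤-Reasoning
      arc-size : ∀ {y} → y ∈ X → ∑ (upTo N) (λ m → 𝟙 (arc? y m)) ≤ gap y
      arc-size {y} y∈X = begin
        ∑ (upTo N) (λ m → 𝟙 (arc? y m))            ≤⟨ count-injective (arc? y) (0 ≤?_) (dist y) (Unique.upTo⁺ N)
                                                        (λ _ inside → ∈-upTo⁺ inside , z≤n)
                                                        (λ m∈ _ m′∈ _ → dist-injective (<⇒≤ (bounded y∈X)) (∈-upTo⁻ m∈) (∈-upTo⁻ m′∈)) ⟩
        ∑ (upTo (gap y)) (λ s → 𝟙 (0 ≤? s))        ≡⟨ ∑-cong (upTo (gap y)) (λ s → 𝟙-yes (0 ≤? s) z≤n) ⟩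
        ∑ (upTo (gap y)) (λ _ → 1)                 ≡⟨ trans (∑-const (upTo (gap y)) 1) (trans (*-identityʳ _) (length-upTo (gap y))) ⟩
        gap y                                      ∎

    full-gap⇒singleton : ∀ {y z} → y ∈ X → z ∈ X → gap y ≡ N → z ≡ y
    full-gap⇒singleton {y} {z} y∈X z∈X gap≡N with dist y z in eq
    ... | zero  = trans (sym (m<n⇒m%n≡m (bounded z∈X))) (trans (sym (+-dist z (<⇒≤ (bounded y∈X))))
                    (trans (cong (λ s → (y + s) % N) eq) (trans (cong (_% N) (+-identityʳ y)) (m<n⇒m%n≡m (bounded y∈X)))))
    ... | suc s = ⊥-elim (gap-least {y} {dist y z} (subst (0 <_) (sym eq) (s≤s z≤n)) (subst (dist y z <_) (sym gap≡N) (dist<N y z))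
                    (subst (_∈ X) (sym (trans (+-dist z (<⇒≤ (bounded y∈X))) (m<n⇒m%n≡m (bounded z∈X)))) z∈X))

    -- A gap v < N is a difference of two marks, so `differences` applies. A gap N leaves room for a
    -- single mark only, hence occurs at most once, and 1 ≤ g. No gap is 0 or exceeds N.
    gap-multiplicity : ∀ v → ∑ X (λ y → 𝟙 (gap y ≟ v)) ≤ g
    gap-multiplicity zero = ≤-trans (≤-reflexive (trans (∑-cong X (λ y → 𝟙-no (gap y ≟ 0) λ ())) (∑-0 X))) z≤n
    gap-multiplicity v@(suc _) with v <? N
    ... | yes v<N = ≤-trans (∑-mono-∈ X (λ {y} y∈X → hit y y∈X (gap y ≟ v))) (differences v (s≤s z≤n) v<N)
      where
      hit : ∀ y → y ∈ X → (d : Dec (gap y ≡ v)) → 𝟙 d ≤ ∑ X (λ x → 𝟙 (x % N ≟ (y + v) % N))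
      hit y y∈X (no _)     = z≤n
      hit y y∈X (yes refl) = 1≤∑𝟙 (λ x → x % N ≟ (y + gap y) % N) (gap∈X y∈X) (m%n%n≡m%n (y + gap y) N)
    ... | no v≮N = ≤-trans (count-injective (λ y → gap y ≟ v) (0 ≟_) {ys = 0 ∷ []} (λ _ → 0) unique (λ _ _ → here refl , refl)
                     (λ y∈ gy≡v z∈ _ _ → sym (full-gap⇒singleton y∈ z∈ (≤-antisym (gap≤N _) (≤-trans (≮⇒≥ v≮N) (≤-reflexive (sym gy≡v)))))))
                     (ℕ.>-nonZero⁻¹ g)

    longest = maximiser gap x₀∈X
    y₀   = proj₁ longest
    y₀∈X = proj₁ (proj₂ longest)
    M    = gap y₀

    gap≤M : ∀ {y} → y ∈ X → gap y ≤ M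
    gap≤M = proj₂ (proj₂ longest)

    -- Gaps and deficits together sum to `length X` times M. The gaps amount to at least N, and the
    -- deficits, which repeat as rarely as the gaps, are bounded below by `length*a≤∑δ`.
    gap-bound : ∀ a → N + length X * a ≤ length X * M + triangle a * g
    gap-bound a = begin
      N + length X * a                                       ≤⟨ +-mono-≤ N≤∑gap (length*a≤∑δ X deficit multiplicity a) ⟩
      ∑ X gap + (∑ X deficit + triangle a * g)               ≡⟨ +-assoc (∑ X gap) (∑ X deficit) _ ⟨
      ∑ X gap + ∑ X deficit + triangle a * g                 ≡⟨ cong (λ z → z + triangle a * g) (∑-+ X gap deficit) ⟨
      ∑ X (λ y → gap y + deficit y) + triangle a * g         ≤⟨ +-monoˡ-≤ (triangle a * g) (∑-mono-∈ X (λ y∈ → ≤-reflexive (m+[n∸m]≡n (gap≤M y∈)))) ⟩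
      ∑ X (λ _ → M) + triangle a * g                         ≡⟨ cong (λ z → z + triangle a * g) (∑-const X M) ⟩
      length X * M + triangle a * g                          ∎
      where
      open ≤-Reasoning
      deficit : ℕ → ℕ
      deficit y = M ∸ gap y
      multiplicity : ∀ v → ∑ X (λ y → 𝟙 (deficit y ≟ v)) ≤ g
      multiplicity v = ≤-trans (∑-mono-∈ X (λ {y} y∈ → 𝟙-mono (deficit y ≟ v) (gap y ≟ M ∸ v)
        (λ { refl → sym (m∸[m∸n]≡n (gap≤M y∈)) }))) (gap-multiplicity (M ∸ v))

    -- The mark behind the longest gap becomes 0, and `y₀`, just before that gap, becomes the last
    -- mark.
    origin : ℕ
    origin = (y₀ + M) % N

    origin≤N : origin ≤ N
    origin≤N = <⇒≤ (m%n<n _ N)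

    mark : ℕ → ℤ
    mark x = + dist origin x

    marks : List ℤ
    marks = map mark X

    dist-origin-y₀ : dist origin y₀ ≡ N ∸ M
    dist-origin-y₀ = dist-unique origin≤N (∸-monoʳ-< (s≤s z≤n) (gap≤N y₀)) (begin
      ((y₀ + M) % N + (N ∸ M)) % N     ≡⟨ %-+-cong N {c = N ∸ M} (m%n%n≡m%n (y₀ + M) N) refl ⟩
      (y₀ + M + (N ∸ M)) % N           ≡⟨ cong (_% N) (trans (+-assoc y₀ M _) (cong (λ z → y₀ + z) (m+[n∸m]≡n (gap≤N y₀)))) ⟩
      (y₀ + N) % N                     ≡⟨ [m+n]%n≡m%n y₀ N ⟩
      y₀ % N                           ∎)
      where open ≡-Reasoning

    -- A mark farther than N - M from the origin would lie strictly inside the longest gap, contrary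
    -- to `gap-least`.
    dist-origin≤ : ∀ {x} → x ∈ X → dist origin x ≤ N ∸ M
    dist-origin≤ {x} x∈X = ≮⇒≥ λ N∸M<s → gap-least {y₀} {s + M ∸ N}
      (m<n⇒0<n∸m (subst (_< s + M) (m∸n+n≡m (gap≤N y₀)) (+-monoˡ-< M N∸M<s)))
      (subst (s + M ∸ N <_) (m+n∸m≡n N M) (∸-monoˡ-< (+-monoˡ-< M (dist<N origin x)) (N≤ N∸M<s)))
      (subst (_∈ X) (sym (trans (residue (N≤ N∸M<s)) (m<n⇒m%n≡m (bounded x∈X)))) x∈X)
      where
      open ≡-Reasoning
      s = dist origin x
      N≤ : N ∸ M < s → N ≤ s + M
      N≤ lt = <⇒≤ (subst (_< s + M) (m∸n+n≡m (gap≤N y₀)) (+-monoˡ-< M lt))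
      rot : ∀ y s m → y + (s + m) ≡ y + m + s
      rot = solve-∀
      residue : N ≤ s + M → (y₀ + (s + M ∸ N)) % N ≡ x % N
      residue N≤s+M = begin
        (y₀ + (s + M ∸ N)) % N         ≡⟨ [m+n]%n≡m%n _ N ⟨
        (y₀ + (s + M ∸ N) + N) % N     ≡⟨ cong (_% N) (trans (+-assoc y₀ _ N) (cong (λ z → y₀ + z) (m∸n+n≡m N≤s+M))) ⟩
        (y₀ + (s + M)) % N             ≡⟨ cong (_% N) (rot y₀ s M) ⟩
        (y₀ + M + s) % N               ≡⟨ %-+-cong N {c = s} (m%n%n≡m%n (y₀ + M) N) refl ⟨
        (origin + s) % N               ≡⟨ +-dist x origin≤N ⟩
        x % N                          ∎

    marks-unique : Unique marks
    marks-unique = AllPairs.map⁺ (separate X id unique)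
      where
      separate : ∀ Y → (∀ {x} → x ∈ Y → x ∈ X) → Unique Y → AllPairs.AllPairs (λ x y → mark x ≢ mark y) Y
      separate []      _   _            = AllPairs.[]
      separate (y ∷ Y) Y⊆X (y∉ AllPairs.∷ u) =
        All.tabulate (λ z∈ eq → All.lookup y∉ z∈ (dist-injective origin≤N (bounded (Y⊆X (here refl))) (bounded (Y⊆X (there z∈))) (ℤₚ.+-injective eq)))
        AllPairs.∷ separate Y (Y⊆X ∘ there) u

    shift⇒≡ : ∀ {t} y x → mark x ℤ.- mark y ≡ + t → dist origin x ≡ dist origin y + t
    shift⇒≡ {t} y x eq = ℤₚ.+-injective (begin
      + dist origin x                             ≡⟨ //-rightDividesˡ (mark y) (mark x) ⟨
      (mark x ℤ.- mark y) ℤ.+ mark y              ≡⟨ cong (λ z → z ℤ.+ mark y) eq ⟩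
      + t ℤ.+ + dist origin y                     ≡⟨ ℤₚ.+-comm (+ t) (+ dist origin y) ⟩
      + (dist origin y + t)                       ∎)
      where open ≡-Reasoning

    -- Marks that differ by t as integers also differ by t modulo N, so `differences` covers t < N;
    -- larger t do not occur between numbers in [0, N).
    marks-golomb : ∀ d → + 0 ℤ.< d → length (pairsWithDifference marks d) ≤ g
    marks-golomb (+ t) (ℤ.+<+ 0<t) = begin
      length (pairsWithDifference marks (+ t))                           ≡⟨ length-filter-∑ _ (cartesianProduct marks marks) ⟩
      ∑ (cartesianProduct marks marks) (λ (a , c) → 𝟙 ((c ℤ.- a) ℤ.≟ + t)) ≡⟨ ∑-cartesianProductWith _,_ marks marks _ ⟩
      ∑ marks (λ a → ∑ marks (λ c → 𝟙 ((c ℤ.- a) ℤ.≟ + t)))              ≡⟨ trans (∑-map mark X _) (∑-cong X (λ y → ∑-map mark X _)) ⟩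
      ∑ X (λ y → ∑ X (λ x → 𝟙 ((mark x ℤ.- mark y) ℤ.≟ + t)))            ≤⟨ bound (t <? N) ⟩
      g                                                                  ∎
      where
      open ≤-Reasoning
      bound : Dec (t < N) → ∑ X (λ y → ∑ X (λ x → 𝟙 ((mark x ℤ.- mark y) ℤ.≟ + t))) ≤ g
      bound (yes t<N) = ≤-trans (∑-mono X (λ y → ∑-mono X (λ x → 𝟙-mono ((mark x ℤ.- mark y) ℤ.≟ + t) (x % N ≟ (y + t) % N) (residue y x)))) (differences t 0<t t<N)
        where
        residue : ∀ y x → mark x ℤ.- mark y ≡ + t → x % N ≡ (y + t) % N
        residue y x eq = E.begin
          x % N                                    E.≡⟨ +-dist x origin≤N ⟨
          (origin + dist origin x) % N             E.≡⟨ cong (λ z → (origin + z) % N) (shift⇒≡ y x eq) ⟩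
          (origin + (dist origin y + t)) % N       E.≡⟨ cong (_% N) (+-assoc origin _ t) ⟨
          (origin + dist origin y + t) % N         E.≡⟨ %-+-cong N {c = t} (+-dist y origin≤N) refl ⟩
          (y + t) % N                              E.∎
          where module E = ≡-Reasoning
      bound (no t≮N) = ≤-trans (≤-reflexive (trans (∑-cong X (λ y → trans (∑-cong X (λ x → 𝟙-no ((mark x ℤ.- mark y) ℤ.≟ + t)
        (λ eq → t≮N (≤-<-trans (m≤n+m t _) (subst (_< N) (shift⇒≡ y x eq) (dist<N origin x)))))) (∑-0 X))) (∑-0 X))) z≤n

    rulerDiameter : IsRulerDiameter g (length X) (+ (N ∸ M))
    rulerDiameter = marks , (marks-unique , marks-golomb) , length-map mark X ,
      + 0 , + (N ∸ M) ,
      subst (_∈ marks) (cong +_ (dist-unique origin≤N (ℕ.>-nonZero⁻¹ N) (cong (_% N) (+-identityʳ origin)))) (∈-map⁺ mark (gap∈X y₀∈X)) ,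
      subst (_∈ marks) (cong +_ dist-origin-y₀) (∈-map⁺ mark y₀∈X) ,
      (λ z z∈ → let x , x∈X , z≡ = ∈-map⁻ mark z∈ in
        subst (+ 0 ℤ.≤_) (sym z≡) (ℤ.+≤+ z≤n) , subst (ℤ._≤ + (N ∸ M)) (sym z≡) (ℤ.+≤+ (dist-origin≤ x∈X))) ,
      sym (ℤₚ.+-identityʳ (+ (N ∸ M)))

-- Discarding marks only removes differences, so any n of them still form a ruler.
modular⇒residueRuler : ∀ {g N} .{{_ : NonZero N}} {A : List (Fin N)} → IsModularGolombRuler g N A →
  ∀ n → ResidueRuler g N (map toℕ (take n A))
modular⇒residueRuler {g} {N} {A} (A-unique , A-golomb) n = record
  { unique  = Unique.map⁺ Finₚ.toℕ-injective (Unique.take⁺ n A-unique)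
  ; bounded = λ x∈ → let a , _ , x≡ = ∈-map⁻ toℕ x∈ in subst (_< N) (sym x≡) (Finₚ.toℕ<n a)
  ; differences = λ t 0<t t<N → let d = Fin.fromℕ< t<N ; toℕ-d = Finₚ.toℕ-fromℕ< t<N in begin
      ∑ X (λ y → ∑ X (λ x → 𝟙 (x % N ≟ (y + t) % N)))                        ≡⟨ trans (∑-map toℕ (take n A) _) (∑-cong (take n A) (λ b → ∑-map toℕ (take n A) _)) ⟩
      ∑ (take n A) (λ b → ∑ (take n A) (λ a → 𝟙 (toℕ a % N ≟ (toℕ b + t) % N))) ≤⟨ ∑-mono (take n A) (λ b → ∑-⊆ (take-⊆ n A) _) ⟩
      ∑ (take n A) (λ b → ∑ A (λ a → 𝟙 (toℕ a % N ≟ (toℕ b + t) % N)))       ≤⟨ ∑-⊆ (take-⊆ n A) _ ⟩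
      ∑ A (λ b → ∑ A (λ a → 𝟙 (toℕ a % N ≟ (toℕ b + t) % N)))                ≡⟨ ∑-swap A A _ ⟩
      ∑ A (λ a → ∑ A (λ b → 𝟙 (toℕ a % N ≟ (toℕ b + t) % N)))                ≤⟨ ∑-mono A (λ a → ∑-mono A (λ b → 𝟙-mono (toℕ a % N ≟ (toℕ b + t) % N)
                                                                                   (¬? (a Fin.≟ b) ×-dec differMod? N a b d)
                                                                                   (λ eq → distinct 0<t t<N eq , %≡⇒DifferMod a b d (trans eq (cong (λ z → (toℕ b + z) % N) (sym toℕ-d)))))) ⟩
      ∑ A (λ a → ∑ A (λ b → 𝟙 (¬? (a Fin.≟ b) ×-dec differMod? N a b d)))    ≡⟨ ∑-cartesianProductWith _,_ A A _ ⟨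
      ∑ (cartesianProduct A A) (λ (a , b) → 𝟙 (¬? (a Fin.≟ b) ×-dec differMod? N a b d)) ≡⟨ length-filter-∑ _ (cartesianProduct A A) ⟨
      length (pairsWithDifferenceMod A d)                                    ≤⟨ A-golomb d (λ d≡0 → <⇒≢ 0<t (sym (trans (sym toℕ-d) d≡0))) ⟩
      g                                                                      ∎
  }
  where
  open ≤-Reasoning
  X = map toℕ (take n A)
  distinct : ∀ {a b : Fin N} {t} → 0 < t → t < N → toℕ a % N ≡ (toℕ b + t) % N → a ≢ b
  distinct {a} {t = t} 0<t t<N eq refl = <⇒≢ 0<t (trans (sym (trans (sym (%-+-cancelˡ N (toℕ a) (trans (cong (_% N) (+-identityʳ (toℕ a))) eq))) (m*n%n≡0 0 N))) (m<n⇒m%n≡m t<N))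

modular⇒rulerDiameter : ∀ {g N n} .{{_ : NonZero g}} .{{_ : NonZero N}} .{{_ : NonZero n}} {A : List (Fin N)} →
  IsModularGolombRuler g N A → n ≤ length A →
  ∃[ M ] (M ≤ N × IsRulerDiameter g n (+ (N ∸ M)) × (∀ a → N + n * a ≤ n * M + triangle a * g))
modular⇒rulerDiameter {g} {N} {n} {A} modular n≤ with map toℕ (take n A) in eq
... | [] = ⊥-elim (<⇒≢ (ℕ.>-nonZero⁻¹ n) (trans (cong length (sym eq)) length-X))
  where
  length-X : length (map toℕ (take n A)) ≡ n
  length-X = trans (length-map toℕ (take n A)) (trans (length-take n A) (m≤n⇒m⊓n≡m n≤))
... | x ∷ X = M , gap≤N y₀ , subst (λ n → IsRulerDiameter g n (+ (N ∸ M))) length-X rulerDiameter ,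
    λ a → subst (λ n → N + n * a ≤ n * M + triangle a * g) length-X (gap-bound a)
  where
  open Unrolling (subst (ResidueRuler g N) eq (modular⇒residueRuler modular n))
  open Arcs (here refl)
  length-X : length (x ∷ X) ≡ n
  length-X = trans (cong length (sym eq)) (trans (length-map toℕ (take n A)) (trans (length-take n A) (m≤n⇒m⊓n≡m n≤)))

-- Existence of the minimal diameter

words : ∀ {A : Set} → ℕ → List A → List (List A)
words zero    xs = [] ∷ []
words (suc n) xs = cartesianProductWith _∷_ xs (words n xs)

∈-words : ∀ {A : Set} {xs ys : List A} → All (_∈ xs) ys → ys ∈ words (length ys) xs
∈-words []         = here refl
∈-words (y∈ ∷ ys∈) = ∈-cartesianProductWith⁺ _∷_ y∈ (∈-words ys∈)

-- Of the infinitely many d, those that are no difference of S have an empty list of pairs; it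
-- remains to test c - a for the pairs of S.
isGolombRuler? : ∀ g S → Dec (IsGolombRuler g S)
isGolombRuler? g S = Data.List.Relation.Unary.Unique.DecPropositional.unique? ℤ._≟_ S ×-dec
  Dec.map′ from to (all? (λ (a , c) → (+ 0 ℤ.<? c ℤ.- a) →-dec (length (pairsWithDifference S (c ℤ.- a)) ≤? g)) (cartesianProduct S S))
  where
  Small : ℤ → Set
  Small d = + 0 ℤ.< d → length (pairsWithDifference S d) ≤ g
  to : (∀ d → Small d) → All (λ (a , c) → Small (c ℤ.- a)) (cartesianProduct S S)
  to small = All.universal (λ (a , c) → small (c ℤ.- a)) _
  from : All (λ (a , c) → Small (c ℤ.- a)) (cartesianProduct S S) → ∀ d → Small d
  from small d 0<d with pairsWithDifference S d in eq
  ... | []          = z≤n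
  ... | (a , c) ∷ _ with ∈-filter⁻ (λ (a , c) → (c ℤ.- a) ℤ.≟ d) {xs = cartesianProduct S S} (subst ((a , c) ∈_) (sym eq) (here refl))
  ...   | pair∈ , refl = subst (λ ps → length ps ≤ g) eq (All.lookup small pair∈ 0<d)

-- Rulers may be translated to start at 0, so only finitely many have to be searched.
Normalised : ℕ → ℕ → ℕ → List ℤ → Set
Normalised g n k S = IsGolombRuler g S × length S ≡ n × + 0 ∈ S × + k ∈ S × All (λ x → + 0 ℤ.≤ x × x ℤ.≤ + k) S

normalised? : ∀ g n k S → Dec (Normalised g n k S)
normalised? g n k S = isGolombRuler? g S ×-dec (length S ≟ n) ×-dec (+ 0 ∈ℤ? S) ×-dec (+ k ∈ℤ? S) ×-dec
  all? (λ x → (+ 0 ℤ.≤? x) ×-dec (x ℤ.≤? + k)) S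
  where open Data.List.Membership.DecPropositional ℤ._≟_ using () renaming (_∈?_ to _∈ℤ?_)

sub-cancel : ∀ a b c → (a ℤ.- c) ℤ.- (b ℤ.- c) ≡ a ℤ.- b
sub-cancel a b c = begin
  (a ℤ.- c) ℤ.- (b ℤ.- c)        ≡⟨ cong (λ z → (a ℤ.- c) ℤ.+ z) (trans (ℤₚ.neg-distrib-+ b (ℤ.- c)) (trans (ℤₚ.+-comm (ℤ.- b) _) (cong (λ z → z ℤ.- b) (ℤₚ.neg-involutive c)))) ⟩
  (a ℤ.- c) ℤ.+ (c ℤ.- b)        ≡⟨ ℤₚ.+-minus-telescope a c b ⟩
  a ℤ.- b                        ∎
  where open ≡-Reasoning

golomb-translate : ∀ {g S} c → IsGolombRuler g S → IsGolombRuler g (map (ℤ._- c) S)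
golomb-translate {g} {S} c (unique , golomb) =
  Unique.map⁺ (λ {x} {y} eq → trans (sym (//-rightDividesˡ c x)) (trans (cong (ℤ._+ c) eq) (//-rightDividesˡ c y))) unique ,
  λ d 0<d → ≤-trans (≤-reflexive (same d)) (golomb d 0<d)
  where
  open ≡-Reasoning
  same : ∀ d → length (pairsWithDifference (map (ℤ._- c) S) d) ≡ length (pairsWithDifference S d)
  same d = begin
    length (pairsWithDifference (map (ℤ._- c) S) d)                       ≡⟨ length-filter-∑ _ (cartesianProduct (map (ℤ._- c) S) (map (ℤ._- c) S)) ⟩
    ∑ (cartesianProduct (map (ℤ._- c) S) (map (ℤ._- c) S)) (λ (x , y) → 𝟙 ((y ℤ.- x) ℤ.≟ d))
                                                                          ≡⟨ ∑-cartesianProductWith _,_ (map (ℤ._- c) S) (map (ℤ._- c) S) _ ⟩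
    ∑ (map (ℤ._- c) S) (λ x → ∑ (map (ℤ._- c) S) (λ y → 𝟙 ((y ℤ.- x) ℤ.≟ d))) ≡⟨ trans (∑-map (ℤ._- c) S _) (∑-cong S (λ x → ∑-map (ℤ._- c) S _)) ⟩
    ∑ S (λ x → ∑ S (λ y → 𝟙 (((y ℤ.- c) ℤ.- (x ℤ.- c)) ℤ.≟ d)))           ≡⟨ ∑-cong S (λ x → ∑-cong S (λ y → cong (λ z → 𝟙 (z ℤ.≟ d)) (sub-cancel y x c))) ⟩
    ∑ S (λ x → ∑ S (λ y → 𝟙 ((y ℤ.- x) ℤ.≟ d)))                           ≡⟨ ∑-cartesianProductWith _,_ S S _ ⟨
    ∑ (cartesianProduct S S) (λ (x , y) → 𝟙 ((y ℤ.- x) ℤ.≟ d))            ≡⟨ length-filter-∑ _ (cartesianProduct S S) ⟨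
    length (pairsWithDifference S d)                                      ∎

normalise : ∀ {g n k} → IsRulerDiameter g n (+ k) → ∃[ S ] Normalised g n k S
normalise {k = k} (S , golomb , len , lo , hi , lo∈ , hi∈ , bounds , k≡) =
  map (ℤ._- lo) S , golomb-translate lo golomb , trans (length-map _ S) len ,
  subst (_∈ map (ℤ._- lo) S) (ℤₚ.+-inverseʳ lo) (∈-map⁺ (ℤ._- lo) lo∈) ,
  subst (_∈ map (ℤ._- lo) S) (sym k≡) (∈-map⁺ (ℤ._- lo) hi∈) ,
  All.tabulate (λ y∈ → let x , x∈ , y≡ = ∈-map⁻ (ℤ._- lo) y∈ ; lo≤x , x≤hi = bounds x x∈ in
    subst (+ 0 ℤ.≤_) (sym y≡) (ℤₚ.i≤j⇒0≤j-i lo≤x) ,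
    subst₂ ℤ._≤_ (sym y≡) (sym k≡) (ℤₚ.+-monoˡ-≤ (ℤ.- lo) x≤hi))

normalised⇒diameter : ∀ {g n k S} → Normalised g n k S → IsRulerDiameter g n (+ k)
normalised⇒diameter {k = k} {S} (golomb , len , 0∈ , k∈ , bounds) =
  S , golomb , len , + 0 , + k , 0∈ , k∈ , (λ x x∈ → All.lookup bounds x∈) , sym (ℤₚ.+-identityʳ (+ k))

rulerDiameter? : ∀ g n k → Dec (IsRulerDiameter g n (+ k))
rulerDiameter? g n k = Dec.map′ (λ any → normalised⇒diameter (proj₂ (proj₂ (find any))))
  (λ diameter → let S , normal = normalise diameter in lose (S∈words normal) normal)
  (any? (normalised? g n k) (words n range))
  where
  range : List ℤ
  range = map +_ (upTo (suc k))
  in-range : ∀ {x} → + 0 ℤ.≤ x × x ℤ.≤ + k → x ∈ range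
  in-range (ℤ.+≤+ _ , ℤ.+≤+ j≤k) = ∈-map⁺ +_ (∈-upTo⁺ (s≤s j≤k))
  S∈words : ∀ {S} → Normalised g n k S → S ∈ words n range
  S∈words {S} (_ , refl , _ , _ , bounds) = ∈-words (All.map in-range bounds)

diameter≥0 : ∀ {g n m} → IsRulerDiameter g n m → + 0 ℤ.≤ m
diameter≥0 (S , _ , _ , lo , hi , lo∈ , _ , bounds , refl) = ℤₚ.i≤j⇒0≤j-i (proj₂ (bounds lo lo∈))

-- Diameters are nonnegative and decidable, so a search from 0 upwards that succeeds at k at the
-- latest finds the minimum.
rulerDiameter⇒IsG : ∀ {g n k} → IsRulerDiameter g n (+ k) → ∃[ m ] (IsG g n m × m ℤ.≤ + k)
rulerDiameter⇒IsG {g} {n} {k} diameter with least (rulerDiameter? g n) k diameter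
... | m , m≤k , diameter-m , minimal = + m , (diameter-m , smallest) , ℤ.+≤+ m≤k
  where
  smallest : ∀ m′ → IsRulerDiameter g n m′ → + m ℤ.≤ m′
  smallest (+ j)      diameter-j = ℤ.+≤+ (≮⇒≥ (λ j<m → minimal j j<m diameter-j))
  smallest (ℤ.-[1+ j ]) diameter-j = ⊥-elim (negative (diameter≥0 diameter-j))
    where
    negative : ¬ (+ 0 ℤ.≤ ℤ.-[1+ j ])
    negative ()

-- Ceilings and the final estimates

*≤⇒≤/ : ∀ k x d .{{_ : NonZero d}} → k ℤ.* + d ℤ.≤ x → k ℤ.≤ x ℤDivMod./ℕ d
*≤⇒≤/ k x d kd≤x = ℤₚ.≮⇒≥ λ x/d<k → ℤₚ.<⇒≱ (below x/d<k) kd≤x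
  where
  open ℤₚ.≤-Reasoning
  below : x ℤDivMod./ℕ d ℤ.< k → x ℤ.< k ℤ.* + d
  below x/d<k = begin-strict
    x                                                        ≡⟨ ℤDivMod.a≡a%ℕn+[a/ℕn]*n x d ⟩
    + (x ℤDivMod.%ℕ d) ℤ.+ (x ℤDivMod./ℕ d) ℤ.* + d          <⟨ ℤₚ.+-monoˡ-< ((x ℤDivMod./ℕ d) ℤ.* + d) (ℤ.+<+ (ℤDivMod.n%ℕd<d x d)) ⟩
    + d ℤ.+ (x ℤDivMod./ℕ d) ℤ.* + d                         ≡⟨ ℤₚ.suc-* (x ℤDivMod./ℕ d) (+ d) ⟨
    ℤ.suc (x ℤDivMod./ℕ d) ℤ.* + d                           ≤⟨ ℤₚ.*-monoʳ-≤-nonNeg (+ d) (ℤₚ.i<j⇒suc[i]≤j x/d<k) ⟩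
    k ℤ.* + d                                                ∎

-- `ceiling` is minus the floor of the negative, so `*≤⇒≤/` is applied to -M and -x.
ceiling≤ : ∀ x M → x ℚ.≤ (+ M ℚ./ 1) → ceiling x ℤ.≤ + M
ceiling≤ (mkℚᵘ x d) M (*≤* x≤M) = subst (ceiling (mkℚᵘ x d) ℤ.≤_) (ℤₚ.neg-involutive (+ M))
  (ℤₚ.neg-mono-≤ (subst (ℤ.- + M ℤ.≤_) (sym (ℤDivMod.div-pos-is-/ℕ (ℤ.- x) (suc d)))
    (*≤⇒≤/ (ℤ.- + M) (ℤ.- x) (suc d) (subst₂ ℤ._≤_ (ℤₚ.neg-distribˡ-* (+ M) (+ suc d)) (cong ℤ.-_ (ℤₚ.*-identityʳ x)) (ℤₚ.neg-mono-≤ x≤M)))))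

-- The hypothesis is the inequality under the ceiling with the denominators 2 and n cleared.
ceiling-bound : ∀ N g n M .{{_ : NonZero n}} a r →
  + 2 ℤ.* + N ℤ.+ (+ g ℤ.* a ℤ.* (a ℤ.- + 1) ℤ.+ + 2 ℤ.* (r ℤ.* a)) ℤ.≤ + 2 ℤ.* (+ n ℤ.* + M) →
  ceiling (((+ N ℚ./ 1) ℚ.+ ((+ g ℤ.* a ℤ.* (a ℤ.- + 1)) ℚ./ 2) ℚ.+ ((r ℤ.* a) ℚ./ 1)) ℚ.* (+ 1 ℚ./ n)) ℤ.≤ + M
ceiling-bound N g zero        M a r _     = ⊥-elim (ℕ.≢-nonZero⁻¹ 0 refl)
ceiling-bound N g n@(suc n-1) M a r bound = ceiling≤ (((+ N ℚ./ 1) ℚ.+ (X ℚ./ 2) ℚ.+ ((r ℤ.* a) ℚ./ 1)) ℚ.* (+ 1 ℚ./ n)) M (*≤* (begin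
  ((+ N ℤ.* + 2 ℤ.+ X ℤ.* + 1) ℤ.* + 1 ℤ.+ r ℤ.* a ℤ.* + 2) ℤ.* + 1 ℤ.* + 1     ≡⟨ numerator (+ N) X (r ℤ.* a) ⟩
  + 2 ℤ.* + N ℤ.+ (X ℤ.+ + 2 ℤ.* (r ℤ.* a))                                     ≤⟨ bound ⟩
  + 2 ℤ.* (+ n ℤ.* + M)                                                         ≡⟨ denominator (+ n) (+ M) ⟩
  + M ℤ.* (+ 2 ℤ.* + n)                                                         ≡⟨ cong (λ z → + M ℤ.* z) (ℤₚ.pos-* 2 n) ⟨
  + M ℤ.* + (2 * n)                                                             ∎))
  where
  open ℤₚ.≤-Reasoning
  X = + g ℤ.* a ℤ.* (a ℤ.- + 1)
  numerator : ∀ N X y → ((N ℤ.* + 2 ℤ.+ X ℤ.* + 1) ℤ.* + 1 ℤ.+ y ℤ.* + 2) ℤ.* + 1 ℤ.* + 1 ≡ + 2 ℤ.* N ℤ.+ (X ℤ.+ + 2 ℤ.* y)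
  numerator = solve-∀-ℤ
  denominator : ∀ n M → + 2 ℤ.* (n ℤ.* M) ≡ M ℤ.* (+ 2 ℤ.* n)
  denominator = solve-∀-ℤ

-- Twice the gap bound, where n = a g + r gives 2 n a - a (a + 1) g = g a (a - 1) + 2 r a.
gap-bound⇒ : ∀ N g n M a r → n ≡ a * g + r → N + n * a ≤ n * M + triangle a * g →
  + 2 ℤ.* + N ℤ.+ (+ g ℤ.* + a ℤ.* (+ a ℤ.- + 1) ℤ.+ + 2 ℤ.* (+ r ℤ.* + a)) ℤ.≤ + 2 ℤ.* (+ n ℤ.* + M)
gap-bound⇒ N g n M a r n≡ bound = begin
  + 2 ℤ.* + N ℤ.+ (+ g ℤ.* + a ℤ.* (+ a ℤ.- + 1) ℤ.+ + 2 ℤ.* (+ r ℤ.* + a))           ≡⟨ expand (+ N) (+ g) (+ a) (+ r) ⟩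
  (+ 2 ℤ.* + N ℤ.+ + 2 ℤ.* ((+ a ℤ.* + g ℤ.+ + r) ℤ.* + a)) ℤ.- T                     ≡⟨ cong (λ z → (+ 2 ℤ.* + N ℤ.+ + 2 ℤ.* (z ℤ.* + a)) ℤ.- T) n≡ℤ ⟨
  (+ 2 ℤ.* + N ℤ.+ + 2 ℤ.* (+ n ℤ.* + a)) ℤ.- T                                       ≡⟨ cong (λ z → z ℤ.- T) (push N n a) ⟨
  + (2 * N + 2 * (n * a)) ℤ.- T                                                       ≤⟨ ℤₚ.+-monoˡ-≤ (ℤ.- T) (ℤ.+≤+ doubled) ⟩
  + (2 * (n * M) + a * suc a * g) ℤ.- T                                               ≡⟨ cong (λ z → z ℤ.- T) (trans (ℤₚ.pos-+ (2 * (n * M)) _)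
                                                                                           (cong₂ ℤ._+_ (trans (ℤₚ.pos-* 2 (n * M)) (cong (λ z → + 2 ℤ.* z) (ℤₚ.pos-* n M)))
                                                                                             (trans (ℤₚ.pos-* (a * suc a) g) (cong (λ z → z ℤ.* + g) (ℤₚ.pos-* a (suc a)))))) ⟩
  (+ 2 ℤ.* (+ n ℤ.* + M) ℤ.+ T) ℤ.- T                                                 ≡⟨ cancel (+ 2 ℤ.* (+ n ℤ.* + M)) T ⟩
  + 2 ℤ.* (+ n ℤ.* + M)                                                               ∎
  where
  open ℤₚ.≤-Reasoning
  T = + a ℤ.* (+ 1 ℤ.+ + a) ℤ.* + g
  expand : ∀ N g a r → + 2 ℤ.* N ℤ.+ (g ℤ.* a ℤ.* (a ℤ.- + 1) ℤ.+ + 2 ℤ.* (r ℤ.* a)) ≡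
                       (+ 2 ℤ.* N ℤ.+ + 2 ℤ.* ((a ℤ.* g ℤ.+ r) ℤ.* a)) ℤ.- a ℤ.* (+ 1 ℤ.+ a) ℤ.* g
  expand = solve-∀-ℤ
  cancel : ∀ x y → (x ℤ.+ y) ℤ.- y ≡ x
  cancel = solve-∀-ℤ
  n≡ℤ : + n ≡ + a ℤ.* + g ℤ.+ + r
  n≡ℤ = trans (cong +_ n≡) (trans (ℤₚ.pos-+ (a * g) r) (cong (λ z → z ℤ.+ + r) (ℤₚ.pos-* a g)))
  push : ∀ N n a → + (2 * N + 2 * (n * a)) ≡ + 2 ℤ.* + N ℤ.+ + 2 ℤ.* (+ n ℤ.* + a)
  push N n a = trans (ℤₚ.pos-+ (2 * N) _) (cong₂ ℤ._+_ (ℤₚ.pos-* 2 N) (trans (ℤₚ.pos-* 2 (n * a)) (cong (λ z → + 2 ℤ.* z) (ℤₚ.pos-* n a))))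
  doubled : 2 * N + 2 * (n * a) ≤ 2 * (n * M) + a * suc a * g
  doubled = ≤-trans (≤-reflexive (sym (*-distribˡ-+ 2 N (n * a)))) (≤-trans (*-monoʳ-≤ 2 bound)
    (≤-reflexive (trans (*-distribˡ-+ 2 (n * M) _) (cong (λ z → 2 * (n * M) + z) (trans (sym (*-assoc 2 (triangle a) g)) (cong (_* g) (2*triangle a)))))))

marks≤ : ∀ Q M η ρ ℓ → 2 * Q + ρ * M ≤ 2 * ℓ + η * M →
  (+ Q ℚ./ 1) ℚ.- ((+ M ℤ.* (+ η ℤ.- + ρ)) ℚ./ 2) ℚ.≤ (+ ℓ ℚ./ 1)
marks≤ Q M η ρ ℓ bound = *≤* (begin
  (+ Q ℤ.* + 2 ℤ.+ (ℤ.- (+ M ℤ.* (+ η ℤ.- + ρ))) ℤ.* + 1) ℤ.* + 1     ≡⟨ regroup (+ Q) (+ M) (+ η) (+ ρ) ⟩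
  (+ 2 ℤ.* + Q ℤ.+ + ρ ℤ.* + M) ℤ.- + η ℤ.* + M                       ≡⟨ cong (λ z → z ℤ.- + η ℤ.* + M) (push Q ρ) ⟨
  + (2 * Q + ρ * M) ℤ.- + η ℤ.* + M                                   ≤⟨ ℤₚ.+-monoˡ-≤ (ℤ.- (+ η ℤ.* + M)) (ℤ.+≤+ bound) ⟩
  + (2 * ℓ + η * M) ℤ.- + η ℤ.* + M                                   ≡⟨ cong (λ z → z ℤ.- + η ℤ.* + M) (push ℓ η) ⟩
  (+ 2 ℤ.* + ℓ ℤ.+ + η ℤ.* + M) ℤ.- + η ℤ.* + M                       ≡⟨ cancel (+ ℓ) (+ η ℤ.* + M) ⟩
  + ℓ ℤ.* + 2                                                         ∎)
  where
  open ℤₚ.≤-Reasoning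
  push : ∀ x y → + (2 * x + y * M) ≡ + 2 ℤ.* + x ℤ.+ + y ℤ.* + M
  push x y = trans (ℤₚ.pos-+ (2 * x) _) (cong₂ ℤ._+_ (ℤₚ.pos-* 2 x) (ℤₚ.pos-* y M))
  regroup : ∀ Q M η ρ → (Q ℤ.* + 2 ℤ.+ (ℤ.- (M ℤ.* (η ℤ.- ρ))) ℤ.* + 1) ℤ.* + 1 ≡ (+ 2 ℤ.* Q ℤ.+ ρ ℤ.* M) ℤ.- η ℤ.* M
  regroup = solve-∀-ℤ
  cancel : ∀ x y → (+ 2 ℤ.* x ℤ.+ y) ℤ.- y ≡ x ℤ.* + 2
  cancel = solve-∀-ℤ

/1-cancel-≤ : ∀ {m n} → (+ m ℚ./ 1) ℚ.≤ (+ n ℚ./ 1) → m ≤ n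
/1-cancel-≤ {m} {n} (*≤* m≤n) = ℤₚ.drop‿+≤+ (subst₂ ℤ._≤_ (ℤₚ.*-identityʳ (+ m)) (ℤₚ.*-identityʳ (+ n)) m≤n)

-- If a were at most -1, then r = n - a g would be at least g.
quotient-nonNegative : ∀ {n g r} a → + n ≡ a ℤ.* + g ℤ.+ + r → r < g → ∃[ b ] (a ≡ + b × n ≡ b * g + r)
quotient-nonNegative {n} {g} {r} (+ b) eq r<g = b , refl ,
  ℤₚ.+-injective (trans eq (trans (cong (λ z → z ℤ.+ + r) (sym (ℤₚ.pos-* b g))) (sym (ℤₚ.pos-+ (b * g) r))))
quotient-nonNegative {n} {g} {r} ℤ.-[1+ b ] eq r<g = ⊥-elim (<⇒≱ r<g (≤-trans (m≤m+n g (b * g)) (≤-trans (m≤n+m _ n) (≤-reflexive (ℤₚ.+-injective total)))))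
  where
  cancel : ∀ x r → (ℤ.- x ℤ.+ r) ℤ.+ x ≡ r
  cancel = solve-∀-ℤ
  total : + (n + suc b * g) ≡ + r
  total = trans (ℤₚ.pos-+ n (suc b * g)) (trans (cong₂ ℤ._+_ eq (ℤₚ.pos-* (suc b) g))
    (trans (cong (λ z → (z ℤ.+ + r) ℤ.+ + suc b ℤ.* + g) (sym (ℤₚ.neg-distribˡ-* (+ suc b) (+ g)))) (cancel (+ suc b ℤ.* + g) (+ r))))

golomb-diameter-bound : ∀ {g N} .{{_ : NonZero g}} .{{_ : NonZero N}} {A : List (Fin N)} → IsModularGolombRuler g N A →
  ∀ n .{{_ : NonZero n}} → n ≤ length A → ∀ a r → + n ≡ a ℤ.* + g ℤ.+ r → + 0 ℤ.≤ r → r ℤ.< + g →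
  ∃[ m ] (IsG g n m ×
          m ℤ.≤ + N ℤ.- ceiling (((+ N ℚ./ 1) ℚ.+ ((+ g ℤ.* a ℤ.* (a ℤ.- + 1)) ℚ./ 2) ℚ.+ ((r ℤ.* a) ℚ./ 1)) ℚ.* (+ 1 ℚ./ n)))
golomb-diameter-bound {g} {N} modular n n≤ a (+ r) n≡ (ℤ.+≤+ _) (ℤ.+<+ r<g)
  with quotient-nonNegative a n≡ r<g | modular⇒rulerDiameter modular n≤
... | b , refl , n≡bg+r | M , M≤N , diameter , bound with rulerDiameter⇒IsG diameter
...   | m , isG , m≤N∸M = m , isG , ℤₚ.≤-trans m≤N∸M (ℤₚ.≤-trans (ℤₚ.≤-reflexive (trans (sym (ℤₚ.⊖-≥ M≤N)) (sym (ℤₚ.m-n≡m⊖n N M))))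
        (ℤₚ.+-monoʳ-≤ (+ N) (ℤₚ.neg-mono-≤ (ceiling-bound N g n M (+ b) (+ r) (gap-bound⇒ N g n M b r n≡bg+r (bound b))))))

theorem5 :
    ∀ (q d g : ℕ) .{{_ : NonZero g}} →
    IsPrimePower q → 2 ℕ.≤ d →
    (q^[d-2]∣g : q ^ (d ∸ 2) ∣ g) →
    let η = quotient q^[d-2]∣g
        ρ = gcd η (q ∸ 1)
        N = (q ^ (d ∸ 2) ℕ.* (q ^ d ∸ 1)) / g
        marks = (+ (q ^ (d ∸ 1)) ℚ./ 1)
                  ℚ.- ((+ (q ^ (d ∸ 2)) ℤ.* (+ η ℤ.- + ρ)) ℚ./ 2)
    in
    η ∣ q ^ d ∸ 1 →
    (∃[ A ] (IsModularGolombRuler g N A × marks ℚ.≤ (+ length A ℚ./ 1)))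
    ×
    (∀ (n : ℕ) .{{_ : NonZero n}} → (+ n ℚ./ 1) ℚ.≤ marks →
     ∀ (a r : ℤ) → + n ≡ a ℤ.* + g ℤ.+ r → + 0 ℤ.≤ r → r ℤ.< + g →
     ∃[ m ] (IsG g n m ×
             m ℤ.≤ + N ℤ.- ceiling (((+ N ℚ./ 1)
                                      ℚ.+ ((+ g ℤ.* a ℤ.* (a ℤ.- + 1)) ℚ./ 2)
                                      ℚ.+ ((r ℤ.* a) ℚ./ 1))
                                    ℚ.* (+ 1 ℚ./ n))))
theorem5 q (suc zero) g _ (s≤s ())
theorem5 q (suc (suc d′)) g (p , k , p-prime , 1≤k , refl) 2≤d (divides η g≡) η∣ =
  (A , modular , marks≤A) ,
  λ n n≤marks → golomb-diameter-bound modular n (/1-cancel-≤ (ℚₚ.≤-trans n≤marks marks≤A))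
  where
  n = q ^ suc (suc d′) ∸ 1
  N = (q ^ d′ * n) / g
  ρ = gcd η (q ∸ 1)
  w = quotient (gcd[m,n]∣m η (q ∸ 1))

  instance
    q^d′≢0 : NonZero (q ^ d′)
    q^d′≢0 = m*n≢0⇒n≢0 η {{subst NonZero g≡ (ℕ.≢-nonZero (ℕ.≢-nonZero⁻¹ g))}}

  -- The division defining N is exact because g = η q^(d-2) with η ∣ q^d - 1; then q^(d-2) cancels.
  N*η≡n : N * η ≡ n
  N*η≡n = *-cancelʳ-≡ (N * η) n (q ^ d′) (begin
    N * η * q ^ d′       ≡⟨ *-assoc N η _ ⟩
    N * (η * q ^ d′)     ≡⟨ cong (N *_) g≡ ⟨
    N * g                ≡⟨ m/n*n≡m g∣ ⟩
    q ^ d′ * n           ≡⟨ *-comm (q ^ d′) n ⟩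
    n * q ^ d′           ∎)
    where
    open ≡-Reasoning
    g∣ : g ∣ q ^ d′ * n
    g∣ = subst (_∣ q ^ d′ * n) (trans (*-comm (q ^ d′) η) (sym g≡)) (*-monoʳ-∣ (q ^ d′) η∣)

  instance
    η≢0 : NonZero η
    η≢0 = m*n≢0⇒m≢0 η {{subst NonZero g≡ (ℕ.≢-nonZero (ℕ.≢-nonZero⁻¹ g))}}
    N≢0 : NonZero N
    N≢0 = m*n≢0⇒m≢0 N {{subst NonZero (sym N*η≡n) (ℕ.>-nonZero (0<q^d∸1 (1<p^k p-prime 1≤k) (suc d′)))}}

  η∣w[q-1] : η ∣ w * (q ∸ 1)
  η∣w[q-1] = divides u (begin
    w * (q ∸ 1)          ≡⟨ cong (w *_) (_∣_.equality (gcd[m,n]∣n η (q ∸ 1))) ⟩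
    w * (u * ρ)          ≡⟨ rot w u ρ ⟩
    u * (w * ρ)          ≡⟨ cong (u *_) (_∣_.equality (gcd[m,n]∣m η (q ∸ 1))) ⟨
    u * η                ∎)
    where
    open ≡-Reasoning
    u = quotient (gcd[m,n]∣n η (q ∸ 1))
    rot : ∀ a b c → a * (b * c) ≡ b * (a * c)
    rot = solve-∀

  module P = Projection (primePower⇒relativeDifferenceSet p-prime k d′ 1≤k) N η ρ w (sym N*η≡n)
    (trans (_∣_.equality (gcd[m,n]∣m η (q ∸ 1))) (*-comm w ρ)) η∣w[q-1]
  open P using (A; A-unique; A-golomb; A-size)

  modular : IsModularGolombRuler g N A
  modular = A-unique , λ d d≢0 → subst (length (pairsWithDifferenceMod A d) ≤_) (sym g≡) (A-golomb d d≢0)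

  marks≤A = marks≤ (q ^ suc d′) (q ^ d′) η ρ (length A) A-size
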